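{- For every prime $p$, the set $\mathcal R_p$ of quadratic residues modulo $p$ (the set of nonzero squares in $\mathbb F_p$, i.e. $\mu_{(p-1)/2}$ for odd $p$) cannot be written as $A+B=\{a+b:a\in A,b\in B\}$ with $A,B\subseteq\mathbb F_p$ and $|A|,|B|>1$. -}

module Defs where

open import Data.Nat using (ℕ; NonZero; _+_; _*_)
open import Data.Nat.DivMod using (_mod_)
open import Data.Fin using (Fin; toℕ)
open import Data.Fin.Subset using (Subset; _∈_)
open import Data.Product using (Σ; _×_)
open import Relation.Binary.PropositionalEquality using (_≡_; _≢_)

module _ (p : ℕ) .{{_ : NonZero p}} where

  _+ₚ_ : Fin p → Fin p → Fin p
  x +ₚ y = (toℕ x + toℕ y) mod p

  _*ₚ_ : Fin p → Fin p → Fin p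
  x *ₚ y = (toℕ x * toℕ y) mod p

  zeroₚ : Fin p
  zeroₚ = 0 mod p

  IsQR : Fin p → Set
  IsQR x = (x ≢ zeroₚ) × Σ (Fin p) (λ y → y *ₚ y ≡ x)

  QRIsSumset : Subset p → Subset p → Set
  QRIsSumset A B =
    ((x : Fin p) → IsQR x → Σ (Fin p) λ a → Σ (Fin p) λ b → a ∈ A × b ∈ B × a +ₚ b ≡ x)
    × ((a b : Fin p) → a ∈ A → b ∈ B → IsQR (a +ₚ b))

{-# OPTIONS --safe #-}
-- Replace A by -A, so that the nonzero squares are the differences b - a, and put n = |A|, k = |B|,
-- m = (p - 1) / 2, P = ∏ (X - a), Q = ∏ (X - b).
--
-- Following Hanson and Petridis, the polynomial h_m(X - a₁, …, X - aₙ) - 1, with h_m the complete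
-- homogeneous symmetric polynomial, has degree m and vanishes to order n at every b. Hence n k ≤ m, and
-- since all m squares are covered, n k = m and h_m(X - a₁, …, X - aₙ) - 1 = κ Qⁿ. Comparing expansions at
-- each b relates the Taylor coefficients of P and Q there; exchanging A and B gives the mirror relations.
--
-- The first relation is n (n + 1) Q″ P = 2 (m - 1) P′ Q′ at the roots of Q. Summed against powers of the
-- roots and compared with Σ (b - a)ʲ = 0 for 0 < j < m, at the first j for which the j-th power sum of A
-- (centred at its barycentre) is nonzero, it forces n = k, so p = 2 n² + 1.
--
-- Now W = n (Q″ P + P″ Q) - 2 (n - 1) P′ Q′ has degree less than 2 n and vanishes on A and B, so W = 0.
-- The second relation in the same way gives V = 0 for
-- V = (1 + 6 n) (Q‴ P - P‴ Q) + (25 - 14 n) (Q″ P′ - Q′ P″).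
-- Substituting W = V = 0 into the third relation leaves (4 + 43 n) P′³ = 0 on B, up to units. As
-- 2 · 4² + 43² = 3² · 11 · 19, for p ≠ 19 the polynomial P′ of degree n - 1 has n roots, which is absurd;
-- for p = 19 the identity W = 0 alone contradicts the choice of j.
module Submission where

open import Defs
open import Data.Nat using (ℕ; NonZero; _<_)
open import Data.Nat.Primality using (Prime)
open import Data.Fin.Subset using (Subset; ∣_∣)
open import Relation.Nullary using (¬_)

open import Algebra.Bundles using (CommutativeRing; CommutativeSemiring)
open import Data.Bool using (T)
open import Data.Empty using (⊥; ⊥-elim)
open import Data.Integer using (ℤ; +_; _+_; _*_; -_; _-_; _^_; 0ℤ; 1ℤ) renaming (∣_∣ to ∣_∣ᶻ)
open import Data.Integer.Divisibility.Signed using (divides; ∣⇒∣ᵤ; ∣ᵤ⇒∣)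
open import Data.Integer.DivMod using (_%ℕ_; _/ℕ_; n%ℕd<d; a≡a%ℕn+[a/ℕn]*n)
import Data.Integer.Properties as ℤₚ
open import Data.Integer.Tactic.RingSolver using (solve; solve-∀)
open import Data.List using (List; []; _∷_; length; map; foldr; _++_; applyUpTo)
open import Data.List.Membership.Propositional using (_∈_)
open import Data.List.Membership.Propositional.Properties using (∈-map⁺; ∈-map⁻)
open import Data.List.Properties using (length-map; length-++; length-applyUpTo; ++-identityʳ)
import Data.List.Relation.Unary.All as All
import Data.List.Relation.Unary.All.Properties as Allₚ
import Data.List.Relation.Unary.AllPairs as AllPairs
import Data.List.Relation.Unary.AllPairs.Properties as AllPairsₚ
open import Data.List.Relation.Unary.Any using (Any; here; there)
import Data.List.Relation.Unary.Any as Any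
import Data.List.Relation.Unary.Any.Properties as Anyₚ
open import Data.Nat using (zero; suc; _≤ᵇ_; _≤_; z≤n; s≤s; _∸_)
import Data.Nat as ℕ
import Data.Nat.Divisibility as ℕᵈ
open import Data.Nat.Primality using (euclidsLemma; prime⇒nonZero; prime⇒nonTrivial; prime?; ¬prime[1])
import Data.Nat.Properties as ℕₚ
open import Data.Product using (Σ; ∃; _×_; _,_; proj₁; proj₂)
open import Data.Sum using (_⊎_; inj₁; inj₂; [_,_]′)
open import Function using (id)
open import Level using (0ℓ)
open import Relation.Binary.Definitions using (tri<; tri≈; tri>)
open import Relation.Binary.PropositionalEquality using (_≡_; refl; sym; trans; cong; cong₂; subst; subst₂)
import Relation.Binary.Reasoning.Setoid as SetoidReasoning
open import Relation.Binary.Structures using (IsEquivalence)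
open import Relation.Nullary using (Dec; yes; no)
open import Relation.Nullary.Decidable using (from-no)

-- Why h_m: h_s(x₁, ..., xₙ) is the divided difference of X^(s+n-1) at the xᵢ. At the nodes xᵢ = b -
-- aᵢ the power X^m is constant, so exponents may be lowered by m. For m - n < s < m this leaves a
-- power of degree below n - 1, whose divided difference is zero. For s ≤ m - n the exponent turns
-- negative, and divided differences of negative powers are the coefficients of 1/P. As
-- differentiation takes h_s to a multiple of h_(s-1), these values are, up to such multiples, the
-- Taylor coefficients at b: the zeros give the order of vanishing, the later ones compare Qⁿ with
-- 1/P.
--
-- The obstacle is that such a comparison holds only at roots, with too many unknown coefficients at
-- each. Completing it to an expression symmetric or antisymmetric in P and Q makes it vanish at all
-- 2 n points, hence identically, and each further Taylor coefficient of the identity is a new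
-- equation at b. Since 2 N² = -1 modulo p, 1/N = -2 N and all coefficients reduce to the form r + s
-- N, so the elimination is linear algebra with fixed integers and fails at finitely many primes.

module Residues (p : ℕ) (p-prime : Prime p) where

  -- Residues modulo p

  infix 4 _≈_ _≉_

  -- Carrying the quotient turns each congruence rule into an identity of integers once `equal` is
  -- matched with `refl`, within reach of the ring solver.
  record _≈_ (x y : ℤ) : Set where
    constructor by
    field
      quot  : ℤ
      equal : x ≡ y + quot * + p

  _≉_ : ℤ → ℤ → Set
  x ≉ y = ¬ (x ≈ y)

  -- Opaque, so that no proof is ever evaluated during type checking.
  opaque
    ≈-reflexive : ∀ {x y} → x ≡ y → x ≈ y
    ≈-reflexive {x} refl = by 0ℤ (sym (ℤₚ.+-identityʳ x))

    ≈-refl : ∀ {x} → x ≈ x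
    ≈-refl = ≈-reflexive refl

    ≈-sym : ∀ {x y} → x ≈ y → y ≈ x
    ≈-sym {_} {y} (by q refl) = by (- q) (identity y q (+ p))
      where
      identity : ∀ y q r → y ≡ (y + q * r) + - q * r
      identity = solve-∀

    ≈-trans : ∀ {x y z} → x ≈ y → y ≈ z → x ≈ z
    ≈-trans {z = z} (by q refl) (by r refl) = by (r + q) (identity z q r (+ p))
      where
      identity : ∀ z q r s → (z + r * s) + q * s ≡ z + (r + q) * s
      identity = solve-∀

    +-cong : ∀ {x y u v} → x ≈ y → u ≈ v → x + u ≈ y + v
    +-cong {_} {y} {_} {v} (by q refl) (by r refl) = by (q + r) (identity y v q r (+ p))
      where
      identity : ∀ y v q r s → (y + q * s) + (v + r * s) ≡ (y + v) + (q + r) * s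
      identity = solve-∀

    *-cong : ∀ {x y u v} → x ≈ y → u ≈ v → x * u ≈ y * v
    *-cong {_} {y} {_} {v} (by q refl) (by r refl) =
      by (q * v + y * r + q * r * + p) (identity y v q r (+ p))
      where
      identity : ∀ y v q r s →
        (y + q * s) * (v + r * s) ≡ y * v + (q * v + y * r + q * r * s) * s
      identity = solve-∀

    +-congˡ : ∀ c {x y} → x ≈ y → c + x ≈ c + y
    +-congˡ c {x} {y} = +-cong {c} {c} {x} {y} ≈-refl

    +-congʳ : ∀ c {x y} → x ≈ y → x + c ≈ y + c
    +-congʳ c {x} {y} e = +-cong {x} {y} {c} {c} e ≈-refl

    *-congˡ : ∀ c {x y} → x ≈ y → c * x ≈ c * y
    *-congˡ c {x} {y} = *-cong {c} {c} {x} {y} ≈-refl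

    *-congʳ : ∀ c {x y} → x ≈ y → x * c ≈ y * c
    *-congʳ c {x} {y} e = *-cong {x} {y} {c} {c} e ≈-refl

    *-zeroʳ : ∀ c {x} → x ≈ 0ℤ → c * x ≈ 0ℤ
    *-zeroʳ c {x} e = ≈-trans (*-congˡ c {x} {0ℤ} e) (≈-reflexive (ℤₚ.*-zeroʳ c))

    *-zeroˡ : ∀ c {x} → x ≈ 0ℤ → x * c ≈ 0ℤ
    *-zeroˡ c {x} e = ≈-trans (*-congʳ c {x} {0ℤ} e) (≈-reflexive (ℤₚ.*-zeroˡ c))

    neg-cong : ∀ {x y} → x ≈ y → - x ≈ - y
    neg-cong {_} {y} (by q refl) = by (- q) (identity y q (+ p))
      where
      identity : ∀ y q s → - (y + q * s) ≡ - y + - q * s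
      identity = solve-∀

  residueRing : CommutativeRing 0ℓ 0ℓ
  residueRing = record
    { Carrier = ℤ ; _≈_ = _≈_ ; _+_ = _+_ ; _*_ = _*_ ; -_ = -_ ; 0# = 0ℤ ; 1# = 1ℤ
    ; isCommutativeRing = record
      { isRing = record
        { +-isAbelianGroup = record
          { isGroup = record
            { isMonoid = record
              { isSemigroup = record
                { isMagma = record
                  { isEquivalence = record { refl = ≈-refl ; sym = ≈-sym ; trans = ≈-trans }
                  ; ∙-cong = +-cong }
                ; assoc = λ x y z → ≈-reflexive (ℤₚ.+-assoc x y z) }
              ; identity = (λ x → ≈-reflexive (ℤₚ.+-identityˡ x))
                         , (λ x → ≈-reflexive (ℤₚ.+-identityʳ x)) }
            ; inverse = (λ x → ≈-reflexive (ℤₚ.+-inverseˡ x))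
                      , (λ x → ≈-reflexive (ℤₚ.+-inverseʳ x))
            ; ⁻¹-cong = neg-cong }
          ; comm = λ x y → ≈-reflexive (ℤₚ.+-comm x y) }
        ; *-cong = *-cong
        ; *-assoc = λ x y z → ≈-reflexive (ℤₚ.*-assoc x y z)
        ; *-identity = (λ x → ≈-reflexive (ℤₚ.*-identityˡ x))
                     , (λ x → ≈-reflexive (ℤₚ.*-identityʳ x))
        ; distrib = (λ x y z → ≈-reflexive (ℤₚ.*-distribˡ-+ x y z))
                  , (λ x y z → ≈-reflexive (ℤₚ.*-distribʳ-+ x y z)) }
      ; *-comm = λ x y → ≈-reflexive (ℤₚ.*-comm x y) } }

  open CommutativeRing residueRing public using () renaming (setoid to residueSetoid)

  -- Linear combinations of congruences to zero; `conclude` reduces a congruence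
  -- to an integer identity exhibiting the difference as such a combination.

  infixl 6 _⊕_

  infix 6.5 _·_

  opaque
    _⊕_ : ∀ {x y} → x ≈ 0ℤ → y ≈ 0ℤ → x + y ≈ 0ℤ
    _⊕_ = +-cong

    _·_ : ∀ c {x y} → x ≈ y → c * (x - y) ≈ 0ℤ
    _·_ c {_} {y} (by q refl) = by (c * q) (identity c y q (+ p))
      where
      identity : ∀ c y q s → c * ((y + q * s) - y) ≡ 0ℤ + (c * q) * s
      identity = solve-∀

    conclude : ∀ {x y z} → x - y ≡ z → z ≈ 0ℤ → x ≈ y
    conclude {x} {y} refl (by q e) = by q (trans (identity x y) (cong (λ w → y + w) (trans e (ℤₚ.+-identityˡ _))))
      where
      identity : ∀ x y → x ≡ y + (x - y)
      identity = solve-∀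

  combine : ∀ {x y z} → z ≈ 0ℤ → x - y ≡ z → x ≈ y
  combine e identity = conclude identity e

  difference-zero : ∀ {x y} → x ≈ y → x - y ≈ 0ℤ
  difference-zero {x} {y} e = conclude (identity x y) (1ℤ · e)
    where
    identity : ∀ x y → (x - y) - 0ℤ ≡ 1ℤ * (x - y)
    identity = solve-∀

  zero-difference : ∀ {x y} → x - y ≈ 0ℤ → x ≈ y
  zero-difference = conclude refl

  ≈0⇒∣ : ∀ {x} → x ≈ 0ℤ → p ℕᵈ.∣ ∣ x ∣ᶻ
  ≈0⇒∣ (by q e) = ∣⇒∣ᵤ {+ p} (divides q (trans e (ℤₚ.+-identityˡ _)))

  ∣⇒≈0 : ∀ {x} → p ℕᵈ.∣ ∣ x ∣ᶻ → x ≈ 0ℤ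
  ∣⇒≈0 {x} d with ∣ᵤ⇒∣ {+ p} {x} d
  ... | divides q e = by q (trans e (sym (ℤₚ.+-identityˡ _)))

  _≈0? : ∀ x → Dec (x ≈ 0ℤ)
  x ≈0? with p ℕᵈ.∣? ∣ x ∣ᶻ
  ... | yes d = yes (∣⇒≈0 d)
  ... | no ¬d = no (λ e → ¬d (≈0⇒∣ e))

  integral : ∀ x y → x * y ≈ 0ℤ → x ≈ 0ℤ ⊎ y ≈ 0ℤ
  integral x y e with euclidsLemma ∣ x ∣ᶻ ∣ y ∣ᶻ p-prime (subst (p ℕᵈ.∣_) (ℤₚ.∣i*j∣≡∣i∣*∣j∣ x y) (≈0⇒∣ e))
  ... | inj₁ d = inj₁ (∣⇒≈0 d)
  ... | inj₂ d = inj₂ (∣⇒≈0 d)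

  cancelˡ : ∀ {x y} → x ≉ 0ℤ → x * y ≈ 0ℤ → y ≈ 0ℤ
  cancelˡ {x} {y} x≉0 e with integral x y e
  ... | inj₁ x≈0 = ⊥-elim (x≉0 x≈0)
  ... | inj₂ y≈0 = y≈0

  *-nonzero : ∀ {x y} → x ≉ 0ℤ → y ≉ 0ℤ → x * y ≉ 0ℤ
  *-nonzero x≉0 y≉0 e = y≉0 (cancelˡ x≉0 e)

  1≉0 : 1ℤ ≉ 0ℤ
  1≉0 e = ¬prime[1] (subst Prime (ℕᵈ.∣1⇒≡1 (≈0⇒∣ e)) p-prime)

  ^-nonzero : ∀ {x} → x ≉ 0ℤ → ∀ n → x ^ n ≉ 0ℤ
  ^-nonzero x≉0 ℕ.zero    = 1≉0
  ^-nonzero x≉0 (ℕ.suc n) = *-nonzero x≉0 (^-nonzero x≉0 n)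

  ^-cong : ∀ {x y} → x ≈ y → ∀ n → x ^ n ≈ y ^ n
  ^-cong e ℕ.zero    = ≈-refl
  ^-cong e (ℕ.suc n) = *-cong e (^-cong e n)

  positive-nonzero : ∀ {n} → 0 ℕ.< n → n ℕ.< p → + n ≉ 0ℤ
  positive-nonzero {ℕ.suc n} _ n<p e = ℕᵈ.>⇒∤ n<p (≈0⇒∣ e)

  -- Elimination

  -- Near a point b of B write P = P₀ (1 + u z + x₂ z² + x₃ z³ + …) and Q = Q₁ (z + q₂ z² + q₃ z³ + q₄ z⁴ + …),
  -- and let N = |A| = |B|, so that 2 N² = -1. The coefficients come from Gaussian elimination over ℤ[N] among
  -- the relations collected in the record Jet and the coefficients of the identities W = 0 and V = 0.

  -- Because 2 N² = -1, division by N is multiplication by -2 N; applied to N q₂ = (N - 1) u it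
  -- gives the value of q₂.
  solve-q₂ : ∀ N u q₂ g₁ y₁ → g₁ - (N - + 1) * y₁ ≈ 0ℤ → g₁ - N * q₂ ≈ 0ℤ → y₁ - u ≈ 0ℤ → + 2 * (N * N)
    + + 1 ≈ 0ℤ
    → q₂ - (+ 1 + + 2 * N) * u ≈ 0ℤ
  solve-q₂ N u q₂ g₁ y₁ e₁ e₂ e₃ e₄ = combine ((- (+ 2 * N)) · e₁ ⊕ (+ 2 * N) · e₂
    ⊕ (- (+ 2 * N * (N - + 1))) · e₃ ⊕ (q₂ - u) · e₄)
    (solve (N ∷ u ∷ q₂ ∷ g₁ ∷ y₁ ∷ []))

  solve-g₁ : ∀ N u g₁ y₁ → g₁ - (N - + 1) * y₁ ≈ 0ℤ → y₁ - u ≈ 0ℤ → g₁ - (N - + 1) * u ≈ 0ℤ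
  solve-g₁ N u g₁ y₁ e₁ e₂ = combine (+ 1 · e₁ ⊕ (N - + 1) · e₂)
    (solve (N ∷ u ∷ g₁ ∷ y₁ ∷ []))

  solve-y₂ : ∀ u x₂ y₁ y₂ → y₂ - (u * y₁ - x₂) ≈ 0ℤ → y₁ - u ≈ 0ℤ → y₂ - (u * u - x₂) ≈ 0ℤ
  solve-y₂ u x₂ y₁ y₂ e₁ e₂ = combine (+ 1 · e₁ ⊕ u · e₂)
    (solve (u ∷ x₂ ∷ y₁ ∷ y₂ ∷ []))

  solve-y₃ : ∀ u x₂ x₃ y₁ y₂ y₃ → y₃ - (u * y₂ - x₂ * y₁ + x₃) ≈ 0ℤ → y₂ - (u * u - x₂) ≈ 0ℤ → y₁ - u ≈ 0ℤ
    → y₃ - (u * u * u - + 2 * u * x₂ + x₃) ≈ 0ℤ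
  solve-y₃ u x₂ x₃ y₁ y₂ y₃ e₁ e₂ e₃ = combine (+ 1 · e₁ ⊕ u · e₂ ⊕ (- x₂) · e₃)
    (solve (u ∷ x₂ ∷ x₃ ∷ y₁ ∷ y₂ ∷ y₃ ∷ []))

  solve-g₂ : ∀ N u q₂ q₃ g₁ g₂ → (+ 2 * g₂ + q₂ * g₁) - N * (+ 2 * q₃ + q₂ * g₁) ≈ 0ℤ
    → g₁ - (N - + 1) * u ≈ 0ℤ
    → q₂ - (+ 1 + + 2 * N) * u ≈ 0ℤ → + 2 * (N * N) + + 1 ≈ 0ℤ
    → + 4 * g₂ - (+ 4 * N * q₃ + (+ 5 - + 2 * N) * (u * u)) ≈ 0ℤ
  solve-g₂ N u q₂ q₃ g₁ g₂ e₁ e₂ e₃ e₄ = combine (+ 2 · e₁ ⊕ (+ 2 * (N - + 1) * q₂) · e₂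
    ⊕ (+ 2 * (N - + 1) * (N - + 1) * u) · e₃ ⊕ (+ 2 * N * u * u - + 3 * u * u) · e₄)
    (solve (N ∷ u ∷ q₂ ∷ q₃ ∷ g₁ ∷ g₂ ∷ []))

  solve-W₁ : ∀ N u x₂ q₂ q₃ → N * (+ 6 * q₃ + + 2 * q₂ * u + + 2 * x₂) - + 2 * (N - + 1) * (+ 2 * x₂
    + + 2 * u * q₂) ≈ 0ℤ
    → + 2 * (N * N) + + 1 ≈ 0ℤ → + 3 * q₃ - (+ 1 + + 4 * N) * (x₂ + u * q₂) ≈ 0ℤ
  solve-W₁ N u x₂ q₂ q₃ e₁ e₂ = combine ((- N) · e₁ ⊕ (- (q₂ * u) + + 3 * q₃ - x₂) · e₂)
    (solve (N ∷ u ∷ x₂ ∷ q₂ ∷ q₃ ∷ []))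

  -- The second-order ratio and the linear coefficient of `W` are two equations for q₃ and x₂ in
  -- terms of u²; here q₃ is eliminated between them.
  combine-x₂ : ∀ N u x₂ q₂ q₃ g₂ y₂ → (N + + 2) * g₂ - (N - + 1) * (N * N - + 2) * y₂ ≈ 0ℤ
    → + 4 * g₂ - (+ 4 * N * q₃ + (+ 5 - + 2 * N) * (u * u)) ≈ 0ℤ → y₂ - (u * u - x₂) ≈ 0ℤ
    → + 3 * q₃ - (+ 1 + + 4 * N) * (x₂ + u * q₂) ≈ 0ℤ → q₂ - (+ 1 + + 2 * N) * u ≈ 0ℤ → + 2 * (N * N)
    + + 1 ≈ 0ℤ
    → + 3 * ((+ 4 - + 10 * N) * x₂ - (+ 5 + N) * (u * u)) ≈ 0ℤ
  combine-x₂ N u x₂ q₂ q₃ g₂ y₂ e₁ e₂ e₃ e₄ e₅ e₆ = combine (+ 12 · e₁ ⊕ (- (+ 3 * (N + + 2))) · e₂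
    ⊕ (+ 12 * (N - + 1) * (N * N - + 2)) · e₃ ⊕ (- (+ 8 * N - + 2)) · e₄
    ⊕ (- ((+ 8 * N - + 2) * (+ 1 + + 4 * N) * u)) · e₅
    ⊕ (- (+ 26 * N * u * u) - + 6 * N * x₂ - + 6 * q₃ - + 19 * u * u - + 10 * x₂) · e₆)
    (solve (N ∷ u ∷ x₂ ∷ q₂ ∷ q₃ ∷ g₂ ∷ y₂ ∷ []))

  -- Multiplication by the conjugate: (4 - 10 N)(4 + 10 N) = 16 - 100 N² = 66 = 3 · 22.
  solve-x₂ : ∀ N u x₂ → (+ 4 - + 10 * N) * x₂ - (+ 5 + N) * (u * u) ≈ 0ℤ → + 2 * (N * N) + + 1 ≈ 0ℤ
    → + 3 * (+ 22 * x₂ - (+ 18 * N + + 5) * (u * u)) ≈ 0ℤ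
  solve-x₂ N u x₂ e₁ e₂ = combine ((+ 4 + + 10 * N) · e₁ ⊕ (+ 5 * u * u + + 50 * x₂) · e₂)
    (solve (N ∷ u ∷ x₂ ∷ []))

  solve-q₃ : ∀ N u x₂ q₂ q₃ → + 3 * q₃ - (+ 1 + + 4 * N) * (x₂ + u * q₂) ≈ 0ℤ
    → + 22 * x₂ - (+ 18 * N + + 5) * (u * u) ≈ 0ℤ → q₂ - (+ 1 + + 2 * N) * u ≈ 0ℤ → + 2 * (N * N) + + 1 ≈ 0ℤ
    → + 66 * q₃ - (+ 170 * N - + 97) * (u * u) ≈ 0ℤ
  solve-q₃ N u x₂ q₂ q₃ e₁ e₂ e₃ e₄ = combine (+ 22 · e₁ ⊕ (+ 1 + + 4 * N) · e₂
    ⊕ (+ 22 * (+ 1 + + 4 * N) * u) · e₃ ⊕ (+ 124 * u * u) · e₄)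
    (solve (N ∷ u ∷ x₂ ∷ q₂ ∷ q₃ ∷ []))

  -- The origin of the coefficients of `V`: 6 q₃ and 2 (u q₂ - x₂) equal u² times (170 N - 97)/11
  -- and (26 N + 17)/11, and 1 + 6 N and 25 - 14 N are in the ratio that makes these cancel modulo 2
  -- N² + 1.
  solve-V₀ : ∀ N u x₂ q₂ q₃ → + 66 * q₃ - (+ 170 * N - + 97) * (u * u) ≈ 0ℤ
    → + 22 * x₂ - (+ 18 * N + + 5) * (u * u) ≈ 0ℤ → q₂ - (+ 1 + + 2 * N) * u ≈ 0ℤ → + 2 * (N * N) + + 1 ≈ 0ℤ
    → + 11 * ((+ 1 + + 6 * N) * (+ 6 * q₃) + (+ 25 - + 14 * N) * (+ 2 * u * q₂ - + 2 * x₂)) ≈ 0ℤ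
  solve-V₀ N u x₂ q₂ q₃ e₁ e₂ e₃ e₄ = combine ((+ 1 + + 6 * N) · e₁ ⊕ (- (+ 25 - + 14 * N)) · e₂
    ⊕ (+ 22 * (+ 25 - + 14 * N) * u) · e₃ ⊕ (+ 328 * u * u) · e₄)
    (solve (N ∷ u ∷ x₂ ∷ q₂ ∷ q₃ ∷ []))

  solve-W₂ : ∀ N u x₂ x₃ q₂ q₃ q₄ → N * ((+ 12 * q₄ + + 6 * q₃ * u + + 2 * q₂ * x₂) + (+ 6 * x₃
    + + 2 * x₂ * q₂)) - + 2 * (N - + 1) * (+ 3 * x₃ + + 4 * x₂ * q₂ + + 3 * u * q₃) ≈ 0ℤ
    → + 2 * (+ 6 * N * q₄ + + 3 * x₃ + + 3 * q₃ * u + (+ 4 - + 2 * N) * x₂ * q₂) ≈ 0ℤ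
  solve-W₂ N u x₂ x₃ q₂ q₃ q₄ e₁ = combine (+ 1 · e₁)
    (solve (N ∷ u ∷ x₂ ∷ x₃ ∷ q₂ ∷ q₃ ∷ q₄ ∷ []))

  solve-V₁ : ∀ N u x₂ x₃ q₂ q₃ q₄ → (+ 1 + + 6 * N) * (+ 24 * q₄ + + 6 * q₃ * u - + 6 * x₃)
    + (+ 25 - + 14 * N) * ((+ 6 * q₃ * u + + 4 * q₂ * x₂) - (+ 6 * x₃ + + 4 * x₂ * q₂)) ≈ 0ℤ
    → + 12 * (+ 2 * (+ 1 + + 6 * N) * q₄ + (+ 13 - + 4 * N) * (q₃ * u - x₃)) ≈ 0ℤ
  solve-V₁ N u x₂ x₃ q₂ q₃ q₄ e₁ = combine (+ 1 · e₁)
    (solve (N ∷ u ∷ x₂ ∷ x₃ ∷ q₂ ∷ q₃ ∷ q₄ ∷ []))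

  reduce-V₁ : ∀ N u x₃ q₃ q₄ → + 2 * (+ 1 + + 6 * N) * q₄ + (+ 13 - + 4 * N) * (q₃ * u - x₃) ≈ 0ℤ
    → + 66 * q₃ - (+ 170 * N - + 97) * (u * u) ≈ 0ℤ
    → + 132 * (+ 1 + + 6 * N) * q₄ + (+ 13 - + 4 * N) * ((+ 170 * N - + 97) * (u * u * u) - + 66 * x₃) ≈ 0ℤ
  reduce-V₁ N u x₃ q₃ q₄ e₁ e₂ = combine (+ 66 · e₁ ⊕ (- ((+ 13 - + 4 * N) * u)) · e₂)
    (solve (N ∷ u ∷ x₃ ∷ q₃ ∷ q₄ ∷ []))

  reduce-W₂ : ∀ N u x₂ x₃ q₂ q₃ q₄ → + 6 * N * q₄ + + 3 * x₃ + + 3 * q₃ * u + (+ 4 - + 2 * N) * x₂ * q₂ ≈ 0ℤ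
    → + 66 * q₃ - (+ 170 * N - + 97) * (u * u) ≈ 0ℤ → q₂ - (+ 1 + + 2 * N) * u ≈ 0ℤ
    → + 22 * x₂ - (+ 18 * N + + 5) * (u * u) ≈ 0ℤ
    → + 396 * N * q₄ + + 198 * x₃ + (+ 3 * (+ 170 * N - + 97) + + 3 * (+ 4 - + 2 * N) * (+ 18 * N
    + + 5) * (+ 1 + + 2 * N)) * (u * u * u) ≈ 0ℤ
  reduce-W₂ N u x₂ x₃ q₂ q₃ q₄ e₁ e₂ e₃ e₄ = combine (+ 66 · e₁ ⊕ (- (+ 3 * u)) · e₂
    ⊕ (- (+ 66 * (+ 4 - + 2 * N) * x₂)) · e₃ ⊕ (- (+ 3 * (+ 4 - + 2 * N) * (+ 1 + + 2 * N) * u)) · e₄)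
    (solve (N ∷ u ∷ x₂ ∷ x₃ ∷ q₂ ∷ q₃ ∷ q₄ ∷ []))

  -- g₃ is eliminated between the power relation and the ratio of third order. The constant is 12
  -- (N² - 2)(N² - 3) = 12 · 35/4 = 105.
  solve-L₃ : ∀ N u x₂ x₃ q₂ q₃ q₄ g₁ g₂ g₃ y₃ → (+ 3 * g₃ + + 2 * q₂ * g₂ + q₃ * g₁) - N * (+ 3 * q₄
    + + 2 * q₃ * g₁ + q₂ * g₂) ≈ 0ℤ
    → (N + + 2) * (N + + 3) * g₃ - (N - + 1) * (N * N - + 2) * (N * N - + 3) * y₃ ≈ 0ℤ
    → y₃ - (u * u * u - + 2 * u * x₂ + x₃) ≈ 0ℤ → + 2 * (N * N) + + 1 ≈ 0ℤ
    → + 105 * (N - + 1) * (x₃ - + 2 * u * x₂ + u * u * u) + + 4 * ((N + + 2) * (N + + 3)) * (+ 2 * q₂ * g₂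
    + q₃ * g₁ - N * (+ 3 * q₄ + + 2 * q₃ * g₁ + q₂ * g₂)) ≈ 0ℤ
  solve-L₃ N u x₂ x₃ q₂ q₃ q₄ g₁ g₂ g₃ y₃ e₁ e₂ e₃ e₄ = combine ((+ 4 * ((N + + 2) * (N + + 3))) · e₁
    ⊕ (- (+ 12)) · e₂ ⊕ (- (+ 12 * (N - + 1) * (N * N - + 2) * (N * N - + 3))) · e₃
    ⊕ (- (+ 66 * N * u * x₂) + + 33 * N * u * u * u + + 33 * N * x₃ - + 12 * N * N * u * x₂
    + + 6 * N * N * u * u * u + + 6 * N * N * x₃
    + + 12 * N * N * N * u * x₂ - + 6 * N * N * N * u * u * u - + 6 * N * N * N * x₃
    + + 66 * u * x₂ - + 33 * u * u * u - + 33 * x₃) · e₄)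
    (solve (N ∷ u ∷ x₂ ∷ x₃ ∷ q₂ ∷ q₃ ∷ q₄ ∷ g₁ ∷ g₂ ∷ g₃ ∷ y₃ ∷ []))

  reduce-L₃ : ∀ N u x₂ x₃ q₂ q₃ q₄ g₁ g₂ → + 105 * (N - + 1) * (x₃ - + 2 * u * x₂ + u * u * u) + + 4 * ((N
    + + 2) * (N + + 3)) * (+ 2 * q₂ * g₂ + q₃ * g₁ - N * (+ 3 * q₄ + + 2 * q₃ * g₁ + q₂ * g₂)) ≈ 0ℤ
    → + 22 * x₂ - (+ 18 * N + + 5) * (u * u) ≈ 0ℤ → + 4 * g₂ - (+ 4 * N * q₃ + (+ 5 - + 2 * N) * (u * u)) ≈ 0ℤ
    → q₂ - (+ 1 + + 2 * N) * u ≈ 0ℤ → + 66 * q₃ - (+ 170 * N - + 97) * (u * u) ≈ 0ℤ → g₁ - (N - + 1) * u ≈ 0ℤ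
    → + 2 * (N * N) + + 1 ≈ 0ℤ
    → (+ 6930 * N - + 6930) * x₃ + (+ 1980 - + 4356 * N) * q₄ + (+ 7290 - + 1377 * N) * (u * u * u) ≈ 0ℤ
  reduce-L₃ N u x₂ x₃ q₂ q₃ q₄ g₁ g₂ e₁ e₂ e₃ e₄ e₅ e₆ e₇ = combine (+ 66 · e₁
    ⊕ (+ 105 * (N - + 1) * + 6 * u) · e₂ ⊕ (- (+ 66 * ((N + + 2) * (N + + 3)) * (+ 2 - N) * q₂)) · e₃
    ⊕ (- (+ 66 * ((N + + 2) * (N + + 3)) * (+ 2 - N) * (+ 4 * N * q₃ + (+ 5 - + 2 * N) * (u * u)))) · e₄
    ⊕ (- (((N + + 2) * (N + + 3)) * ((+ 2 - N) * (+ 1 + + 2 * N) * + 4 * N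
    + + 4 * (+ 1 - + 2 * N) * (N - + 1)) * u)) · e₅
    ⊕ (- (+ 264 * ((N + + 2) * (N + + 3)) * (+ 1 - + 2 * N) * q₃)) · e₆
    ⊕ (+ 396 * N * q₄ - + 10373 * N * u * u * u - + 1538 * N * N * u * u * u + + 2540 * N * N * N * u * u * u
    + + 680 * N * N * N * N * u * u * u + + 1980 * q₄ + + 4782 * u * u * u) · e₇)
    (solve (N ∷ u ∷ x₂ ∷ x₃ ∷ q₂ ∷ q₃ ∷ q₄ ∷ g₁ ∷ g₂ ∷ []))

  -- Three linear equations in x₃, q₄ and u³ over ℤ[N]; the multipliers cancel x₃ and q₄ modulo 2 N²
  -- + 1.
  eliminate : ∀ N u x₃ q₄ → + 132 * (+ 1 + + 6 * N) * q₄
    + (+ 13 - + 4 * N) * ((+ 170 * N - + 97) * (u * u * u) - + 66 * x₃) ≈ 0ℤ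
    → + 396 * N * q₄ + + 198 * x₃ + (+ 3 * (+ 170 * N - + 97) + + 3 * (+ 4 - + 2 * N) * (+ 18 * N
    + + 5) * (+ 1 + + 2 * N)) * (u * u * u) ≈ 0ℤ
    → (+ 6930 * N - + 6930) * x₃ + (+ 1980 - + 4356 * N) * q₄ + (+ 7290 - + 1377 * N) * (u * u * u) ≈ 0ℤ
    → + 2 * (N * N) + + 1 ≈ 0ℤ → + 360 * ((+ 4 + + 43 * N) * (u * u * u)) ≈ 0ℤ
  eliminate N u x₃ q₄ e₁ e₂ e₃ e₄ = combine ((+ 135 + + 144 * N) · e₁ ⊕ (- (+ 194 + + 676 * N)) · e₂
    ⊕ (- (+ 6 + + 38 * N)) · e₃
    ⊕ (+ 117240 * N * u * u * u - + 73008 * N * N * u * u * u - + 5940 * q₄ + + 170601 * u * u * u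
    + + 112662 * x₃) · e₄)
    (solve (N ∷ u ∷ x₃ ∷ q₄ ∷ []))

  -- Power series over the residues

  open All using (All; []; _∷_)
  open AllPairs using (AllPairs; []; _∷_)

  module ≈-Reasoning = SetoidReasoning residueSetoid

  Series : Set
  Series = ℕ → ℤ

  infix 4 _≋_

  record _≋_ (f g : Series) : Set where
    constructor ext
    field at : ∀ i → f i ≈ g i
  open _≋_ public

  ≋-refl : ∀ {f} → f ≋ f
  ≋-refl = ext λ i → ≈-refl

  ≋-sym : ∀ {f g} → f ≋ g → g ≋ f
  ≋-sym e = ext λ i → ≈-sym (at e i)

  ≋-trans : ∀ {f g h} → f ≋ g → g ≋ h → f ≋ h
  ≋-trans d e = ext λ i → ≈-trans (at d i) (at e i)

  tail : Series → Series
  tail f i = f (suc i)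

  infixl 6 _+ˢ_
  infixl 7 _*ˢ_ _•_

  _+ˢ_ : Series → Series → Series
  (f +ˢ g) i = f i + g i

  _•_ : ℤ → Series → Series
  (c • f) i = c * f i

  _*ˢ_ : Series → Series → Series
  (f *ˢ g) zero    = f 0 * g 0
  (f *ˢ g) (suc n) = f 0 * g (suc n) + (tail f *ˢ g) n

  const : ℤ → Series
  const c zero    = c
  const c (suc _) = 0ℤ

  -- The expansion of X at c.
  lin : ℤ → Series
  lin c zero          = c
  lin c (suc zero)    = 1ℤ
  lin c (suc (suc _)) = 0ℤ

  *ˢ-congₙ : ∀ {f f′ g g′} → (∀ i → f i ≈ f′ i) → (∀ i → g i ≈ g′ i) → ∀ n → (f *ˢ g) n ≈ (f′ *ˢ g′) n
  *ˢ-congₙ d e zero    = *-cong (d 0) (e 0)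
  *ˢ-congₙ d e (suc n) = +-cong (*-cong (d 0) (e (suc n))) (*ˢ-congₙ (λ i → d (suc i)) e n)

  *ˢ-cong : ∀ {f f′ g g′} → f ≋ f′ → g ≋ g′ → f *ˢ g ≋ f′ *ˢ g′
  *ˢ-cong d e = ext (*ˢ-congₙ (at d) (at e))

  +ˢ-cong : ∀ {f f′ g g′} → f ≋ f′ → g ≋ g′ → f +ˢ g ≋ f′ +ˢ g′
  +ˢ-cong d e = ext λ i → +-cong (at d i) (at e i)

  +ˢ-congˡ : ∀ f {g h} → g ≋ h → f +ˢ g ≋ f +ˢ h
  +ˢ-congˡ f e = +ˢ-cong (≋-refl {f}) e

  *ˢ-congˡ : ∀ f {g h} → g ≋ h → f *ˢ g ≋ f *ˢ h
  *ˢ-congˡ f e = *ˢ-cong (≋-refl {f}) e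

  *ˢ-congʳ : ∀ f {g h} → g ≋ h → g *ˢ f ≋ h *ˢ f
  *ˢ-congʳ f e = *ˢ-cong e (≋-refl {f})

  0*ˢ : ∀ g n → ((λ _ → 0ℤ) *ˢ g) n ≡ 0ℤ
  0*ˢ g zero    = ℤₚ.*-zeroˡ (g 0)
  0*ˢ g (suc n) rewrite 0*ˢ g n = refl

  *ˢ-distribʳ : ∀ h f g n → ((f +ˢ g) *ˢ h) n ≡ (f *ˢ h +ˢ g *ˢ h) n
  *ˢ-distribʳ h f g zero    = ℤₚ.*-distribʳ-+ (h 0) (f 0) (g 0)
  *ˢ-distribʳ h f g (suc n) rewrite *ˢ-distribʳ h (tail f) (tail g) n =
    identity (f 0) (g 0) (h (suc n)) _ _
    where
    identity : ∀ a b c d e → (a + b) * c + (d + e) ≡ (a * c + d) + (b * c + e)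
    identity = solve-∀

  •-*ˢ : ∀ c f g n → ((c • f) *ˢ g) n ≡ c * (f *ˢ g) n
  •-*ˢ c f g zero    = ℤₚ.*-assoc c (f 0) (g 0)
  •-*ˢ c f g (suc n) rewrite •-*ˢ c (tail f) g n = identity c (f 0) (g (suc n)) _
    where
    identity : ∀ c a b d → c * a * b + c * d ≡ c * (a * b + d)
    identity = solve-∀

  *ˢ-assoc : ∀ f g h n → ((f *ˢ g) *ˢ h) n ≡ (f *ˢ (g *ˢ h)) n
  *ˢ-assoc f g h zero    = ℤₚ.*-assoc (f 0) (g 0) (h 0)
  *ˢ-assoc f g h (suc n)
    rewrite *ˢ-distribʳ h (f 0 • tail g) (tail f *ˢ g) n
          | •-*ˢ (f 0) (tail g) h n
          | *ˢ-assoc (tail f) g h n = identity (f 0) (g 0) (h (suc n)) _ _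
    where
    identity : ∀ a b c d e → a * b * c + (a * d + e) ≡ a * (b * c + d) + e
    identity = solve-∀

  -- The defining recursion peels coefficients off the left factor; commutativity needs the same
  -- from the right.
  *ˢ-snoc : ∀ f g n → (f *ˢ g) (suc n) ≡ f (suc n) * g 0 + (f *ˢ tail g) n
  *ˢ-snoc f g zero    = ℤₚ.+-comm (f 0 * g 1) (f 1 * g 0)
  *ˢ-snoc f g (suc n) rewrite *ˢ-snoc (tail f) g n = identity (f 0 * g (suc (suc n))) (f (suc (suc n)) * g 0) _
    where
    identity : ∀ a b c → a + (b + c) ≡ b + (a + c)
    identity = solve-∀

  *ˢ-comm : ∀ f g n → (f *ˢ g) n ≡ (g *ˢ f) n
  *ˢ-comm f g zero    = ℤₚ.*-comm (f 0) (g 0)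
  *ˢ-comm f g (suc n) rewrite *ˢ-snoc g f n | *ˢ-comm (tail f) g n | ℤₚ.*-comm (f 0) (g (suc n)) = refl

  const-*ˢ : ∀ c g n → (const c *ˢ g) n ≡ c * g n
  const-*ˢ c g zero = refl
  const-*ˢ c g (suc n) rewrite 0*ˢ g n = ℤₚ.+-identityʳ _

  lin-*ˢ : ∀ c g n → (lin c *ˢ g) (suc n) ≡ c * g (suc n) + g n
  lin-*ˢ c g zero = cong (λ w → c * g 1 + w) (ℤₚ.*-identityˡ (g 0))
  lin-*ˢ c g (suc n) rewrite 0*ˢ g n = cong (λ w → c * g (suc (suc n)) + w)
    (trans (ℤₚ.+-identityʳ _) (ℤₚ.*-identityˡ (g (suc n))))

  seriesSemiring : CommutativeSemiring 0ℓ 0ℓ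
  seriesSemiring = record
    { Carrier = Series ; _≈_ = _≋_ ; _+_ = _+ˢ_ ; _*_ = _*ˢ_ ; 0# = const 0ℤ ; 1# = const 1ℤ
    ; isCommutativeSemiring = record
      { isSemiring = record
        { isSemiringWithoutAnnihilatingZero = record
          { +-isCommutativeMonoid = record
            { isMonoid = record
              { isSemigroup = record
                { isMagma = record
                  { isEquivalence = ≋-isEquivalence
                  ; ∙-cong = +ˢ-cong }
                ; assoc = λ f g h → pointwise λ i → ℤₚ.+-assoc (f i) (g i) (h i) }
              ; identity = +ˢ-identityˡ , λ f → pointwise λ i → trans (ℤₚ.+-comm (f i) _) (+-identity f i) }
            ; comm = λ f g → pointwise λ i → ℤₚ.+-comm (f i) (g i) }
          ; *-cong = *ˢ-cong
          ; *-assoc = λ f g h → pointwise (*ˢ-assoc f g h)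
          ; *-identity = *ˢ-identityˡ , λ f → ≋-trans (pointwise (*ˢ-comm f (const 1ℤ))) (*ˢ-identityˡ f)
          ; distrib = (λ h f g → pointwise λ n → trans (*ˢ-comm h (f +ˢ g) n)
                        (trans (*ˢ-distribʳ h f g n)
                          (trans (cong (λ w → w + (g *ˢ h) n) (*ˢ-comm f h n))
                            (cong (λ w → (h *ˢ f) n + w) (*ˢ-comm g h n)))))
                    , (λ h f g → pointwise (*ˢ-distribʳ h f g)) }
        ; zero = *ˢ-zeroˡ , λ f → ≋-trans (pointwise (*ˢ-comm f (const 0ℤ))) (*ˢ-zeroˡ f) }
      ; *-comm = λ f g → pointwise (*ˢ-comm f g) } }
    where
    pointwise : ∀ {f g} → (∀ i → f i ≡ g i) → f ≋ g
    pointwise e = ext λ i → ≈-reflexive (e i)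

    ≋-isEquivalence : IsEquivalence _≋_
    ≋-isEquivalence = record { refl = ≋-refl ; sym = ≋-sym ; trans = ≋-trans }

    +-identity : ∀ f i → (const 0ℤ +ˢ f) i ≡ f i
    +-identity f zero    = ℤₚ.+-identityˡ (f 0)
    +-identity f (suc i) = ℤₚ.+-identityˡ (f (suc i))

    +ˢ-identityˡ : ∀ f → const 0ℤ +ˢ f ≋ f
    +ˢ-identityˡ f = pointwise (+-identity f)

    *ˢ-identityˡ : ∀ f → const 1ℤ *ˢ f ≋ f
    *ˢ-identityˡ f = pointwise λ n → trans (const-*ˢ 1ℤ f n) (ℤₚ.*-identityˡ (f n))

    *ˢ-zeroˡ : ∀ f → const 0ℤ *ˢ f ≋ const 0ℤ
    *ˢ-zeroˡ f = pointwise λ where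
      zero    → ℤₚ.*-zeroˡ (f 0)
      (suc n) → trans (const-*ˢ 0ℤ f (suc n)) (ℤₚ.*-zeroˡ (f (suc n)))

  open CommutativeSemiring seriesSemiring public using () renaming (setoid to seriesSetoid)
  module ≋-Reasoning = SetoidReasoning seriesSetoid

  *ˢ-low : ∀ f {g} n → (∀ i → i ≤ n → g i ≈ 0ℤ) → (f *ˢ g) n ≈ 0ℤ
  *ˢ-low f zero    g≈0 = *-zeroʳ (f 0) (g≈0 0 z≤n)
  *ˢ-low f (suc n) g≈0 = *-zeroʳ (f 0) (g≈0 (suc n) ℕₚ.≤-refl)
                       ⊕ *ˢ-low (tail f) n (λ i i≤n → g≈0 i (ℕₚ.m≤n⇒m≤1+n i≤n))

  -- The lowest coefficient of `g` not yet known to vanish meets, in the product, only the unit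
  -- `f 0`.
  unit-order : ∀ {f g} → f 0 ≉ 0ℤ → ∀ e → (∀ i → i < e → (f *ˢ g) i ≈ 0ℤ) → ∀ i → i < e → g i ≈ 0ℤ
  unit-order f₀ zero h i ()
  unit-order {f} {g} f₀ (suc e) h i (s≤s i≤e) with ℕₚ.m≤n⇒m<n∨m≡n i≤e
  ... | inj₁ i<e  = below i i<e
    where
    below = unit-order {f} {g} f₀ e (λ j j<e → h j (ℕₚ.m≤n⇒m≤1+n j<e))
  ... | inj₂ refl = top e (unit-order {f} {g} f₀ e (λ j j<e → h j (ℕₚ.m≤n⇒m≤1+n j<e))) (h e ℕₚ.≤-refl)
    where
    top : ∀ e → (∀ j → j < e → g j ≈ 0ℤ) → (f *ˢ g) e ≈ 0ℤ → g e ≈ 0ℤ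
    top zero    below eq = cancelˡ f₀ eq
    top (suc e) below eq = cancelˡ f₀ (conclude (identity (f 0 * g (suc e)) _)
      (1ℤ · eq ⊕ (- 1ℤ) · *ˢ-low (tail f) {g} e (λ j j≤e → below j (s≤s j≤e))))
      where
      identity : ∀ a b → a - 0ℤ ≡ 1ℤ * ((a + b) - 0ℤ) + (- 1ℤ) * (b - 0ℤ)
      identity = solve-∀

  shift-order : ∀ {f g} → f 0 ≈ 0ℤ → f 1 ≉ 0ℤ → ∀ e → (∀ i → i < suc e → (f *ˢ g) i ≈ 0ℤ) → ∀ i → i < e → g i ≈ 0ℤ
  shift-order {f} {g} f₀ f₁ e h = unit-order {tail f} {g} f₁ e λ i i<e →
    conclude (identity (f 0) (g (suc i)) _) (1ℤ · h (suc i) (s≤s i<e) ⊕ (- g (suc i)) · f₀)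
    where
    identity : ∀ a b c → c - 0ℤ ≡ 1ℤ * ((a * b + c) - 0ℤ) + (- b) * (a - 0ℤ)
    identity = solve-∀

  -- Formal differentiation of power series

  D : Series → Series
  D f i = + suc i * f (suc i)

  D-cong : ∀ {f g} → f ≋ g → D f ≋ D g
  D-cong e = ext λ i → *-congˡ (+ suc i) (at e (suc i))

  private
    -- The operator z d/dz. Its weights add under convolution without an index shift, so the product
    -- rule is proved for it and read off for `D f i`, which is `euler f (suc i)`.
    euler : Series → Series
    euler f i = + i * f i

    *ˢ-congʳ-≡ : ∀ {f f′} g → (∀ i → f i ≡ f′ i) → ∀ n → (f *ˢ g) n ≡ (f′ *ˢ g) n
    *ˢ-congʳ-≡ g e zero    = cong (λ w → w * g 0) (e 0)
    *ˢ-congʳ-≡ {f′ = f′} g e (suc n) rewrite e 0 = cong (λ w → f′ 0 * g (suc n) + w) (*ˢ-congʳ-≡ g (λ i → e (suc i)) n)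

    suc-* : ∀ i x → (1ℤ + i) * x ≡ i * x + x
    suc-* = solve-∀

    euler-leibniz : ∀ f g n → euler (f *ˢ g) n ≡ (euler f *ˢ g +ˢ f *ˢ euler g) n
    euler-leibniz f g zero = identity (f 0) (g 0)
      where
      identity : ∀ a b → + 0 * (a * b) ≡ + 0 * a * b + a * (+ 0 * b)
      identity = solve-∀
    euler-leibniz f g (suc n)
      rewrite *ˢ-congʳ-≡ {tail (euler f)} {euler (tail f) +ˢ tail f} g (λ i → suc-* (+ i) (f (suc i))) n
            | *ˢ-distribʳ g (euler (tail f)) (tail f) n =
        trans (identity (+ n) (f 0) (g (suc n)) _)
          (trans (cong (λ w → f 0 * ((1ℤ + + n) * g (suc n)) + (tail f *ˢ g) n + w) (euler-leibniz (tail f) g n))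
            (identity′ (+ n) (f 0) (g (suc n)) _ ((euler (tail f) *ˢ g) n) ((tail f *ˢ euler g) n)))
      where
      identity : ∀ n a b c → (1ℤ + n) * (a * b + c) ≡ a * ((1ℤ + n) * b) + c + n * c
      identity = solve-∀
      identity′ : ∀ n a b c d e → a * ((1ℤ + n) * b) + c + (d + e) ≡
                   (+ 0 * a * b + (d + c)) + (a * ((1ℤ + n) * b) + e)
      identity′ = solve-∀

  D-leibniz : ∀ f g → D (f *ˢ g) ≋ D f *ˢ g +ˢ f *ˢ D g
  D-leibniz f g = ext λ n → ≈-reflexive (trans (euler-leibniz f g (suc n))
    (trans (cong (λ w → (euler f *ˢ g) (suc n) + w) (*ˢ-snoc f (euler g) n))
      (identity (f 0) (g (suc n)) (f (suc n)) (g 0) ((D f *ˢ g) n) ((f *ˢ D g) n))))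
    where
    identity : ∀ a b c d e x → (+ 0 * a * b + e) + (c * (+ 0 * d) + x) ≡ e + x
    identity = solve-∀

  infixr 8 _^ˢ_
  _^ˢ_ : Series → ℕ → Series
  f ^ˢ zero  = const 1ℤ
  f ^ˢ suc n = f *ˢ f ^ˢ n

  -- Polynomials

  open import Algebra.Solver.Ring.NaturalCoefficients.Default seriesSemiring 
    using (_:+_; _:*_; _:=_) renaming (solve to solveˢ)

  -- A polynomial is handled through its expansions at all points simultaneously.

  Family : Set
  Family = ℤ → Series

  -- Poly d Φ : the family Φ comes from a polynomial of degree less than d.
  data Poly : ℕ → Family → Set where
    null   : ∀ {Φ} → (∀ c → Φ c ≋ const 0ℤ) → Poly 0 Φ
    horner : ∀ {d Φ} α Ψ → Poly d Ψ → (∀ c → Φ c ≋ const α +ˢ lin c *ˢ Ψ c) → Poly (suc d) Φ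

  zero-const : ∀ {f} → (∀ i → f i ≈ 0ℤ) → f ≋ const 0ℤ
  zero-const e = ext λ where
    zero    → e 0
    (suc i) → e (suc i)

  const0-coeff : ∀ i → const 0ℤ i ≡ 0ℤ
  const0-coeff zero    = refl
  const0-coeff (suc i) = refl

  ≋0⇒ : ∀ {f} → f ≋ const 0ℤ → ∀ i → f i ≈ 0ℤ
  ≋0⇒ e i = ≈-trans (at e i) (≈-reflexive (const0-coeff i))

  const-cong : ∀ {a b} → a ≈ b → const a ≋ const b
  const-cong e = ext λ where
    zero    → e
    (suc i) → ≈-refl

  *ˢ-zeroʳ : ∀ f {g} → g ≋ const 0ℤ → f *ˢ g ≋ const 0ℤ
  *ˢ-zeroʳ f e = zero-const λ i → *ˢ-low f i (λ j _ → ≋0⇒ e j)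

  const-+ : ∀ a b → const (a + b) ≋ const a +ˢ const b
  const-+ a b = ext λ where
    zero    → ≈-refl
    (suc i) → ≈-refl

  const-* : ∀ a b → const (a * b) ≋ const a *ˢ const b
  const-* a b = ext λ i → ≈-sym (≈-trans (≈-reflexive (const-*ˢ a (const b) i)) (coeff i))
    where
    coeff : ∀ i → a * const b i ≈ const (a * b) i
    coeff zero    = ≈-refl
    coeff (suc i) = ≈-reflexive (ℤₚ.*-zeroʳ a)

  lin-split : ∀ c b → lin c ≋ lin (c - b) +ˢ const b
  lin-split c b = ext coeff
    where
    coeff : ∀ i → lin c i ≈ (lin (c - b) +ˢ const b) i
    coeff zero          = ≈-reflexive (identity c b)
      where
      identity : ∀ c b → c ≡ (c - b) + b
      identity = solve-∀
    coeff (suc zero)    = ≈-refl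
    coeff (suc (suc i)) = ≈-refl

  lin-shift : ∀ c b → lin (c - b) ≋ lin c +ˢ const (- b)
  lin-shift c b = ext λ where
    zero          → ≈-refl
    (suc zero)    → ≈-refl
    (suc (suc i)) → ≈-refl

  +ˢ-zeroʳ : ∀ f {g} → g ≋ const 0ℤ → f +ˢ g ≋ f
  +ˢ-zeroʳ f e = ext λ i → ≈-trans (+-congˡ (f i) (≋0⇒ e i)) (≈-reflexive (ℤₚ.+-identityʳ (f i)))

  +ˢ-zeroˡ : ∀ {f} g → f ≋ const 0ℤ → f +ˢ g ≋ g
  +ˢ-zeroˡ g e = ext λ i → ≈-trans (+-congʳ (g i) (≋0⇒ e i)) (≈-reflexive (ℤₚ.+-identityˡ (g i)))

  Poly-cong : ∀ {d Φ Φ′} → (∀ c → Φ′ c ≋ Φ c) → Poly d Φ → Poly d Φ′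
  Poly-cong e (null z)         = null λ c → ≋-trans (e c) (z c)
  Poly-cong e (horner α Ψ q h) = horner α Ψ q λ c → ≋-trans (e c) (h c)

  Poly-0 : ∀ d {Φ} → (∀ c → Φ c ≋ const 0ℤ) → Poly d Φ
  Poly-0 zero    z = null z
  Poly-0 (suc d) z = horner 0ℤ (λ _ → const 0ℤ) (Poly-0 d (λ _ → ≋-refl))
    λ c → ≋-trans (z c) (≋-sym (+ˢ-zeroʳ (const 0ℤ) (*ˢ-zeroʳ (lin c) ≋-refl)))

  Poly-≤ : ∀ {d e Φ} → d ≤ e → Poly d Φ → Poly e Φ
  Poly-≤ {e = e} z≤n (null z)      = Poly-0 e z
  Poly-≤ (s≤s d≤e) (horner α Ψ q h) = horner α Ψ (Poly-≤ d≤e q) h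

  Poly-const : ∀ α → Poly 1 (λ _ → const α)
  Poly-const α = horner α (λ _ → const 0ℤ) (null λ _ → ≋-refl)
    λ c → ≋-sym (+ˢ-zeroʳ (const α) (*ˢ-zeroʳ (lin c) ≋-refl))

  Poly-+ : ∀ {d Φ Ψ} → Poly d Φ → Poly d Ψ → Poly d (λ c → Φ c +ˢ Ψ c)
  Poly-+ {Ψ = Ψ} (null y) (null z) = null λ c → ≋-trans (+ˢ-zeroˡ (Ψ c) (y c)) (z c)
  Poly-+ (horner α Φ q h) (horner β Ψ r k) = horner (α + β) (λ c → Φ c +ˢ Ψ c) (Poly-+ q r) λ c →
    ≋-trans (+ˢ-cong (h c) (k c))
      (≋-trans (solveˢ 5 (λ a b x f g → (a :+ x :* f) :+ (b :+ x :* g) := (a :+ b) :+ x :* (f :+ g))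
                  ≋-refl (const α) (const β) (lin c) (Φ c) (Ψ c))
        (+ˢ-cong (≋-sym (const-+ α β)) ≋-refl))

  Poly-X : ∀ {d Φ} → Poly d Φ → Poly (suc d) (λ c → lin c *ˢ Φ c)
  Poly-X {Φ = Φ} q = horner 0ℤ Φ q λ c → ≋-sym (+ˢ-zeroˡ (lin c *ˢ Φ c) ≋-refl)

  Poly-• : ∀ {d Φ} α → Poly d Φ → Poly d (λ c → const α *ˢ Φ c)
  Poly-• α (null z) = null λ c → *ˢ-zeroʳ (const α) (z c)
  Poly-• α (horner β Ψ q h) = horner (α * β) (λ c → const α *ˢ Ψ c) (Poly-• α q) λ c →
    ≋-trans (*ˢ-cong ≋-refl (h c))
      (≋-trans (solveˢ 4 (λ a b x f → a :* (b :+ x :* f) := a :* b :+ x :* (a :* f))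
                  ≋-refl (const α) (const β) (lin c) (Ψ c))
        (+ˢ-cong (≋-sym (const-* α β)) ≋-refl))

  Poly-lin : ∀ {d Φ} a → Poly d Φ → Poly (suc d) (λ c → lin (c - a) *ˢ Φ c)
  Poly-lin {Φ = Φ} a q = Poly-cong
    (λ c → ≋-trans (*ˢ-cong (lin-shift c a) ≋-refl)
      (solveˢ 3 (λ x a f → (x :+ a) :* f := x :* f :+ a :* f) ≋-refl (lin c) (const (- a)) (Φ c)))
    (Poly-+ (Poly-X q) (Poly-≤ (ℕₚ.n≤1+n _) (Poly-• (- a) q)))

  Poly-* : ∀ {d e Φ Ψ} → Poly d Φ → Poly (suc e) Ψ → Poly (d ℕ.+ e) (λ c → Φ c *ˢ Ψ c)
  Poly-* {e = e} {Ψ = Ψ} (null z) r = Poly-0 e λ c →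
    ≋-trans (solveˢ 2 (λ f g → f :* g := g :* f) ≋-refl _ (Ψ c)) (*ˢ-zeroʳ (Ψ c) (z c))
  Poly-* {suc d} {e} {Φ} {Ψ} (horner α Φ′ q h) r = Poly-cong
    (λ c → ≋-trans (*ˢ-cong (h c) ≋-refl)
      (solveˢ 4 (λ a x f g → (a :+ x :* f) :* g := a :* g :+ x :* (f :* g)) ≋-refl (const α) (lin c) (Φ′ c) (Ψ c)))
    (Poly-+ (Poly-≤ (s≤s (ℕₚ.m≤n+m e d)) (Poly-• α r)) (Poly-X (Poly-* q r)))

  D-+ : ∀ f g → D (f +ˢ g) ≋ D f +ˢ D g
  D-+ f g = ext λ i → ≈-reflexive (ℤₚ.*-distribˡ-+ (+ suc i) (f (suc i)) (g (suc i)))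

  D-const : ∀ α → D (const α) ≋ const 0ℤ
  D-const α = zero-const λ i → *-zeroʳ (+ suc i) {0ℤ} ≈-refl

  D-lin : ∀ c → D (lin c) ≋ const 1ℤ
  D-lin c = ext λ where
    zero    → ≈-refl
    (suc i) → *-zeroʳ (+ suc (suc i)) {0ℤ} ≈-refl

  const1-* : ∀ f → const 1ℤ *ˢ f ≋ f
  const1-* f = ext λ i → ≈-reflexive (trans (const-*ˢ 1ℤ f i) (ℤₚ.*-identityˡ (f i)))

  D-lin-* : ∀ c f → D (lin c *ˢ f) ≋ f +ˢ lin c *ˢ D f
  D-lin-* c f = ≋-trans (D-leibniz (lin c) f)
    (+ˢ-cong (≋-trans (*ˢ-cong (D-lin c) ≋-refl) (const1-* f)) ≋-refl)

  Poly-D : ∀ {d Φ} → Poly (suc d) Φ → Poly d (λ c → D (Φ c))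
  Poly-D {Φ = Φ} (horner α Ψ q h) = Poly-cong derivative (sum q)
    where
    derivative : ∀ c → D (Φ c) ≋ Ψ c +ˢ lin c *ˢ D (Ψ c)
    derivative c = ≋-trans (D-cong (h c)) (≋-trans (D-+ (const α) (lin c *ˢ Ψ c))
      (≋-trans (+ˢ-zeroˡ _ (D-const α)) (D-lin-* c (Ψ c))))
    sum : ∀ {d} → Poly d Ψ → Poly d (λ c → Ψ c +ˢ lin c *ˢ D (Ψ c))
    sum (null z) = null λ c → ≋-trans (+ˢ-zeroˡ _ (z c))
      (*ˢ-zeroʳ (lin c) (≋-trans (D-cong (z c)) (D-const 0ℤ)))
    sum q@(horner _ _ _ _) = Poly-+ q (Poly-X (Poly-D q))

  -- Synthetic division: the Horner coefficients of the quotient are the values at `b` of the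
  -- successive tails of the Horner form of `Φ`.
  division : ∀ {d Φ} → Poly (suc d) Φ → ∀ b →
    Σ Family λ Ψ → Poly d Ψ × (∀ c → Φ c ≋ const (Φ b 0) +ˢ lin (c - b) *ˢ Ψ c)
  division {Φ = Φ} (horner α Ψ (null z) h) b = (λ _ → const 0ℤ) , null (λ _ → ≋-refl) , λ c →
    ≋-trans (h c) (+ˢ-cong (const-cong (≈-sym value))
      (≋-trans (*ˢ-zeroʳ (lin c) (z c)) (≋-sym (*ˢ-zeroʳ (lin (c - b)) ≋-refl))))
    where
    value : Φ b 0 ≈ α
    value = ≈-trans (at (h b) 0) (≈-trans (+-congˡ α (*-zeroʳ b (≋0⇒ (z b) 0))) (≈-reflexive (ℤₚ.+-identityʳ α)))
  division {Φ = Φ} (horner α Ψ q@(horner _ _ _ _) h) b with division q b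
  ... | Ψ₁ , q₁ , k = (λ c → const β +ˢ lin c *ˢ Ψ₁ c) , horner β Ψ₁ q₁ (λ _ → ≋-refl) , λ c →
    begin
      Φ c
        ≈⟨ h c ⟩
      const α +ˢ lin c *ˢ Ψ c
        ≈⟨ +ˢ-congˡ (const α) (*ˢ-cong (lin-split c b) (k c)) ⟩
      const α +ˢ (lin (c - b) +ˢ const b) *ˢ (const β +ˢ lin (c - b) *ˢ Ψ₁ c)
        ≈⟨ solveˢ 5 (λ α y b β ψ → α :+ (y :+ b) :* (β :+ y :* ψ) := (α :+ b :* β) :+ y :* (β :+ (y :+ b) :* ψ))
             ≋-refl (const α) (lin (c - b)) (const b) (const β) (Ψ₁ c) ⟩
      (const α +ˢ const b *ˢ const β) +ˢ lin (c - b) *ˢ (const β +ˢ (lin (c - b) +ˢ const b) *ˢ Ψ₁ c)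
        ≈⟨ +ˢ-cong value (*ˢ-congˡ (lin (c - b)) (+ˢ-congˡ (const β) (*ˢ-congʳ (Ψ₁ c) (≋-sym (lin-split c b))))) ⟩
      const (Φ b 0) +ˢ lin (c - b) *ˢ (const β +ˢ lin c *ˢ Ψ₁ c) ∎
    where
    open ≋-Reasoning
    β : ℤ
    β = Ψ b 0
    value : const α +ˢ const b *ˢ const β ≋ const (Φ b 0)
    value = ≋-trans (+ˢ-congˡ (const α) (≋-sym (const-* b β)))
      (≋-trans (≋-sym (const-+ α (b * β))) (const-cong (≈-sym (at (h b) 0))))

  -- Products of linear factors and division by roots

  Distinct : List ℤ → Set
  Distinct = AllPairs _≉_

  prod : List ℤ → Family
  prod bs c = foldr (λ b f → lin (c - b) *ˢ f) (const 1ℤ) bs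

  Poly-prod : ∀ bs → Poly (suc (length bs)) (prod bs)
  Poly-prod []       = Poly-const 1ℤ
  Poly-prod (b ∷ bs) = Poly-lin b (Poly-prod bs)

  difference-nonzero : ∀ {x y} → x ≉ y → x - y ≉ 0ℤ
  difference-nonzero x≉y e = x≉y (zero-difference e)

  ≉-sym : ∀ {x y} → x ≉ y → y ≉ x
  ≉-sym x≉y e = x≉y (≈-sym e)

  root-divides : ∀ {d Φ} bs → Distinct bs → All (λ b → Φ b 0 ≈ 0ℤ) bs → Poly (length bs ℕ.+ d) Φ →
    Σ Family λ Ψ → Poly d Ψ × (∀ c → Φ c ≋ prod bs c *ˢ Ψ c)
  root-divides {Φ = Φ} [] _ _ q = Φ , q , λ c → ≋-sym (const1-* (Φ c))
  root-divides {Φ = Φ} (b ∷ bs) (b≉ ∷ bs≉) (Φb ∷ Φbs) q with division q b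
  ... | Ψ , r , h = quotient (root-divides bs bs≉ (remaining b≉ Φbs) r)
    where
    factor : ∀ c → Φ c ≋ lin (c - b) *ˢ Ψ c
    factor c = ≋-trans (h c) (+ˢ-zeroˡ _ (const-cong Φb))
    remaining : ∀ {bs} → All (b ≉_) bs → All (λ b → Φ b 0 ≈ 0ℤ) bs → All (λ b → Ψ b 0 ≈ 0ℤ) bs
    remaining [] [] = []
    remaining {c ∷ _} (b≉c ∷ b≉) (Φc ∷ Φs) =
      cancelˡ (difference-nonzero (≉-sym b≉c)) (≈-trans (≈-sym (at (factor c) 0)) Φc) ∷ remaining b≉ Φs
    quotient : _ → _
    quotient (Ψ′ , r′ , h′) = Ψ′ , r′ , λ c → ≋-trans (factor c)
      (≋-trans (*ˢ-cong ≋-refl (h′ c))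
        (solveˢ 3 (λ x f g → x :* (f :* g) := (x :* f) :* g) ≋-refl (lin (c - b)) (prod bs c) (Ψ′ c)))

  many-roots⇒zero : ∀ {d Φ} bs → Distinct bs → All (λ b → Φ b 0 ≈ 0ℤ) bs → Poly d Φ → d ≤ length bs → ∀ c → Φ c ≋ const 0ℤ
  many-roots⇒zero {Φ = Φ} bs bs≉ Φbs q d≤ c with root-divides bs bs≉ Φbs
    (subst (λ e → Poly e Φ) (sym (ℕₚ.+-identityʳ _)) (Poly-≤ d≤ q))
  ... | Ψ , null z , h = ≋-trans (h c) (*ˢ-zeroʳ (prod bs c) (z c))

  prod-value-nonzero : ∀ {c} bs → All (c ≉_) bs → prod bs c 0 ≉ 0ℤ
  prod-value-nonzero []       []           = 1≉0
  prod-value-nonzero (b ∷ bs) (c≉b ∷ c≉bs) = *-nonzero (difference-nonzero c≉b) (prod-value-nonzero bs c≉bs)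

  prod-root : ∀ {b} bs → b ∈ bs → prod bs b 0 ≈ 0ℤ
  prod-root {b} (_ ∷ bs) (here refl) = *-zeroˡ (prod bs b 0) (≈-reflexive (ℤₚ.+-inverseʳ b))
  prod-root {b} (c ∷ bs) (there b∈)  = *-zeroʳ (b - c) (prod-root bs b∈)

  prod-simple-root : ∀ {b} bs → Distinct bs → b ∈ bs → prod bs b 1 ≉ 0ℤ
  prod-simple-root {b} (_ ∷ bs) (b≉ ∷ _) (here refl) e = prod-value-nonzero bs b≉
    (conclude (identity b (prod bs b 1) (prod bs b 0)) (1ℤ · e))
    where
    identity : ∀ b f g → g - 0ℤ ≡ 1ℤ * (((b - b) * f + 1ℤ * g) - 0ℤ)
    identity = solve-∀
  prod-simple-root {b} (c ∷ bs) (c≉ ∷ bs≉) (there b∈) e =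
    *-nonzero (difference-nonzero (≉-sym (All.lookup c≉ b∈))) (prod-simple-root bs bs≉ b∈)
      (conclude (identity b c (prod bs b 1) (prod bs b 0)) (1ℤ · e ⊕ (- 1ℤ) · prod-root bs b∈))
    where
    identity : ∀ b c f g → (b - c) * f - 0ℤ ≡ 1ℤ * (((b - c) * f + 1ℤ * g) - 0ℤ) + (- 1ℤ) * (g - 0ℤ)
    identity = solve-∀

  -- Fermat's little theorem

  open import Data.List.Relation.Binary.Permutation.Setoid residueSetoid
    using (_↭_; prep; swap; ↭-refl; ↭-trans; ↭-reflexive)
  open import Data.List.Relation.Binary.Permutation.Setoid.Properties residueSetoid
    using (foldr-commMonoid; map⁺; ∈-resp-↭; xs↭ys⇒|xs|≡|ys|)

  extract : ∀ {x ys} → Any (x ≈_) ys → ∃ λ zs → ys ↭ x ∷ zs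
  extract {ys = _ ∷ ys} (here e) = ys , prep (≈-sym e) ↭-refl
  extract {x} {y ∷ _} (there i) with extract i
  ... | zs , σ = y ∷ zs , ↭-trans (prep ≈-refl σ) (swap ≈-refl ≈-refl ↭-refl)

  distinct-⊆ : ∀ xs {ys} → Distinct xs → All (λ x → Any (x ≈_) ys) xs → ∃ λ zs → ys ↭ xs ++ zs
  distinct-⊆ []       {ys} []         []         = ys , ↭-refl
  distinct-⊆ (x ∷ xs) {ys} (x≉ ∷ xs≉) (x∈ ∷ xs∈) with extract x∈
  ... | ys′ , σ with distinct-⊆ xs xs≉ (remaining x≉ xs∈)
    where
    remaining : ∀ {xs} → All (x ≉_) xs → All (λ z → Any (z ≈_) ys) xs → All (λ z → Any (z ≈_) ys′) xs
    remaining [] [] = []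
    remaining (x≉z ∷ x≉) (z∈ ∷ zs∈) with ∈-resp-↭ σ z∈
    ... | here e  = ⊥-elim (x≉z (≈-sym e))
    ... | there i = i ∷ remaining x≉ zs∈
  ... | zs , τ = zs , ↭-trans σ (prep ≈-refl τ)

  distinct-length : ∀ xs {ys} → Distinct xs → All (λ x → Any (x ≈_) ys) xs → length xs ≤ length ys
  distinct-length xs xs≉ xs∈ with distinct-⊆ xs xs≉ xs∈
  ... | zs , σ = subst (length xs ≤_) (sym (trans (xs↭ys⇒|xs|≡|ys| σ) (length-++ xs))) (ℕₚ.m≤m+n _ _)

  -- `ys` may have repetitions a priori; its length leaves no room for them. This matters for the
  -- list of all differences b - a.
  distinct-↭ : ∀ xs {ys} → Distinct xs → All (λ x → Any (x ≈_) ys) xs → length ys ≤ length xs → ys ↭ xs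
  distinct-↭ xs xs≉ xs∈ le with distinct-⊆ xs xs≉ xs∈
  ... | [] , σ = ↭-trans σ (↭-reflexive (++-identityʳ xs))
  ... | z ∷ zs , σ = ⊥-elim (ℕₚ.m+1+n≰m (length xs)
    (subst (_≤ length xs) (trans (xs↭ys⇒|xs|≡|ys| σ) (length-++ xs)) le))

  naturals-distinct : ∀ {i j} → i < j → j < p → + i ≉ + j
  naturals-distinct {i} {j} i<j j<p e = positive-nonzero (ℕₚ.m<n⇒0<n∸m i<j) (ℕₚ.≤-<-trans (ℕₚ.m∸n≤m j i) j<p)
    (subst (_≈ 0ℤ) (trans (ℤₚ.m-n≡m⊖n j i) (ℤₚ.⊖-≥ (ℕₚ.<⇒≤ i<j))) (difference-zero (≈-sym e)))

  instance
    p-nonZero : NonZero p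
    p-nonZero = prime⇒nonZero p-prime

  p≡1+[p∸1] : p ≡ suc (p ∸ 1)
  p≡1+[p∸1] = sym (ℕₚ.suc-pred p)

  units : List ℤ
  units = applyUpTo (λ i → + suc i) (p ∸ 1)

  residue-≈ : ∀ x → x ≈ + (x %ℕ p)
  residue-≈ x = by (x /ℕ p) (a≡a%ℕn+[a/ℕn]*n x p)

  ∈-units : ∀ {x} → x ≉ 0ℤ → Any (x ≈_) units
  ∈-units {x} x≉0 with x %ℕ p | n%ℕd<d x p | residue-≈ x
  ... | zero  | _   | e = ⊥-elim (x≉0 e)
  ... | suc i | i<p | e = Anyₚ.applyUpTo⁺ (λ i → + suc i) e (ℕₚ.≤-pred (subst (suc i <_) p≡1+[p∸1] i<p))

  units-distinct : Distinct units
  units-distinct = AllPairsₚ.applyUpTo⁺₁ (λ i → + suc i) (p ∸ 1)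
    (λ i<j j<p → naturals-distinct (s≤s i<j) (subst (suc _ <_) (sym p≡1+[p∸1]) (s≤s j<p)))

  units-nonzero : All (_≉ 0ℤ) units
  units-nonzero = Allₚ.applyUpTo⁺₁ (λ i → + suc i) (p ∸ 1)
    (λ i<p → positive-nonzero (s≤s z≤n) (subst (suc _ <_) (sym p≡1+[p∸1]) (s≤s i<p)))

  *-injective : ∀ {g x y} → g ≉ 0ℤ → x ≉ y → g * x ≉ g * y
  *-injective {g} {x} {y} g≉0 x≉y e = *-nonzero g≉0 (difference-nonzero x≉y)
    (conclude (identity g x y) (1ℤ · e))
    where
    identity : ∀ g x y → g * (x - y) - 0ℤ ≡ 1ℤ * (g * x - g * y)
    identity = solve-∀

  scale-distinct : ∀ {g xs} → g ≉ 0ℤ → Distinct xs → Distinct (map (λ x → g * x) xs)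
  scale-distinct g≉0 xs≉ = AllPairsₚ.map⁺ (AllPairs.map (*-injective g≉0) xs≉)

  product : List ℤ → ℤ
  product = foldr _*_ 1ℤ

  product-scale : ∀ g xs → product (map (λ x → g * x) xs) ≡ g ^ length xs * product xs
  product-scale g []       = refl
  product-scale g (x ∷ xs) rewrite product-scale g xs = identity g x (g ^ length xs) (product xs)
    where
    identity : ∀ g x a b → g * x * (a * b) ≡ g * a * (x * b)
    identity = solve-∀

  product-nonzero : ∀ {xs} → All (_≉ 0ℤ) xs → product xs ≉ 0ℤ
  product-nonzero []         = 1≉0
  product-nonzero (x≉ ∷ xs≉) = *-nonzero x≉ (product-nonzero xs≉)

  fermat : ∀ {g} → g ≉ 0ℤ → g ^ (p ∸ 1) ≈ 1ℤ
  fermat {g} g≉0 = zero-difference (cancelˡ (product-nonzero units-nonzero)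
    (conclude (identity (product units) (g ^ (p ∸ 1))) (1ℤ · ≈-sym products)))
    where
    identity : ∀ π x → π * (x - 1ℤ) - 0ℤ ≡ 1ℤ * (x * π - π)
    identity = solve-∀
    permutation : units ↭ map (λ x → g * x) units
    permutation = distinct-↭ _ (scale-distinct g≉0 units-distinct)
      (Allₚ.map⁺ (All.map (λ x≉0 → ∈-units (*-nonzero g≉0 x≉0)) units-nonzero))
      (ℕₚ.≤-reflexive (sym (length-map _ units)))
    products : product units ≈ g ^ (p ∸ 1) * product units
    products = ≈-trans (foldr-commMonoid (CommutativeRing.*-isCommutativeMonoid residueRing) permutation)
      (≈-reflexive (trans (product-scale g units)
        (cong (λ n → g ^ n * product units) (length-applyUpTo (λ i → + suc i) (p ∸ 1)))))

  2≤p : 2 ≤ p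
  2≤p = ℕ.nonTrivial⇒n>1 p {{prime⇒nonTrivial p-prime}}

  opaque
    -- A total inverse. For p > 2 it sends 0 to 0, so double sums of `inv (x - y)` may run over the
    -- diagonal.
    inv : ℤ → ℤ
    inv x = x ^ (p ∸ 2)

    inv-inverse : ∀ {x} → x ≉ 0ℤ → x * inv x ≈ 1ℤ
    inv-inverse {x} x≉0 = subst (λ n → x ^ n ≈ 1ℤ) (ℕₚ.+-∸-assoc 1 2≤p) (fermat x≉0)

    inv-zero : 2 < p → ∀ {x} → x ≈ 0ℤ → inv x ≈ 0ℤ
    inv-zero 2<p {x} e =
      subst (λ k → x ^ k ≈ 0ℤ) (ℕₚ.m+[n∸m]≡n {1} (ℕₚ.m<n⇒0<n∸m 2<p)) (*-zeroˡ (x ^ (p ∸ 2 ∸ 1)) e)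

  -- Complete homogeneous symmetric polynomials

  complete : List ℤ → ℕ → ℤ
  complete []       zero    = 1ℤ
  complete []       (suc s) = 0ℤ
  complete (x ∷ xs) zero    = 1ℤ
  complete (x ∷ xs) (suc s) = complete xs (suc s) + x * complete (x ∷ xs) s

  -- The recurrence of divided differences, h_s at n points being the divided difference of
  -- X^(s+n-1).
  complete-exchange : ∀ x y zs s →
    (x - y) * complete (x ∷ y ∷ zs) s ≡ complete (x ∷ zs) (suc s) - complete (y ∷ zs) (suc s)
  complete-exchange x y zs s = trans (exchange s)
    (cancel (complete zs (suc s)) (x * complete (x ∷ zs) s) (y * complete (y ∷ zs) s))
    where
    cancel : ∀ k a b → a - b ≡ (k + a) - (k + b)
    cancel = solve-∀
    base : ∀ x y → (x - y) * 1ℤ ≡ x * 1ℤ - y * 1ℤ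
    base = solve-∀
    split : ∀ x y k hy h → (x - y) * ((k + y * hy) + x * h) ≡ (x - y) * (k + y * hy) + x * ((x - y) * h)
    split = solve-∀
    join : ∀ x y k hx hy → (x - y) * (k + y * hy) + x * (x * hx - y * hy) ≡ x * (k + x * hx) - y * (k + y * hy)
    join = solve-∀
    exchange : ∀ s → (x - y) * complete (x ∷ y ∷ zs) s ≡ x * complete (x ∷ zs) s - y * complete (y ∷ zs) s
    exchange zero    = base x y
    exchange (suc s) = trans (split x y (complete zs (suc s)) (complete (y ∷ zs) s) (complete (x ∷ y ∷ zs) s))
      (trans (cong (λ w → (x - y) * (complete zs (suc s) + y * complete (y ∷ zs) s) + x * w) (exchange s))
        (join x y (complete zs (suc s)) (complete (x ∷ zs) s) (complete (y ∷ zs) s)))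

  complete-singleton : ∀ x s → complete (x ∷ []) s ≡ x ^ s
  complete-singleton x zero    = refl
  complete-singleton x (suc s) = trans (ℤₚ.+-identityˡ _) (cong (λ w → x * w) (complete-singleton x s))

  module PowerRoots (m′ : ℕ) (χ : ℤ) where
    private
      m : ℕ
      m = suc m′

    -- `complete-exchange` writes the value on one more node as a difference of two values that
    -- agree: both are `χ` at index m, both are zero below it. At index m itself the recursion of
    -- `complete` adds x times a value already known to vanish.
    complete-vanishes : ∀ x xs → Distinct (x ∷ xs) → All (λ x → x ^ m ≈ χ) (x ∷ xs) →
      complete (x ∷ xs) m ≈ χ × (∀ s → s < m → m ≤ s ℕ.+ length xs → complete (x ∷ xs) s ≈ 0ℤ)
    complete-vanishes x [] _ (xᵐ ∷ []) =
      ≈-trans (≈-reflexive (complete-singleton x m)) xᵐ ,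
      λ s s<m m≤s → ⊥-elim (ℕₚ.<⇒≱ s<m (subst (m ≤_) (ℕₚ.+-identityʳ s) m≤s))
    complete-vanishes x (y ∷ xs) ((x≉y ∷ x≉) ∷ y≉ ∷ xs≉) (xᵐ ∷ yᵐ ∷ xsᵐ)
      with complete-vanishes x xs (x≉ ∷ xs≉) (xᵐ ∷ xsᵐ) | complete-vanishes y xs (y≉ ∷ xs≉) (yᵐ ∷ xsᵐ)
    ... | topx , lowx | topy , lowy = top , low
      where
      equal : ∀ s → suc s ≤ m → m ≤ suc s ℕ.+ length xs → complete (x ∷ xs) (suc s) ≈ complete (y ∷ xs) (suc s)
      equal s s<m m≤ with ℕₚ.m≤n⇒m<n∨m≡n s<m
      ... | inj₂ refl = ≈-trans topx (≈-sym topy)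
      ... | inj₁ 1+s<m = ≈-trans (lowx (suc s) 1+s<m m≤) (≈-sym (lowy (suc s) 1+s<m m≤))
      low : ∀ s → s < m → m ≤ s ℕ.+ length (y ∷ xs) → complete (x ∷ y ∷ xs) s ≈ 0ℤ
      low s s<m m≤ = cancelˡ (difference-nonzero x≉y) (≈-trans (≈-reflexive (complete-exchange x y xs s))
        (difference-zero (equal s s<m (subst (m ≤_) (ℕₚ.+-suc s _) m≤))))
      top : complete (x ∷ y ∷ xs) m ≈ χ
      top = ≈-trans (+-cong topy (*-zeroʳ x (low m′ ℕₚ.≤-refl
              (subst (m ≤_) (sym (ℕₚ.+-suc m′ _)) (s≤s (ℕₚ.m≤m+n m′ _)))))) (≈-reflexive (ℤₚ.+-identityʳ χ))

  -- Complete symmetric polynomials of low index and the inverse of P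

  sgn : ℕ → ℤ
  sgn zero    = 1ℤ
  sgn (suc l) = - sgn l

  *ˢ-cong-≤ : ∀ f {g h} n → (∀ i → i ≤ n → g i ≈ h i) → (f *ˢ g) n ≈ (f *ˢ h) n
  *ˢ-cong-≤ f zero    e = *-congˡ (f 0) (e 0 z≤n)
  *ˢ-cong-≤ f (suc n) e = +-cong (*-congˡ (f 0) (e (suc n) ℕₚ.≤-refl))
    (*ˢ-cong-≤ (tail f) n (λ i i≤n → e i (ℕₚ.m≤n⇒m≤1+n i≤n)))

  *ˢ-• : ∀ f c g n → (f *ˢ (c • g)) n ≡ c * (f *ˢ g) n
  *ˢ-• f c g n = trans (*ˢ-comm f (c • g) n) (trans (•-*ˢ c g f n) (cong (λ w → c * w) (*ˢ-comm g f n)))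

  ∸-pred : ∀ {m k} → k < m → m ∸ k ≡ suc (m ∸ suc k)
  ∸-pred = ℕₚ.+-∸-assoc 1

  ∸-suc : ∀ {m} n l → n ℕ.+ suc l ≤ m → m ∸ (n ℕ.+ l) ≡ suc (m ∸ (n ℕ.+ suc l))
  ∸-suc {m} n l le rewrite ℕₚ.+-suc n l = ∸-pred le

  module Dual (m′ : ℕ) (χ : ℤ) where
    private
      m : ℕ
      m = suc m′
    open PowerRoots m′ χ

    -- Where all x satisfy x^m = χ, h_(m-n-l)(x) is (-1)^(n-1) χ / ∏ x times h_l of the inverses
    -- 1/x. With alternating signs these are, up to a constant, the coefficients of 1 / ∏ (x + z).
    -- The truncated index is meaningful while `length xs ℕ.+ l ≤ m`.
    dual : List ℤ → Series
    dual xs l = sgn l * complete xs (m ∸ (length xs ℕ.+ l))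

    dual-singleton : ∀ x → x ^ m ≈ χ → ∀ l → l < m → (lin x *ˢ dual (x ∷ [])) l ≈ const χ l
    dual-singleton x xᵐ zero _ =
      ≈-trans (≈-reflexive (trans (cong (λ w → x * w) (trans (ℤₚ.*-identityˡ _) (complete-singleton x m′))) refl)) xᵐ
    dual-singleton x xᵐ (suc l) l<m = ≈-reflexive (trans (lin-*ˢ x (dual (x ∷ [])) l)
      (trans (cong (λ w → x * (- sgn l * complete (x ∷ []) (m′ ∸ suc l)) + sgn l * w) shifted)
        (identity x (sgn l) (complete (x ∷ []) (m′ ∸ suc l)))))
      where
      shifted : complete (x ∷ []) (m′ ∸ l) ≡ 0ℤ + x * complete (x ∷ []) (m′ ∸ suc l)
      shifted = cong (complete (x ∷ [])) (∸-suc 0 l (ℕₚ.≤-pred l<m))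
      identity : ∀ x σ h → x * (- σ * h) + σ * (0ℤ + x * h) ≡ 0ℤ
      identity = solve-∀

    -- In positive degree this is the recursion of `complete` that removes the node x. In degree
    -- zero the recursion leaves an extra term h_(m-n+1), which vanishes on these nodes.
    dual-step : ∀ x y xs → Distinct (x ∷ y ∷ xs) → All (λ x → x ^ m ≈ χ) (x ∷ y ∷ xs) →
      ∀ l → length (x ∷ y ∷ xs) ℕ.+ l ≤ m → (lin x *ˢ dual (x ∷ y ∷ xs)) l ≈ (- 1ℤ) * dual (y ∷ xs) l
    dual-step x y xs distinct powers zero le =
      conclude (trans (cong (λ w → x * (1ℤ * h) - (- 1ℤ) * (1ℤ * w)) (cong (complete (y ∷ xs)) index))
                 (identity x h (complete (y ∷ xs) (suc s))))
        (1ℤ · proj₂ (complete-vanishes x (y ∷ xs) distinct powers) (suc s) s<m m≤)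
      where
      n′ s : ℕ
      n′ = length xs ℕ.+ 0
      s = m′ ∸ suc n′
      h : ℤ
      h = complete (x ∷ y ∷ xs) s
      index : m′ ∸ n′ ≡ suc s
      index = ∸-pred (ℕₚ.≤-pred le)
      s<m : suc s < m
      s<m = s≤s (subst (_≤ m′) index (ℕₚ.m∸n≤m m′ n′))
      m≤ : m ≤ suc s ℕ.+ length (y ∷ xs)
      m≤ = ℕₚ.≤-reflexive (sym (trans (cong (ℕ._+ suc (length xs)) (sym index))
             (trans (ℕₚ.+-suc _ _) (cong suc (trans (cong (m′ ∸ n′ ℕ.+_) (sym (ℕₚ.+-identityʳ _)))
               (ℕₚ.m∸n+n≡m (ℕₚ.≤-trans (ℕₚ.n≤1+n _) (ℕₚ.≤-pred le))))))))
      identity : ∀ x h k → x * (1ℤ * h) - (- 1ℤ) * (1ℤ * k) ≡ 1ℤ * ((k + x * h) - 0ℤ)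
      identity = solve-∀
    dual-step x y xs distinct powers (suc l) le = ≈-reflexive (trans (lin-*ˢ x (dual (x ∷ y ∷ xs)) l)
      (trans (cong (λ w → x * (- sgn l * h) + sgn l * w) (cong (complete (x ∷ y ∷ xs)) index))
        (trans (identity x (sgn l) h (complete (y ∷ xs) (suc s)))
          (cong (λ w → (- 1ℤ) * (- sgn l * complete (y ∷ xs) w)) (sym index′)))))
      where
      n s : ℕ
      n = suc (suc (length xs))
      s = m ∸ (n ℕ.+ suc l)
      h : ℤ
      h = complete (x ∷ y ∷ xs) s
      index : m ∸ (n ℕ.+ l) ≡ suc s
      index = ∸-suc n l le
      index′ : m ∸ (suc (length xs) ℕ.+ suc l) ≡ suc s
      index′ = trans (cong (m ∸_) (ℕₚ.+-suc (suc (length xs)) l)) index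
      identity : ∀ x σ h k → x * (- σ * h) + σ * (k + x * h) ≡ (- 1ℤ) * (- σ * k)
      identity = solve-∀

    -- Each linear factor removes one node and changes the sign, so `ω` comes out as (-1)^(n-1) χ.
    prod-dual : ∀ c a as → (let xs = map (λ a → c - a) (a ∷ as)) → Distinct xs → All (λ x → x ^ m ≈ χ) xs → χ ≉ 0ℤ →
      Σ ℤ λ ω → ω ≉ 0ℤ × (∀ l → length xs ℕ.+ l ≤ m → (prod (a ∷ as) c *ˢ dual xs) l ≈ const ω l)
    prod-dual c a [] distinct (xᵐ ∷ []) χ≉0 = χ , χ≉0 , λ l le →
      ≈-trans (*ˢ-congₙ {g = dual (c - a ∷ [])} one (λ _ → ≈-refl) l) (dual-singleton (c - a) xᵐ l le)
      where
      one : ∀ i → prod (a ∷ []) c i ≈ lin (c - a) i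
      one i = ≈-reflexive (trans (*ˢ-comm (lin (c - a)) (const 1ℤ) i)
        (trans (const-*ˢ 1ℤ (lin (c - a)) i) (ℤₚ.*-identityˡ _)))
    prod-dual c a (a′ ∷ as) (x≉ ∷ distinct) (xᵐ ∷ powers) χ≉0 with prod-dual c a′ as distinct powers χ≉0
    ... | ω , ω≉0 , h = (- 1ℤ) * ω , *-nonzero (λ e → 1≉0 (neg-cong e)) ω≉0 , λ l le →
      begin
        ((lin x *ˢ F) *ˢ dual xs) l
          ≡⟨ rearrange (lin x) F (dual xs) l ⟩
        (F *ˢ (lin x *ˢ dual xs)) l
          ≈⟨ *ˢ-cong-≤ F l (λ i i≤l → dual-step x (c - a′) _ (x≉ ∷ distinct) (xᵐ ∷ powers) i
               (ℕₚ.≤-trans (ℕₚ.+-monoʳ-≤ (length xs) i≤l) le)) ⟩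
        (F *ˢ ((- 1ℤ) • dual xs′)) l
          ≡⟨ *ˢ-• F (- 1ℤ) (dual xs′) l ⟩
        (- 1ℤ) * (F *ˢ dual xs′) l
          ≈⟨ *-congˡ (- 1ℤ) (h l (ℕₚ.≤-trans (ℕₚ.n≤1+n _) le)) ⟩
        (- 1ℤ) * const ω l
          ≡⟨ scale l ⟩
        const ((- 1ℤ) * ω) l ∎
      where
      open ≈-Reasoning
      x : ℤ
      x = c - a
      xs xs′ : List ℤ
      xs = map (λ a → c - a) (a ∷ a′ ∷ as)
      xs′ = map (λ a → c - a) (a′ ∷ as)
      F : Series
      F = prod (a′ ∷ as) c
      scale : ∀ l → (- 1ℤ) * const ω l ≡ const ((- 1ℤ) * ω) l
      scale zero    = refl
      scale (suc l) = refl
      *ˢ-congˡ-≡ : ∀ f {g h} → (∀ i → g i ≡ h i) → ∀ n → (f *ˢ g) n ≡ (f *ˢ h) n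
      *ˢ-congˡ-≡ f e zero = cong (λ w → f 0 * w) (e 0)
      *ˢ-congˡ-≡ f {g} {h} e (suc n) = trans (cong (λ w → f 0 * w + (tail f *ˢ g) n) (e (suc n)))
        (cong (λ w → f 0 * h (suc n) + w) (*ˢ-congˡ-≡ (tail f) e n))
      rearrange : ∀ f g h n → ((f *ˢ g) *ˢ h) n ≡ (g *ˢ (f *ˢ h)) n
      rearrange f g h n = trans (*ˢ-comm (f *ˢ g) h n) (trans (*ˢ-congˡ-≡ h (*ˢ-comm f g) n)
        (trans (*ˢ-comm h (g *ˢ f) n) (*ˢ-assoc g f h n)))

  -- The Pochhammer symbol x (x + 1) ... (x + i - 1); in particular `rising 1 i` is i!.
  rising : ℕ → ℕ → ℤ
  rising x zero    = 1ℤ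
  rising x (suc i) = rising x i * + (x ℕ.+ i)

  rising-nonzero : ∀ {x} i → 0 < x → x ℕ.+ i ≤ p → rising x i ≉ 0ℤ
  rising-nonzero zero    _   _  = 1≉0
  rising-nonzero {x} (suc i) 0<x le = *-nonzero (rising-nonzero i 0<x (ℕₚ.<⇒≤ x+i<p))
    (positive-nonzero (ℕₚ.<-≤-trans 0<x (ℕₚ.m≤m+n x i)) x+i<p)
    where
    x+i<p : x ℕ.+ i < p
    x+i<p = subst (_≤ p) (ℕₚ.+-suc x i) le

  rising-+ : ∀ x i j → rising x (i ℕ.+ j) ≡ rising x i * rising (x ℕ.+ i) j
  rising-+ x i zero    rewrite ℕₚ.+-identityʳ i = sym (ℤₚ.*-identityʳ _)
  rising-+ x i (suc j) rewrite ℕₚ.+-suc i j | rising-+ x i j | ℕₚ.+-assoc x i j =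
    ℤₚ.*-assoc (rising x i) (rising (x ℕ.+ i) j) (+ (x ℕ.+ (i ℕ.+ j)))

  -- Taylor expansion of h_s(X - a₁, ..., X - aₙ)

  completeˢ : List ℤ → ℕ → Family
  completeˢ []       zero    c = const 1ℤ
  completeˢ []       (suc s) c = const 0ℤ
  completeˢ (a ∷ as) zero    c = const 1ℤ
  completeˢ (a ∷ as) (suc s) c = completeˢ as (suc s) c +ˢ lin (c - a) *ˢ completeˢ (a ∷ as) s c

  completeˢ-value : ∀ as s c → completeˢ as s c 0 ≡ complete (map (λ a → c - a) as) s
  completeˢ-value []       zero    c = refl
  completeˢ-value []       (suc s) c = refl
  completeˢ-value (a ∷ as) zero    c = refl
  completeˢ-value (a ∷ as) (suc s) c rewrite completeˢ-value as (suc s) c | completeˢ-value (a ∷ as) s c = refl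

  completeˢ-zero : ∀ as c → completeˢ as 0 c ≡ const 1ℤ
  completeˢ-zero []      c = refl
  completeˢ-zero (_ ∷ _) c = refl

  Poly-complete : ∀ as s → Poly (suc s) (completeˢ as s)
  Poly-complete []       zero    = Poly-const 1ℤ
  Poly-complete []       (suc s) = Poly-0 (suc (suc s)) (λ _ → ≋-refl)
  Poly-complete (a ∷ as) zero    = Poly-const 1ℤ
  Poly-complete (a ∷ as) (suc s) = Poly-+ (Poly-complete as (suc s)) (Poly-lin a (Poly-complete (a ∷ as) s))

  const-suc : ∀ n → const (+ suc n) ≋ const 1ℤ +ˢ const (+ n)
  const-suc n = const-+ 1ℤ (+ n)

  -- With H(t) = ∏ 1/(1 - xᵢ t), differentiating along a common shift of all xᵢ gives n t H + t² H′,
  -- whose coefficient at t^(s+1) is (n + s) h_s.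
  D-complete : ∀ as s c → D (completeˢ as (suc s) c) ≋ const (+ (length as ℕ.+ s)) *ˢ completeˢ as s c
  D-complete [] zero    c = ≋-trans (D-const 0ℤ) (≋-sym (ext λ i →
    ≈-trans (≈-reflexive (const-*ˢ 0ℤ (const 1ℤ) i)) (≈-sym (≈-reflexive (const0-coeff i)))))
  D-complete [] (suc s) c = ≋-trans (D-const 0ℤ) (≋-sym (*ˢ-zeroʳ (const (+ suc s)) ≋-refl))
  D-complete (a ∷ as) s c = begin
    D (completeˢ as (suc s) c +ˢ y *ˢ H s)
      ≈⟨ D-+ (completeˢ as (suc s) c) (y *ˢ H s) ⟩
    D (completeˢ as (suc s) c) +ˢ D (y *ˢ H s)
      ≈⟨ +ˢ-cong (D-complete as s c) (D-lin-* (c - a) (H s)) ⟩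
    const (+ (n ℕ.+ s)) *ˢ completeˢ as s c +ˢ (H s +ˢ y *ˢ D (H s))
      ≈⟨ step s ⟩
    (const 1ℤ +ˢ const (+ (n ℕ.+ s))) *ˢ H s
      ≈⟨ *ˢ-congʳ (H s) (≋-sym (const-suc (n ℕ.+ s))) ⟩
    const (+ suc (n ℕ.+ s)) *ˢ H s ∎
    where
    open ≋-Reasoning
    n : ℕ
    n = length as
    y : Series
    y = lin (c - a)
    H : ℕ → Series
    H s = completeˢ (a ∷ as) s c
    step : ∀ s → const (+ (n ℕ.+ s)) *ˢ completeˢ as s c +ˢ (H s +ˢ y *ˢ D (H s)) ≋
                 (const 1ℤ +ˢ const (+ (n ℕ.+ s))) *ˢ H s
    step zero rewrite completeˢ-zero as c = begin
      N *ˢ const 1ℤ +ˢ (const 1ℤ +ˢ y *ˢ D (const 1ℤ))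
        ≈⟨ +ˢ-congˡ (N *ˢ const 1ℤ) (+ˢ-zeroʳ (const 1ℤ) (*ˢ-zeroʳ y (D-const 1ℤ))) ⟩
      N *ˢ const 1ℤ +ˢ const 1ℤ
        ≈⟨ +ˢ-congˡ (N *ˢ const 1ℤ) (≋-sym (const1-* (const 1ℤ))) ⟩
      N *ˢ const 1ℤ +ˢ const 1ℤ *ˢ const 1ℤ
        ≈⟨ solveˢ 2 (λ n i → n :* i :+ i :* i := (i :+ n) :* i) ≋-refl N (const 1ℤ) ⟩
      (const 1ℤ +ˢ N) *ˢ const 1ℤ ∎
      where
      N : Series
      N = const (+ (n ℕ.+ 0))
    step (suc s) rewrite ℕₚ.+-suc n s = begin
      N *ˢ K +ˢ (H (suc s) +ˢ y *ˢ D (H (suc s)))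
        ≈⟨ +ˢ-congˡ (N *ˢ K) (+ˢ-cong (≋-sym (const1-* (H (suc s)))) (*ˢ-congˡ y (D-complete (a ∷ as) s c))) ⟩
      N *ˢ K +ˢ (const 1ℤ *ˢ (K +ˢ y *ˢ H s) +ˢ y *ˢ (N *ˢ H s))
        ≈⟨ solveˢ 5 (λ n k i y h → n :* k :+ (i :* (k :+ y :* h) :+ y :* (n :* h)) := (i :+ n) :* (k :+ y :* h))
             ≋-refl N K (const 1ℤ) y (H s) ⟩
      (const 1ℤ +ˢ N) *ˢ (K +ˢ y *ˢ H s) ∎
      where
      N K : Series
      N = const (+ suc (n ℕ.+ s))
      K = completeˢ as (suc s) c

  -- `D-complete` iterated i times; the factorial stays on the left, so nothing has to be inverted.
  complete-coeff : ∀ as s c i →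
    rising 1 i * completeˢ as (s ℕ.+ i) c i ≈ rising (length as ℕ.+ s) i * complete (map (λ a → c - a) as) s
  complete-coeff as s c zero rewrite ℕₚ.+-identityʳ s = *-congˡ 1ℤ (≈-reflexive (completeˢ-value as s c))
  complete-coeff as s c (suc i) rewrite ℕₚ.+-suc s i =
    conclude (identity (rising 1 i) (+ suc i) F (+ (n ℕ.+ s ℕ.+ i)) f (rising (n ℕ.+ s) i) (complete (map (λ a → c - a) as) s))
      (rising 1 i · derivative ⊕ + (n ℕ.+ s ℕ.+ i) · complete-coeff as s c i)
    where
    n : ℕ
    n = length as
    F f : ℤ
    F = completeˢ as (suc (s ℕ.+ i)) c (suc i)
    f = completeˢ as (s ℕ.+ i) c i
    derivative : + suc i * F ≈ + (n ℕ.+ s ℕ.+ i) * f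
    derivative = ≈-trans (at (D-complete as (s ℕ.+ i) c) i) (≈-reflexive (trans
      (const-*ˢ (+ (n ℕ.+ (s ℕ.+ i))) (completeˢ as (s ℕ.+ i) c) i)
      (cong (λ k → + k * f) (sym (ℕₚ.+-assoc n s i)))))
    identity : ∀ r j F x f q h → r * j * F - q * x * h ≡ r * (j * F - x * f) + x * (r * f - q * h)
    identity = solve-∀

  -- The roots of `prod bs` are simple, so each division by it lowers the order at every root by
  -- exactly one.
  power-divides : ∀ {d Φ} bs e → Distinct bs → (∀ {b} → b ∈ bs → ∀ i → i < e → Φ b i ≈ 0ℤ) →
    Poly (e ℕ.* length bs ℕ.+ d) Φ → Σ Family λ Ψ → Poly d Ψ × (∀ c → Φ c ≋ prod bs c ^ˢ e *ˢ Ψ c)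
  power-divides {Φ = Φ} bs zero    bs≉ order q = Φ , q , λ c → ≋-sym (const1-* (Φ c))
  power-divides {d} {Φ} bs (suc e) bs≉ order q = once (root-divides bs bs≉
      (All.tabulate (λ b∈ → order b∈ 0 (s≤s z≤n)))
      (subst (λ k → Poly k Φ) (ℕₚ.+-assoc (length bs) (e ℕ.* length bs) d) q))
    where
    Q : Family
    Q = prod bs
    Quotient : ℕ → Set
    Quotient e = Σ Family λ Ψ → Poly d Ψ × (∀ c → Φ c ≋ Q c ^ˢ e *ˢ Ψ c)
    again : ∀ Ψ₁ → (∀ c → Φ c ≋ Q c *ˢ Ψ₁ c) →
      (Σ Family λ Ψ → Poly d Ψ × (∀ c → Ψ₁ c ≋ Q c ^ˢ e *ˢ Ψ c)) → Quotient (suc e)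
    again Ψ₁ h₁ (Ψ , q₂ , h₂) = Ψ , q₂ , λ c → ≋-trans (h₁ c) (≋-trans (*ˢ-congˡ (Q c) (h₂ c))
      (solveˢ 3 (λ f g h → f :* (g :* h) := (f :* g) :* h) ≋-refl (Q c) (Q c ^ˢ e) (Ψ c)))
    once : (Σ Family λ Ψ → Poly (e ℕ.* length bs ℕ.+ d) Ψ × (∀ c → Φ c ≋ Q c *ˢ Ψ c)) → Quotient (suc e)
    once (Ψ₁ , q₁ , h₁) = again Ψ₁ h₁ (power-divides {Φ = Ψ₁} bs e bs≉
      (λ {b} b∈ → shift-order {Q b} {Ψ₁ b} (prod-root bs b∈) (prod-simple-root bs bs≉ b∈) e
        (λ i i<e → ≈-trans (≈-sym (at (h₁ b) i)) (order b∈ i i<e))) q₁)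

  lin0-shift : ∀ e g l → (lin 0ℤ ^ˢ e *ˢ g) (e ℕ.+ l) ≈ g l
  lin0-shift zero    g l = at (const1-* g) l
  lin0-shift (suc e) g l =
    ≈-trans (≈-reflexive (*ˢ-assoc (lin 0ℤ) (lin 0ℤ ^ˢ e) g (suc (e ℕ.+ l))))
      (≈-trans (≈-reflexive (trans (lin-*ˢ 0ℤ (lin 0ℤ ^ˢ e *ˢ g) (e ℕ.+ l)) (ℤₚ.+-identityˡ _)))
        (lin0-shift e g l))

  -- A series without constant term is z times its tail, and `lin 0ℤ` is the series z.
  power-shift : ∀ {f} → f 0 ≈ 0ℤ → ∀ e l → (f ^ˢ e) (e ℕ.+ l) ≈ (tail f ^ˢ e) l
  power-shift {f} f₀ e l = ≈-trans (at (factored e) (e ℕ.+ l)) (lin0-shift e (tail f ^ˢ e) l)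
    where
    divided : f ≋ lin 0ℤ *ˢ tail f
    divided = ext λ where
      zero    → f₀
      (suc i) → ≈-sym (≈-reflexive (trans (lin-*ˢ 0ℤ (tail f) i) (ℤₚ.+-identityˡ _)))
    factored : ∀ e → f ^ˢ e ≋ lin 0ℤ ^ˢ e *ˢ tail f ^ˢ e
    factored zero    = ≋-sym (const1-* (const 1ℤ))
    factored (suc e) = ≋-trans (*ˢ-cong divided (factored e))
      (solveˢ 4 (λ z t a b → (z :* t) :* (a :* b) := (z :* a) :* (t :* b)) ≋-refl
        (lin 0ℤ) (tail f) (lin 0ℤ ^ˢ e) (tail f ^ˢ e))

  -- The extra factor `f` on both sides stands in for the exponent e - 1, so that e = 0 is covered
  -- as well.
  D-power : ∀ f e → f *ˢ D (f ^ˢ e) ≋ const (+ e) *ˢ (D f *ˢ f ^ˢ e)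
  D-power f zero = ≋-trans (*ˢ-zeroʳ f (D-const 1ℤ)) (≋-sym (zero-const λ i →
    ≈-reflexive (trans (const-*ˢ 0ℤ _ i) refl)))
  D-power f (suc e) = begin
    f *ˢ D (f *ˢ f ^ˢ e)
      ≈⟨ *ˢ-congˡ f (D-leibniz f (f ^ˢ e)) ⟩
    f *ˢ (D f *ˢ f ^ˢ e +ˢ f *ˢ D (f ^ˢ e))
      ≈⟨ *ˢ-congˡ f (+ˢ-cong (≋-sym (const1-* (D f *ˢ f ^ˢ e))) (D-power f e)) ⟩
    f *ˢ (const 1ℤ *ˢ (D f *ˢ f ^ˢ e) +ˢ const (+ e) *ˢ (D f *ˢ f ^ˢ e))
      ≈⟨ solveˢ 5 (λ f d g i e → f :* (i :* (d :* g) :+ e :* (d :* g)) := (i :+ e) :* (d :* (f :* g))) ≋-refl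
           f (D f) (f ^ˢ e) (const 1ℤ) (const (+ e)) ⟩
    (const 1ℤ +ˢ const (+ e)) *ˢ (D f *ˢ (f *ˢ f ^ˢ e))
      ≈⟨ *ˢ-congʳ (D f *ˢ (f *ˢ f ^ˢ e)) (≋-sym (const-suc e)) ⟩
    const (+ suc e) *ˢ (D f *ˢ (f *ˢ f ^ˢ e)) ∎
    where open ≋-Reasoning

  -- The Hanson–Petridis argument

  -- For the squares `χ` is 1. Exchanging A and B turns b - a into a - b and `χ` into (-1)^m χ; a
  -- general nonzero `χ` lets every local relation at B be reused at A.
  record Configuration (A B : List ℤ) (m′ : ℕ) (χ : ℤ) : Set where
    field
      A-distinct : Distinct A
      B-distinct : Distinct B
      powers     : ∀ {a b} → a ∈ A → b ∈ B → (b - a) ^ suc m′ ≈ χ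
      χ≉0        : χ ≉ 0ℤ
      p≡1+2m     : p ≡ suc (suc m′ ℕ.+ suc m′)
      2≤|A|      : 2 ≤ length A
      2≤|B|      : 2 ≤ length B
      covering   : suc m′ ≤ length A ℕ.* length B

  ^-scale : ∀ c x n → (c * x) ^ n ≡ c ^ n * x ^ n
  ^-scale c x zero    = refl
  ^-scale c x (suc n) rewrite ^-scale c x n = identity c x (c ^ n) (x ^ n)
    where
    identity : ∀ c x a b → c * x * (a * b) ≡ c * a * (x * b)
    identity = solve-∀

  exchange : ∀ {A B m′ χ} → Configuration A B m′ χ → Configuration B A m′ ((- 1ℤ) ^ suc m′ * χ)
  exchange {A} {B} {m′} {χ} C = record
    { A-distinct = B-distinct ; B-distinct = A-distinct
    ; powers = λ {b} {a} b∈ a∈ → ≈-trans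
        (≈-reflexive (trans (cong (_^ suc m′) (identity a b)) (^-scale (- 1ℤ) (b - a) (suc m′))))
        (*-congˡ ((- 1ℤ) ^ suc m′) (powers a∈ b∈))
    ; χ≉0 = *-nonzero {(- 1ℤ) ^ suc m′} {χ} (^-nonzero { - 1ℤ} (λ e → 1≉0 (neg-cong e)) (suc m′)) χ≉0
    ; p≡1+2m = p≡1+2m ; 2≤|A| = 2≤|B| ; 2≤|B| = 2≤|A|
    ; covering = subst (suc m′ ≤_) (ℕₚ.*-comm (length A) (length B)) covering }
    where
    open Configuration C
    identity : ∀ a b → a - b ≡ (- 1ℤ) * (b - a)
    identity = solve-∀

  -- g expands the normalised power (Q / Q₁z)ⁿ and y the normalised inverse of P(-z).
  record Expansion (n m : ℕ) (P Q : Series) : Set where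
    field
      g y   : Series
      g₀    : g 0 ≈ 1ℤ
      y₀    : y 0 ≈ 1ℤ
      power : tail Q *ˢ D g ≋ const (+ n) *ˢ (D (tail Q) *ˢ g)
      ratio : ∀ l → n ℕ.+ l ≤ m → rising (suc n) l * g l ≈ rising (m ∸ l) l * y l
      inverse : ∀ l → n ℕ.+ suc l ≤ m → (P *ˢ (λ i → sgn i * y i)) (suc l) ≈ 0ℤ

  module _ {A B m′ χ} (C : Configuration A B m′ χ) where
    open Configuration C
    private
      m : ℕ
      m = suc m′

    -- All of B would be roots of (X - a)^m - χ, whose value at a is -χ. The resulting bounds on the
    -- sizes keep the integers below m + n invertible modulo p.
    excess-root : ∀ {a} → a ∈ A → m < length B → ⊥
    excess-root {a} a∈ m<k = χ≉0 (conclude (identity χ (completeˢ (a ∷ []) m a 0))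
        ((- 1ℤ) · ≋0⇒ (many-roots⇒zero B B-distinct (All.tabulate {P = λ b → completeˢ (a ∷ []) m b 0 + - χ ≈ 0ℤ} root)
                  (Poly-+ (Poly-complete (a ∷ []) m) (Poly-≤ (s≤s z≤n) (Poly-const (- χ)))) m<k a) 0
         ⊕ 1ℤ · vanishing))
      where
      value : ∀ c → completeˢ (a ∷ []) m c 0 ≡ (c - a) ^ m
      value c = trans (completeˢ-value (a ∷ []) m c) (complete-singleton (c - a) m)
      root : ∀ {b} → b ∈ B → completeˢ (a ∷ []) m b 0 + - χ ≈ 0ℤ
      root {b} b∈ = difference-zero (≈-trans (≈-reflexive (value b)) (powers a∈ b∈))
      vanishing : completeˢ (a ∷ []) m a 0 ≈ 0ℤ
      vanishing = ≈-trans (≈-reflexive (value a))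
        (*-zeroˡ ((a - a) ^ m′) (≈-reflexive (ℤₚ.+-inverseʳ a)))
      identity : ∀ χ h → χ - 0ℤ ≡ (- 1ℤ) * ((h + - χ) - 0ℤ) + 1ℤ * (h - 0ℤ)
      identity = solve-∀

  |B|≤m : ∀ {A B m′ χ} → Configuration A B m′ χ → length B ≤ suc m′
  |B|≤m {[]} C with Configuration.2≤|A| C
  ... | ()
  |B|≤m {a ∷ A} C = ℕₚ.≮⇒≥ (excess-root C (here refl))

  module PointExpansion {a as B m′ χ} (C : Configuration (a ∷ as) B m′ χ) where
    open Configuration C
    open PowerRoots m′ χ
    open Dual m′ χ

    private
      A : List ℤ
      A = a ∷ as
      m n k : ℕ
      m = suc m′
      n = length A
      k = length B

    n≤m : n ≤ m
    n≤m = |B|≤m (exchange C)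

    m+n≤p : m ℕ.+ n ≤ p
    m+n≤p = subst (m ℕ.+ n ≤_) (sym p≡1+2m) (ℕₚ.≤-trans (ℕₚ.+-monoʳ-≤ m n≤m) (ℕₚ.n≤1+n _))

    n<p : suc n ≤ p
    n<p = ℕₚ.≤-trans (ℕₚ.+-monoˡ-≤ n (s≤s z≤n)) m+n≤p

    Φ : Family
    Φ c = completeˢ A m c +ˢ const (- χ)

    module At {b} (b∈ : b ∈ B) where
      xs : List ℤ
      xs = map (λ a → b - a) A

      xs-distinct : Distinct xs
      xs-distinct = AllPairsₚ.map⁺ (AllPairs.map reflect A-distinct)
        where
        reflect : ∀ {x y} → x ≉ y → b - x ≉ b - y
        reflect {x} {y} x≉y e = x≉y (conclude (identity b x y) ((- 1ℤ) · e))
          where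
          identity : ∀ b x y → x - y ≡ (- 1ℤ) * ((b - x) - (b - y))
          identity = solve-∀

      xs-powers : All (λ x → x ^ m ≈ χ) xs
      xs-powers = Allₚ.map⁺ (All.tabulate (λ a∈ → powers a∈ b∈))

      vanishing : ∀ s → s < m → m ≤ s ℕ.+ length as → complete xs s ≈ 0ℤ
      vanishing s s<m m≤ = proj₂ (complete-vanishes (b - a) _ xs-distinct xs-powers) s s<m
        (subst (λ j → m ≤ s ℕ.+ j) (sym (length-map _ as)) m≤)

      -- The i-th Taylor coefficient at b is a multiple of h_(m-i) of the differences b - a, zero
      -- for 0 < i < n; the constant term is removed by subtracting `χ`.
      order : ∀ i → i < n → Φ b i ≈ 0ℤ
      order zero _ = difference-zero (≈-trans (≈-reflexive (completeˢ-value A m b))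
        (proj₁ (complete-vanishes (b - a) _ xs-distinct xs-powers)))
      order (suc i) i<n = cancelˡ {rising 1 (suc i)} {Φ b (suc i)}
        (rising-nonzero {1} (suc i) (s≤s z≤n) (ℕₚ.≤-trans (s≤s (ℕₚ.<⇒≤ i<n)) n<p))
        (conclude (identity (rising 1 (suc i)) (completeˢ A m b (suc i)) (rising (n ℕ.+ s) (suc i)) (complete xs s))
          (1ℤ · subst (λ k → rising 1 (suc i) * completeˢ A k b (suc i) ≈ rising (n ℕ.+ s) (suc i) * complete xs s)
                  index (complete-coeff A s b (suc i))
           ⊕ rising (n ℕ.+ s) (suc i) · vanishing s s<m m≤))
        where
        s : ℕ
        s = m ∸ suc i
        1+i≤m : suc i ≤ m
        1+i≤m = ℕₚ.≤-trans (ℕₚ.<⇒≤ i<n) n≤m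
        index : s ℕ.+ suc i ≡ m
        index = ℕₚ.m∸n+n≡m 1+i≤m
        s<m : s < m
        s<m = s≤s (ℕₚ.m∸n≤m m′ i)
        m≤ : m ≤ s ℕ.+ length as
        m≤ = subst (_≤ s ℕ.+ length as) index (ℕₚ.+-monoʳ-≤ s (ℕₚ.≤-pred i<n))
        identity : ∀ r f q h → r * (f + 0ℤ) - 0ℤ ≡ 1ℤ * (r * f - q * h) + q * (h - 0ℤ)
        identity = solve-∀

      η : ℕ → ℤ
      η l = complete xs (m ∸ (n ℕ.+ l))

      dual-prod : Σ ℤ λ ω → ω ≉ 0ℤ × (∀ l → n ℕ.+ l ≤ m → (prod A b *ˢ (λ i → sgn i * η i)) l ≈ const ω l)
      dual-prod with prod-dual b a as xs-distinct xs-powers χ≉0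
      ... | ω , ω≉0 , h rewrite length-map (λ a → b - a) as = ω , ω≉0 , h

      η₀≉0 : η 0 ≉ 0ℤ
      η₀≉0 e with dual-prod
      ... | ω , ω≉0 , h = ω≉0 (≈-trans (≈-sym (h 0 (subst (_≤ m) (sym (ℕₚ.+-identityʳ n)) n≤m)))
        (*-zeroʳ (prod A b 0) {1ℤ * η 0} (*-zeroʳ 1ℤ {η 0} e)))

      -- The factors common to all l are split off, since only ratios of coefficients matter.
      top-coeff : ∀ l → n ℕ.+ l ≤ m →
        rising 1 n * rising (suc n) l * Φ b (n ℕ.+ l) ≈ rising (m ∸ l) l * rising m n * η l
      top-coeff l le = conclude
        (trans (cong (λ w → w * Φ b (n ℕ.+ l) - rising (m ∸ l) l * rising m n * η l) (sym (rising-+ 1 n l)))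
          (trans (cong (λ w → rising 1 (n ℕ.+ l) * Φ b (n ℕ.+ l) - w * η l) (sym split))
            (identity (rising 1 (n ℕ.+ l)) (completeˢ A m b (n ℕ.+ l)) (rising (m ∸ l) (n ℕ.+ l)) (η l))))
        (1ℤ · subst (λ j → rising 1 (n ℕ.+ l) * completeˢ A m b (n ℕ.+ l) ≈ rising j (n ℕ.+ l) * η l) base
          (subst (λ j → rising 1 (n ℕ.+ l) * completeˢ A j b (n ℕ.+ l) ≈ rising (n ℕ.+ (m ∸ (n ℕ.+ l))) (n ℕ.+ l) * η l)
            (ℕₚ.m∸n+n≡m le) (complete-coeff A (m ∸ (n ℕ.+ l)) b (n ℕ.+ l))))
        where
        l≤m : l ≤ m
        l≤m = ℕₚ.≤-trans (ℕₚ.m≤n+m l n) le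
        base : n ℕ.+ (m ∸ (n ℕ.+ l)) ≡ m ∸ l
        base = trans (cong (λ j → n ℕ.+ (m ∸ j)) (ℕₚ.+-comm n l))
          (trans (cong (n ℕ.+_) (sym (ℕₚ.∸-+-assoc m l n))) (ℕₚ.m+[n∸m]≡n (ℕₚ.m+n≤o⇒m≤o∸n n le)))
        split : rising (m ∸ l) (n ℕ.+ l) ≡ rising (m ∸ l) l * rising m n
        split = trans (cong (rising (m ∸ l)) (ℕₚ.+-comm n l))
          (trans (rising-+ (m ∸ l) l n) (cong (λ j → rising (m ∸ l) l * rising j n) (ℕₚ.m∸n+n≡m l≤m)))
        identity : ∀ r f q h → r * (f + 0ℤ) - q * h ≡ 1ℤ * (r * f - q * h)
        identity = solve-∀

      n+0≤m : n ℕ.+ 0 ≤ m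
      n+0≤m = subst (_≤ m) (sym (ℕₚ.+-identityʳ n)) n≤m

      leading-nonzero : Φ b (n ℕ.+ 0) ≉ 0ℤ
      leading-nonzero e = *-nonzero {1ℤ * rising m n} {η 0}
        (*-nonzero {1ℤ} {rising m n} 1≉0 (rising-nonzero {m} n (s≤s z≤n) m+n≤p)) η₀≉0
        (≈-trans (≈-sym (top-coeff 0 n+0≤m)) (*-zeroʳ (rising 1 n * 1ℤ) {Φ b (n ℕ.+ 0)} e))

    Poly-Φ : Poly (suc m) Φ
    Poly-Φ = Poly-+ (Poly-complete A m) (Poly-≤ (s≤s z≤n) (Poly-const (- χ)))

    element : ∃ λ b → b ∈ B
    element = nonempty 2≤|B|
      where
      nonempty : ∀ {B : List ℤ} → 2 ≤ length B → ∃ λ b → b ∈ B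
      nonempty {b ∷ _} _ = b , here refl

    -- Otherwise the quotient of `Φ` by Qⁿ is zero, whereas the coefficient of zⁿ at a point of B is
    -- a nonzero multiple of `η 0`.
    n*k≤m : n ℕ.* k ≤ m
    n*k≤m = ℕₚ.≮⇒≥ λ m<nk → excess (power-divides {d = 0} {Φ} B n B-distinct At.order
      (subst (λ d → Poly d Φ) (sym (ℕₚ.+-identityʳ (n ℕ.* k))) (Poly-≤ m<nk Poly-Φ)))
      where
      excess : (Σ Family λ Ψ → Poly 0 Ψ × (∀ c → Φ c ≋ prod B c ^ˢ n *ˢ Ψ c)) → ⊥
      excess (Ψ , null z , h) = At.leading-nonzero (proj₂ element)
        (≈-trans (at (h b) (n ℕ.+ 0)) (≋0⇒ (*ˢ-zeroʳ (prod B b ^ˢ n) (z b)) (n ℕ.+ 0)))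
        where
        b : ℤ
        b = proj₁ element

    n*k≡m : n ℕ.* k ≡ m
    n*k≡m = ℕₚ.≤-antisym n*k≤m covering

    Φ-power : Σ ℤ λ κ → ∀ c → Φ c ≋ const κ *ˢ prod B c ^ˢ n
    Φ-power = constant (power-divides {d = 1} {Φ} B n B-distinct At.order
      (subst (λ d → Poly d Φ) (sym (trans (ℕₚ.+-comm (n ℕ.* k) 1) (cong suc n*k≡m))) Poly-Φ))
      where
      constant : (Σ Family λ Ψ → Poly 1 Ψ × (∀ c → Φ c ≋ prod B c ^ˢ n *ˢ Ψ c)) →
                 Σ ℤ λ κ → ∀ c → Φ c ≋ const κ *ˢ prod B c ^ˢ n
      constant (Ψ , horner κ Ψ′ (null z) h , f) = κ , λ c → ≋-trans (f c)
        (≋-trans (*ˢ-congˡ (prod B c ^ˢ n) (≋-trans (h c) (+ˢ-zeroʳ (const κ) (*ˢ-zeroʳ (lin c) (z c)))))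
          (solveˢ 2 (λ f g → f :* g := g :* f) ≋-refl (prod B c ^ˢ n) (const κ)))

    expansion : ∀ {b} → b ∈ B → Expansion n m (prod A b) (prod B b)
    expansion {b} b∈ = record
      { g = const (iθ * κ) *ˢ q
      ; y = λ l → η l * iη
      ; g₀ = ≈-trans (≈-reflexive (rotate iθ κ (q 0))) (inv-inverse θ≉0)
      ; y₀ = inv-inverse η₀≉0
      ; power = power
      ; ratio = ratio
      ; inverse = inverse }
      where
      open At b∈
      κ θ iθ iη : ℤ
      κ = proj₁ Φ-power
      Q̂ q : Series
      Q̂ = tail (prod B b)
      q = Q̂ ^ˢ n
      θ = κ * q 0
      iθ = inv θ
      iη = inv (η 0)
      rotate : ∀ i k q → i * k * q ≡ k * q * i
      rotate = solve-∀
      coefficient : ∀ l → Φ b (n ℕ.+ l) ≈ κ * q l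
      coefficient l = ≈-trans (at (proj₂ Φ-power b) (n ℕ.+ l))
        (≈-trans (≈-reflexive (const-*ˢ κ (prod B b ^ˢ n) (n ℕ.+ l)))
          (*-congˡ κ (power-shift {prod B b} (prod-root B b∈) n l)))
      scaled : ∀ l → n ℕ.+ l ≤ m →
        rising 1 n * rising (suc n) l * (κ * q l) ≈ rising (m ∸ l) l * rising m n * η l
      scaled l le = ≈-trans
        (*-congˡ (rising 1 n * rising (suc n) l) {κ * q l} {Φ b (n ℕ.+ l)} (≈-sym (coefficient l))) (top-coeff l le)
      θ≉0 : θ ≉ 0ℤ
      θ≉0 e = leading-nonzero (≈-trans (coefficient 0) e)
      power : Q̂ *ˢ D (const (iθ * κ) *ˢ q) ≋ const (+ n) *ˢ (D Q̂ *ˢ (const (iθ * κ) *ˢ q))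
      power = begin
        Q̂ *ˢ D (K *ˢ q)
          ≈⟨ *ˢ-congˡ Q̂ (≋-trans (D-leibniz K q) (+ˢ-zeroˡ (K *ˢ D q)
               (≋-trans (solveˢ 2 (λ f g → f :* g := g :* f) ≋-refl (D K) q) (*ˢ-zeroʳ q (D-const (iθ * κ)))))) ⟩
        Q̂ *ˢ (K *ˢ D q)
          ≈⟨ solveˢ 3 (λ f k d → f :* (k :* d) := k :* (f :* d)) ≋-refl Q̂ K (D q) ⟩
        K *ˢ (Q̂ *ˢ D q)
          ≈⟨ *ˢ-congˡ K (D-power Q̂ n) ⟩
        K *ˢ (const (+ n) *ˢ (D Q̂ *ˢ q))
          ≈⟨ solveˢ 4 (λ k n d q → k :* (n :* (d :* q)) := n :* (d :* (k :* q))) ≋-refl K (const (+ n)) (D Q̂) q ⟩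
        const (+ n) *ˢ (D Q̂ *ˢ (K *ˢ q)) ∎
        where
        open ≋-Reasoning
        K : Series
        K = const (iθ * κ)
      -- Dividing `scaled l` by `scaled 0` removes `κ` and the common factors `rising 1 n` and
      -- `rising m n`.
      ratio : ∀ l → n ℕ.+ l ≤ m → rising (suc n) l * (const (iθ * κ) *ˢ q) l ≈ rising (m ∸ l) l * (η l * iη)
      ratio l le = zero-difference (cancelˡ {rising 1 n * θ} (*-nonzero {rising 1 n} {θ} (rising-nonzero {1} n (s≤s z≤n) n<p) θ≉0)
        (conclude (trans (cong (λ w → rising 1 n * θ * (rising (suc n) l * w - rising (m ∸ l) l * (η l * iη)) - 0ℤ)
                            (const-*ˢ (iθ * κ) q l))
                    (identity (rising 1 n) κ (q 0) iθ iη (η 0) (rising m n) (rising (suc n) l) (q l) (rising (m ∸ l) l) (η l)))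
          (1ℤ · scaled l le ⊕ rising 1 n * rising (suc n) l * κ * q l · inv-inverse θ≉0
           ⊕ (- (rising (m ∸ l) l * η l * iη)) · scaled 0 n+0≤m
           ⊕ (- (rising (m ∸ l) l * η l * rising m n)) · inv-inverse η₀≉0)))
        where
        identity : ∀ φ κ q₀ iθ iη η₀ ρ r q t η →
          φ * (κ * q₀) * (r * (iθ * κ * q) - t * (η * iη)) - 0ℤ ≡
          1ℤ * (φ * r * (κ * q) - t * ρ * η) + φ * r * κ * q * (κ * q₀ * iθ - 1ℤ)
          + (- (t * η * iη)) * (φ * 1ℤ * (κ * q₀) - 1ℤ * ρ * η₀)
          + (- (t * η * ρ)) * (η₀ * iη - 1ℤ)
        identity = solve-∀
      inverse : ∀ l → n ℕ.+ suc l ≤ m → (prod A b *ˢ (λ i → sgn i * (η i * iη))) (suc l) ≈ 0ℤ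
      inverse l le = ≈-trans (*ˢ-cong-≤ (prod A b) (suc l) (λ i _ → ≈-reflexive (identity (sgn i) (η i) iη)))
        (≈-trans (≈-reflexive (*ˢ-• (prod A b) iη (λ i → sgn i * η i) (suc l)))
          (*-zeroʳ iη (proj₂ (proj₂ dual-prod) (suc l) le)))
        where
        identity : ∀ s η i → s * (η * i) ≡ i * (s * η)
        identity = solve-∀

  -- Expansions at the points of A and B

  +-suc-pos : ∀ n i → + (suc n ℕ.+ i) ≡ + n + + suc i
  +-suc-pos n i = trans (cong +_ (sym (ℕₚ.+-suc n i))) (ℤₚ.pos-+ n (suc i))

  ∸-pos : ∀ {m l} i → l ≤ m → + (m ∸ l ℕ.+ i) ≡ + m - + l + + i
  ∸-pos {m} {l} i l≤m = trans (ℤₚ.pos-+ (m ∸ l) i)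
    (cong (λ w → w + + i) (sym (trans (ℤₚ.m-n≡m⊖n m l) (ℤₚ.⊖-≥ l≤m))))

  -- In degree one, `power` reads Q₁ g₁ = n Q₂, `inverse` reads P₀ y₁ = P₁, and `ratio` ties them by
  -- (n + 1) g₁ = (m - 1) y₁.
  first-order : ∀ {n m P Q} → Expansion n m P Q → n ℕ.+ 1 ≤ m →
    + n * (+ n + + 1) * (Q 2 * P 0) ≈ (+ m - + 1) * (P 1 * Q 1)
  first-order {n} {m} {P} {Q} E le =
    conclude (identity (+ n) (+ n + + 1) (+ m - + 1) (P 0) (P 1) (Q 1) (Q 2) (g 0) (g 1) (y 0) (y 1))
      ((- ((+ n + + 1) * P 0)) · ≈-trans (at power 0) (≈-reflexive (const-*ˢ (+ n) (D (tail Q) *ˢ g) 0))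
       ⊕ (P 0 * Q 1) · ratio₁
       ⊕ (- ((+ m - + 1) * Q 1)) · inverse 0 le
       ⊕ (- (+ n * (+ n + + 1) * Q 2 * P 0)) · g₀
       ⊕ ((+ m - + 1) * Q 1 * P 1) · y₀)
    where
    open Expansion E
    ratio₁ : (+ n + + 1) * g 1 ≈ (+ m - + 1) * y 1
    ratio₁ = subst₂ (λ a b → a * g 1 ≈ b * y 1)
      (trans (ℤₚ.*-identityˡ _) (+-suc-pos n 0))
      (trans (ℤₚ.*-identityˡ _) (trans (∸-pos 0 (ℕₚ.≤-trans (ℕₚ.m≤n+m 1 n) le)) (ℤₚ.+-identityʳ (+ m - + 1))))
      (ratio 1 le)
    identity : ∀ N N₁ M P₀ P₁ Q₁ Q₂ g₀ g₁ y₀ y₁ → N * N₁ * (Q₂ * P₀) - M * (P₁ * Q₁) ≡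
      (- (N₁ * P₀)) * (Q₁ * (+ 1 * g₁) - N * ((+ 1 * Q₂) * g₀))
      + (P₀ * Q₁) * (N₁ * g₁ - M * y₁)
      + (- (M * Q₁)) * ((P₀ * ((- 1ℤ) * y₁) + P₁ * (1ℤ * y₀)) - 0ℤ)
      + (- (N * N₁ * Q₂ * P₀)) * (g₀ - 1ℤ) + (M * Q₁ * P₁) * (y₀ - 1ℤ)
    identity = solve-∀

  -- What `Expansion` says up to third order when m = n²: normalised by P₀ and Q₁, with the unit n +
  -- 1 divided out of the ratios.
  record Jet (N u x₂ x₃ q₂ q₃ q₄ : ℤ) : Set where
    field
      g₁ g₂ g₃ y₁ y₂ y₃ : ℤ
      power₁   : g₁ - N * q₂ ≈ 0ℤ
      power₂   : (+ 2 * g₂ + q₂ * g₁) - N * (+ 2 * q₃ + q₂ * g₁) ≈ 0ℤ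
      power₃   : (+ 3 * g₃ + + 2 * q₂ * g₂ + q₃ * g₁) - N * (+ 3 * q₄ + + 2 * q₃ * g₁ + q₂ * g₂) ≈ 0ℤ
      inverse₁ : y₁ - u ≈ 0ℤ
      inverse₂ : y₂ - (u * y₁ - x₂) ≈ 0ℤ
      inverse₃ : y₃ - (u * y₂ - x₂ * y₁ + x₃) ≈ 0ℤ
      ratio₁   : g₁ - (N - + 1) * y₁ ≈ 0ℤ
      ratio₂   : (N + + 2) * g₂ - (N - + 1) * (N * N - + 2) * y₂ ≈ 0ℤ
      ratio₃   : (N + + 2) * (N + + 3) * g₃ - (N - + 1) * (N * N - + 2) * (N * N - + 3) * y₃ ≈ 0ℤ

  module _ {n P Q} (E : Expansion n (n ℕ.* n) P Q) (n+3≤m : n ℕ.+ 3 ≤ n ℕ.* n)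
           (P₀≉0 : P 0 ≉ 0ℤ) (Q₁≉0 : Q 1 ≉ 0ℤ) (N+1≉0 : + n + + 1 ≉ 0ℤ) where
    open Expansion E
    private
      N j i : ℤ
      N = + n
      j = inv (P 0)
      i = inv (Q 1)

      power-coeff : ∀ l → (tail Q *ˢ D g) l ≈ N * (D (tail Q) *ˢ g) l
      power-coeff l = ≈-trans (at power l) (≈-reflexive (const-*ˢ N (D (tail Q) *ˢ g) l))

      n+1≤m : n ℕ.+ 1 ≤ n ℕ.* n
      n+1≤m = ℕₚ.≤-trans (ℕₚ.+-monoʳ-≤ n (s≤s z≤n)) n+3≤m

      n+2≤m : n ℕ.+ 2 ≤ n ℕ.* n
      n+2≤m = ℕₚ.≤-trans (ℕₚ.+-monoʳ-≤ n (s≤s (s≤s z≤n))) n+3≤m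

      l≤m : ∀ {l} → l ≤ 3 → l ≤ n ℕ.* n
      l≤m l≤3 = ℕₚ.≤-trans l≤3 (ℕₚ.≤-trans (ℕₚ.m≤n+m 3 n) n+3≤m)

      factor : ∀ l i → l ≤ 3 → + (n ℕ.* n ∸ l ℕ.+ i) ≡ N * N - + l + + i
      factor l i l≤3 = trans (∸-pos i (l≤m l≤3)) (cong (λ w → w - + l + + i) (ℤₚ.pos-* n n))

      Q₁i : Q 1 * i ≈ 1ℤ
      Q₁i = inv-inverse Q₁≉0

      P₀j : P 0 * j ≈ 1ℤ
      P₀j = inv-inverse P₀≉0

    jet : Jet N (j * P 1) (j * P 2) (j * P 3) (i * Q 2) (i * Q 3) (i * Q 4)
    jet = record
      { g₁ = g 1 ; g₂ = g 2 ; g₃ = g 3 ; y₁ = y 1 ; y₂ = y 2 ; y₃ = y 3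
      ; power₁ = conclude (power-identity₁ N i (Q 1) (Q 2) (g 0) (g 1))
          (i · power-coeff 0 ⊕ (- g 1) · Q₁i ⊕ (N * i * Q 2) · g₀)
      ; power₂ = conclude (power-identity₂ N i (Q 1) (Q 2) (Q 3) (g 0) (g 1) (g 2))
          (i · power-coeff 1 ⊕ (- (+ 2 * g 2)) · Q₁i ⊕ (+ 2 * N * i * Q 3) · g₀)
      ; power₃ = conclude (power-identity₃ N i (Q 1) (Q 2) (Q 3) (Q 4) (g 0) (g 1) (g 2) (g 3))
          (i · power-coeff 2 ⊕ (- (+ 3 * g 3)) · Q₁i ⊕ (+ 3 * N * i * Q 4) · g₀)
      ; inverse₁ = conclude (inverse-identity₁ j (P 0) (P 1) (y 0) (y 1))
          ((- j) · inverse 0 n+1≤m ⊕ (- y 1) · P₀j ⊕ (j * P 1) · y₀)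
      ; inverse₂ = conclude (inverse-identity₂ j (P 0) (P 1) (P 2) (y 0) (y 1) (y 2))
          (j · inverse 1 n+2≤m ⊕ (- y 2) · P₀j ⊕ (- (j * P 2)) · y₀)
      ; inverse₃ = conclude (inverse-identity₃ j (P 0) (P 1) (P 2) (P 3) (y 0) (y 1) (y 2) (y 3))
          ((- j) · inverse 2 n+3≤m ⊕ (- y 3) · P₀j ⊕ (j * P 3) · y₀)
      ; ratio₁ = cancelˡ N+1≉0 (conclude (ratio-identity₁ N (g 1) (y 1))
          (1ℤ · subst₂ (λ a b → 1ℤ * a * g 1 ≈ 1ℤ * b * y 1) (+-suc-pos n 0) (factor 1 0 (s≤s z≤n)) (ratio 1 n+1≤m)))
      ; ratio₂ = cancelˡ N+1≉0 (conclude (ratio-identity₂ N (g 2) (y 2))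
          (1ℤ · subst₂ (λ a b → a * g 2 ≈ b * y 2)
            (cong₂ (λ a b → 1ℤ * a * b) (+-suc-pos n 0) (+-suc-pos n 1))
            (cong₂ (λ a b → 1ℤ * a * b) (factor 2 0 (s≤s (s≤s z≤n))) (factor 2 1 (s≤s (s≤s z≤n))))
            (ratio 2 n+2≤m)))
      ; ratio₃ = cancelˡ N+1≉0 (conclude (ratio-identity₃ N (g 3) (y 3))
          (1ℤ · subst₂ (λ a b → a * g 3 ≈ b * y 3)
            (cong₂ _*_ (cong₂ (λ a b → 1ℤ * a * b) (+-suc-pos n 0) (+-suc-pos n 1)) (+-suc-pos n 2))
            (cong₂ _*_ (cong₂ (λ a b → 1ℤ * a * b) (factor 3 0 ℕₚ.≤-refl) (factor 3 1 ℕₚ.≤-refl)) (factor 3 2 ℕₚ.≤-refl))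
            (ratio 3 n+3≤m)))
      }
      where
      power-identity₁ : ∀ N i Q₁ Q₂ g₀ g₁ → (g₁ - N * (i * Q₂)) - 0ℤ ≡
        i * (Q₁ * (+ 1 * g₁) - N * ((+ 1 * Q₂) * g₀)) + (- g₁) * (Q₁ * i - 1ℤ) + (N * i * Q₂) * (g₀ - 1ℤ)
      power-identity₁ = solve-∀
      power-identity₂ : ∀ N i Q₁ Q₂ Q₃ g₀ g₁ g₂ →
        ((+ 2 * g₂ + i * Q₂ * g₁) - N * (+ 2 * (i * Q₃) + i * Q₂ * g₁)) - 0ℤ ≡
        i * ((Q₁ * (+ 2 * g₂) + Q₂ * (+ 1 * g₁)) - N * ((+ 1 * Q₂) * g₁ + (+ 2 * Q₃) * g₀))
        + (- (+ 2 * g₂)) * (Q₁ * i - 1ℤ) + (+ 2 * N * i * Q₃) * (g₀ - 1ℤ)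
      power-identity₂ = solve-∀
      power-identity₃ : ∀ N i Q₁ Q₂ Q₃ Q₄ g₀ g₁ g₂ g₃ →
        ((+ 3 * g₃ + + 2 * (i * Q₂) * g₂ + i * Q₃ * g₁) - N * (+ 3 * (i * Q₄) + + 2 * (i * Q₃) * g₁ + i * Q₂ * g₂)) - 0ℤ ≡
        i * ((Q₁ * (+ 3 * g₃) + (Q₂ * (+ 2 * g₂) + Q₃ * (+ 1 * g₁)))
             - N * ((+ 1 * Q₂) * g₂ + ((+ 2 * Q₃) * g₁ + (+ 3 * Q₄) * g₀)))
        + (- (+ 3 * g₃)) * (Q₁ * i - 1ℤ) + (+ 3 * N * i * Q₄) * (g₀ - 1ℤ)
      power-identity₃ = solve-∀
      inverse-identity₁ : ∀ j P₀ P₁ y₀ y₁ → (y₁ - j * P₁) - 0ℤ ≡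
        (- j) * ((P₀ * ((- 1ℤ) * y₁) + P₁ * (1ℤ * y₀)) - 0ℤ) + (- y₁) * (P₀ * j - 1ℤ) + (j * P₁) * (y₀ - 1ℤ)
      inverse-identity₁ = solve-∀
      inverse-identity₂ : ∀ j P₀ P₁ P₂ y₀ y₁ y₂ → (y₂ - (j * P₁ * y₁ - j * P₂)) - 0ℤ ≡
        j * ((P₀ * (1ℤ * y₂) + (P₁ * ((- 1ℤ) * y₁) + P₂ * (1ℤ * y₀))) - 0ℤ)
        + (- y₂) * (P₀ * j - 1ℤ) + (- (j * P₂)) * (y₀ - 1ℤ)
      inverse-identity₂ = solve-∀
      inverse-identity₃ : ∀ j P₀ P₁ P₂ P₃ y₀ y₁ y₂ y₃ → (y₃ - (j * P₁ * y₂ - j * P₂ * y₁ + j * P₃)) - 0ℤ ≡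
        (- j) * ((P₀ * ((- 1ℤ) * y₃) + (P₁ * (1ℤ * y₂) + (P₂ * ((- 1ℤ) * y₁) + P₃ * (1ℤ * y₀)))) - 0ℤ)
        + (- y₃) * (P₀ * j - 1ℤ) + (j * P₃) * (y₀ - 1ℤ)
      inverse-identity₃ = solve-∀
      ratio-identity₁ : ∀ N g y → (N + + 1) * (g - (N - + 1) * y) - 0ℤ ≡
        1ℤ * (1ℤ * (N + + 1) * g - 1ℤ * (N * N - + 1 + + 0) * y)
      ratio-identity₁ = solve-∀
      ratio-identity₂ : ∀ N g y → (N + + 1) * ((N + + 2) * g - (N - + 1) * (N * N - + 2) * y) - 0ℤ ≡
        1ℤ * (1ℤ * (N + + 1) * (N + + 2) * g - 1ℤ * (N * N - + 2 + + 0) * (N * N - + 2 + + 1) * y)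
      ratio-identity₂ = solve-∀
      ratio-identity₃ : ∀ N g y →
        (N + + 1) * ((N + + 2) * (N + + 3) * g - (N - + 1) * (N * N - + 2) * (N * N - + 3) * y) - 0ℤ ≡
        1ℤ * (1ℤ * (N + + 1) * (N + + 2) * (N + + 3) * g
              - 1ℤ * (N * N - + 3 + + 0) * (N * N - + 3 + + 1) * (N * N - + 3 + + 2) * y)
      ratio-identity₃ = solve-∀

  -- Two bilinear differential identities

  -- The first local relation is n Q″ P = 2 (n - 1) P′ Q′ at the roots of Q. Adding P″ Q, zero
  -- there, makes it symmetric, so that the relation at the roots of P is the same one. `V` is
  -- antisymmetric for that purpose; its two coefficients are the ones found in `solve-V₀`.
  W V : ℤ → Series → Series → Series
  W N P Q = const N *ˢ (D (D Q) *ˢ P +ˢ D (D P) *ˢ Q) +ˢ const (- (+ 2 * (N - + 1))) *ˢ (D P *ˢ D Q)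
  V N P Q = const (+ 1 + + 6 * N) *ˢ (D (D (D Q)) *ˢ P +ˢ const (- 1ℤ) *ˢ (D (D (D P)) *ˢ Q))
         +ˢ const (+ 25 - + 14 * N) *ˢ (D (D Q) *ˢ D P +ˢ const (- 1ℤ) *ˢ (D Q *ˢ D (D P)))

  W-coeff : ∀ N P Q i → W N P Q i ≡
    N * ((D (D Q) *ˢ P) i + (D (D P) *ˢ Q) i) + - (+ 2 * (N - + 1)) * (D P *ˢ D Q) i
  W-coeff N P Q i = cong₂ _+_ (const-*ˢ N (D (D Q) *ˢ P +ˢ D (D P) *ˢ Q) i)
    (const-*ˢ (- (+ 2 * (N - + 1))) (D P *ˢ D Q) i)

  V-coeff : ∀ N P Q i → V N P Q i ≡
    (+ 1 + + 6 * N) * ((D (D (D Q)) *ˢ P) i + (- 1ℤ) * (D (D (D P)) *ˢ Q) i)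
    + (+ 25 - + 14 * N) * ((D (D Q) *ˢ D P) i + (- 1ℤ) * (D Q *ˢ D (D P)) i)
  V-coeff N P Q i = cong₂ _+_
    (trans (const-*ˢ (+ 1 + + 6 * N) (D (D (D Q)) *ˢ P +ˢ const (- 1ℤ) *ˢ (D (D (D P)) *ˢ Q)) i)
      (cong (λ w → (+ 1 + + 6 * N) * ((D (D (D Q)) *ˢ P) i + w)) (const-*ˢ (- 1ℤ) (D (D (D P)) *ˢ Q) i)))
    (trans (const-*ˢ (+ 25 - + 14 * N) (D (D Q) *ˢ D P +ˢ const (- 1ℤ) *ˢ (D Q *ˢ D (D P))) i)
      (cong (λ w → (+ 25 - + 14 * N) * ((D (D Q) *ˢ D P) i + w)) (const-*ˢ (- 1ℤ) (D Q *ˢ D (D P)) i)))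

  W-coeff₀ : ∀ N P Q → W N P Q 0 ≡ N * (+ 1 * (+ 2 * Q 2) * P 0 + + 1 * (+ 2 * P 2) * Q 0) + - (+ 2 * (N - + 1))
    * (+ 1 * P 1 * (+ 1 * Q 1))
  W-coeff₀ N P Q = trans (W-coeff N P Q 0) refl

  W-coeff₁ : ∀ N P Q → W N P Q 1 ≡ N * ((+ 1 * (+ 2 * Q 2) * P 1 + + 2 * (+ 3 * Q 3) * P 0) + (+ 1 * (+ 2 * P 2)
    * Q 1 + + 2 * (+ 3 * P 3) * Q 0)) + - (+ 2 * (N - + 1)) * (+ 1 * P 1 * (+ 2 * Q 2) + + 2 * P 2 * (+ 1 * Q 1))
  W-coeff₁ N P Q = trans (W-coeff N P Q 1) refl

  W-coeff₂ : ∀ N P Q → W N P Q 2 ≡ N * ((+ 1 * (+ 2 * Q 2) * P 2 + (+ 2 * (+ 3 * Q 3) * P 1 + + 3 * (+ 4 * Q 4)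
    * P 0)) + (+ 1 * (+ 2 * P 2) * Q 2 + (+ 2 * (+ 3 * P 3) * Q 1 + + 3 * (+ 4 * P 4) * Q 0))) + - (+ 2 * (N - + 1))
    * (+ 1 * P 1 * (+ 3 * Q 3) + (+ 2 * P 2 * (+ 2 * Q 2) + + 3 * P 3 * (+ 1 * Q 1)))
  W-coeff₂ N P Q = trans (W-coeff N P Q 2) refl

  V-coeff₀ : ∀ N P Q → V N P Q 0 ≡ (+ 1 + + 6 * N) * (+ 1 * (+ 2 * (+ 3 * Q 3)) * P 0 + (- 1ℤ) * (+ 1 * (+ 2 * (+ 3
    * P 3)) * Q 0)) + (+ 25 - + 14 * N) * (+ 1 * (+ 2 * Q 2) * (+ 1 * P 1) + (- 1ℤ) * (+ 1 * Q 1 * (+ 1 * (+ 2 * P 2))))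
  V-coeff₀ N P Q = trans (V-coeff N P Q 0) refl

  V-coeff₁ : ∀ N P Q → V N P Q 1 ≡ (+ 1 + + 6 * N) * ((+ 1 * (+ 2 * (+ 3 * Q 3)) * P 1 + + 2 * (+ 3 * (+ 4 * Q 4))
    * P 0) + (- 1ℤ) * (+ 1 * (+ 2 * (+ 3 * P 3)) * Q 1 + + 2 * (+ 3 * (+ 4 * P 4)) * Q 0)) + (+ 25 - + 14 * N) * ((+ 1
    * (+ 2 * Q 2) * (+ 2 * P 2) + + 2 * (+ 3 * Q 3) * (+ 1 * P 1)) + (- 1ℤ) * (+ 1 * Q 1 * (+ 2 * (+ 3 * P 3)) + + 2
    * Q 2 * (+ 1 * (+ 2 * P 2))))
  V-coeff₁ N P Q = trans (V-coeff N P Q 1) refl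

  W-symmetric : ∀ N P Q → W N P Q 0 ≡ W N Q P 0
  W-symmetric N P Q = trans (W-coeff₀ N P Q)
    (trans (identity N (P 0) (P 1) (P 2) (Q 0) (Q 1) (Q 2)) (sym (W-coeff₀ N Q P)))
    where
    identity : ∀ N P₀ P₁ P₂ Q₀ Q₁ Q₂ → N * (+ 1 * (+ 2 * Q₂) * P₀ + + 1 * (+ 2 * P₂) * Q₀) + - (+ 2 * (N - + 1))
      * (+ 1 * P₁ * (+ 1 * Q₁)) ≡ N * (+ 1 * (+ 2 * P₂) * Q₀ + + 1 * (+ 2 * Q₂) * P₀) + - (+ 2 * (N - + 1)) * (+ 1
      * Q₁ * (+ 1 * P₁))
    identity = solve-∀

  V-antisymmetric : ∀ N P Q → V N P Q 0 ≡ - V N Q P 0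
  V-antisymmetric N P Q = trans (V-coeff₀ N P Q)
    (trans (identity N (P 0) (P 1) (P 2) (P 3) (Q 0) (Q 1) (Q 2) (Q 3)) (cong -_ (sym (V-coeff₀ N Q P))))
    where
    identity : ∀ N P₀ P₁ P₂ P₃ Q₀ Q₁ Q₂ Q₃ → (+ 1 + + 6 * N) * (+ 1 * (+ 2 * (+ 3 * Q₃)) * P₀ + (- 1ℤ) * (+ 1 * (+ 2
      * (+ 3 * P₃)) * Q₀)) + (+ 25 - + 14 * N) * (+ 1 * (+ 2 * Q₂) * (+ 1 * P₁) + (- 1ℤ) * (+ 1 * Q₁ * (+ 1 * (+ 2
      * P₂)))) ≡ - ((+ 1 + + 6 * N) * (+ 1 * (+ 2 * (+ 3 * P₃)) * Q₀ + (- 1ℤ) * (+ 1 * (+ 2 * (+ 3 * Q₃)) * P₀)) + (+ 25 -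
      + 14 * N) * (+ 1 * (+ 2 * P₂) * (+ 1 * Q₁) + (- 1ℤ) * (+ 1 * P₁ * (+ 1 * (+ 2 * Q₂)))))
    identity = solve-∀

  -- In normalised coefficients the whole expression carries the factor P₀ Q₁, a unit at a point of
  -- B, and the terms with Q₀ drop out.
  W₁-normal : ∀ N P₀ P₁ P₂ P₃ Q₀ Q₁ Q₂ Q₃ u x₂ q₂ q₃ → N * ((+ 1 * (+ 2 * Q₂) * P₁ + + 2 * (+ 3 * Q₃) * P₀) + (+ 1
    * (+ 2 * P₂) * Q₁ + + 2 * (+ 3 * P₃) * Q₀)) + - (+ 2 * (N - + 1)) * (+ 1 * P₁ * (+ 2 * Q₂) + + 2 * P₂ * (+ 1 * Q₁)) ≈ 0ℤ
    → P₁ ≈ P₀ * u → P₂ ≈ P₀ * x₂ → Q₂ ≈ Q₁ * q₂ → Q₃ ≈ Q₁ * q₃ → Q₀ ≈ 0ℤ → P₀ * Q₁ * (N * (+ 6 * q₃ + + 2 * q₂ * u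
    + + 2 * x₂) - + 2 * (N - + 1) * (+ 2 * x₂ + + 2 * u * q₂)) ≈ 0ℤ
  W₁-normal N P₀ P₁ P₂ P₃ Q₀ Q₁ Q₂ Q₃ u x₂ q₂ q₃ e₁ e₂ e₃ e₄ e₅ e₆ = conclude (identity N P₀ P₁ P₂ P₃ Q₀ Q₁ Q₂ Q₃ u x₂ q₂ q₃)
      ((1ℤ) · e₁
       ⊕ (- ((+ 4 - + 2 * N) * Q₂)) · e₂
       ⊕ (- ((+ 4 - + 2 * N) * Q₁)) · e₃
       ⊕ (- ((+ 4 - + 2 * N) * (P₀ * u))) · e₄
       ⊕ (- (+ 6 * N * P₀)) · e₅
       ⊕ (- (+ 6 * N * P₃)) · e₆)
    where
    identity : ∀ N P₀ P₁ P₂ P₃ Q₀ Q₁ Q₂ Q₃ u x₂ q₂ q₃ → P₀ * Q₁ * (N * (+ 6 * q₃ + + 2 * q₂ * u + + 2 * x₂) - + 2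
      * (N - + 1) * (+ 2 * x₂ + + 2 * u * q₂)) - 0ℤ ≡ (1ℤ) * (N * ((+ 1 * (+ 2 * Q₂) * P₁ + + 2 * (+ 3 * Q₃) * P₀)
      + (+ 1 * (+ 2 * P₂) * Q₁ + + 2 * (+ 3 * P₃) * Q₀)) + - (+ 2 * (N - + 1)) * (+ 1 * P₁ * (+ 2 * Q₂) + + 2 * P₂
      * (+ 1 * Q₁)) - 0ℤ) + (- ((+ 4 - + 2 * N) * Q₂)) * (P₁ - P₀ * u) + (- ((+ 4 - + 2 * N) * Q₁)) * (P₂ - P₀ * x₂)
      + (- ((+ 4 - + 2 * N) * (P₀ * u))) * (Q₂ - Q₁ * q₂) + (- (+ 6 * N * P₀)) * (Q₃ - Q₁ * q₃) + (- (+ 6 * N * P₃))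
      * (Q₀ - 0ℤ)
    identity = solve-∀

  W₂-normal : ∀ N P₀ P₁ P₂ P₃ P₄ Q₀ Q₁ Q₂ Q₃ Q₄ u x₂ x₃ q₂ q₃ q₄ → N * ((+ 1 * (+ 2 * Q₂) * P₂ + (+ 2 * (+ 3 * Q₃)
    * P₁ + + 3 * (+ 4 * Q₄) * P₀)) + (+ 1 * (+ 2 * P₂) * Q₂ + (+ 2 * (+ 3 * P₃) * Q₁ + + 3 * (+ 4 * P₄) * Q₀))) + - (+ 2
    * (N - + 1)) * (+ 1 * P₁ * (+ 3 * Q₃) + (+ 2 * P₂ * (+ 2 * Q₂) + + 3 * P₃ * (+ 1 * Q₁))) ≈ 0ℤ → P₁ ≈ P₀ * u → P₂ ≈ P₀
    * x₂ → P₃ ≈ P₀ * x₃ → Q₂ ≈ Q₁ * q₂ → Q₃ ≈ Q₁ * q₃ → Q₄ ≈ Q₁ * q₄ → Q₀ ≈ 0ℤ → P₀ * Q₁ * (N * ((+ 12 * q₄ + + 6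
    * q₃ * u + + 2 * q₂ * x₂) + (+ 6 * x₃ + + 2 * x₂ * q₂)) - + 2 * (N - + 1) * (+ 3 * x₃ + + 4 * x₂ * q₂ + + 3 * u
    * q₃)) ≈ 0ℤ
  W₂-normal N P₀ P₁ P₂ P₃ P₄ Q₀ Q₁ Q₂ Q₃ Q₄ u x₂ x₃ q₂ q₃ q₄ e₁ e₂ e₃ e₄ e₅ e₆ e₇ e₈ = conclude
    (identity N P₀ P₁ P₂ P₃ P₄ Q₀ Q₁ Q₂ Q₃ Q₄ u x₂ x₃ q₂ q₃ q₄)
      ((1ℤ) · e₁
       ⊕ (- (+ 6 * Q₃)) · e₂
       ⊕ (- ((+ 8 - + 4 * N) * Q₂)) · e₃
       ⊕ (- (+ 6 * Q₁)) · e₄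
       ⊕ (- ((+ 8 - + 4 * N) * (P₀ * x₂))) · e₅
       ⊕ (- (+ 6 * (P₀ * u))) · e₆
       ⊕ (- (+ 12 * N * P₀)) · e₇
       ⊕ (- (+ 12 * N * P₄)) · e₈)
    where
    identity : ∀ N P₀ P₁ P₂ P₃ P₄ Q₀ Q₁ Q₂ Q₃ Q₄ u x₂ x₃ q₂ q₃ q₄ → P₀ * Q₁ * (N * ((+ 12 * q₄ + + 6 * q₃ * u +
      + 2 * q₂ * x₂) + (+ 6 * x₃ + + 2 * x₂ * q₂)) - + 2 * (N - + 1) * (+ 3 * x₃ + + 4 * x₂ * q₂ + + 3 * u * q₃)) - 0ℤ
      ≡ (1ℤ) * (N * ((+ 1 * (+ 2 * Q₂) * P₂ + (+ 2 * (+ 3 * Q₃) * P₁ + + 3 * (+ 4 * Q₄) * P₀)) + (+ 1 * (+ 2 * P₂)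
      * Q₂ + (+ 2 * (+ 3 * P₃) * Q₁ + + 3 * (+ 4 * P₄) * Q₀))) + - (+ 2 * (N - + 1)) * (+ 1 * P₁ * (+ 3 * Q₃) + (+ 2
      * P₂ * (+ 2 * Q₂) + + 3 * P₃ * (+ 1 * Q₁))) - 0ℤ) + (- (+ 6 * Q₃)) * (P₁ - P₀ * u) + (- ((+ 8 - + 4 * N) * Q₂))
      * (P₂ - P₀ * x₂) + (- (+ 6 * Q₁)) * (P₃ - P₀ * x₃) + (- ((+ 8 - + 4 * N) * (P₀ * x₂))) * (Q₂ - Q₁ * q₂) + (- (+ 6
      * (P₀ * u))) * (Q₃ - Q₁ * q₃) + (- (+ 12 * N * P₀)) * (Q₄ - Q₁ * q₄) + (- (+ 12 * N * P₄)) * (Q₀ - 0ℤ)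
    identity = solve-∀

  V₀-lift : ∀ N P₀ P₁ P₂ P₃ Q₀ Q₁ Q₂ Q₃ u x₂ q₂ q₃ → (+ 1 + + 6 * N) * (+ 6 * q₃) + (+ 25 - + 14 * N) * (+ 2 * u
    * q₂ - + 2 * x₂) ≈ 0ℤ → P₁ ≈ P₀ * u → P₂ ≈ P₀ * x₂ → Q₂ ≈ Q₁ * q₂ → Q₃ ≈ Q₁ * q₃ → Q₀ ≈ 0ℤ → (+ 1 + + 6 * N) * (+ 1
    * (+ 2 * (+ 3 * Q₃)) * P₀ + (- 1ℤ) * (+ 1 * (+ 2 * (+ 3 * P₃)) * Q₀)) + (+ 25 - + 14 * N) * (+ 1 * (+ 2 * Q₂)
    * (+ 1 * P₁) + (- 1ℤ) * (+ 1 * Q₁ * (+ 1 * (+ 2 * P₂)))) ≈ 0ℤ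
  V₀-lift N P₀ P₁ P₂ P₃ Q₀ Q₁ Q₂ Q₃ u x₂ q₂ q₃ e₁ e₂ e₃ e₄ e₅ e₆ = conclude (identity N P₀ P₁ P₂ P₃ Q₀ Q₁ Q₂ Q₃ u x₂ q₂ q₃)
      ((P₀ * Q₁) · e₁
       ⊕ ((+ 25 - + 14 * N) * (+ 2 * Q₂)) · e₂
       ⊕ (- ((+ 25 - + 14 * N) * (+ 2 * Q₁))) · e₃
       ⊕ ((+ 25 - + 14 * N) * (+ 2 * (P₀ * u))) · e₄
       ⊕ ((+ 1 + + 6 * N) * (+ 6 * P₀)) · e₅
       ⊕ (- ((+ 1 + + 6 * N) * (+ 6 * P₃))) · e₆)
    where
    identity : ∀ N P₀ P₁ P₂ P₃ Q₀ Q₁ Q₂ Q₃ u x₂ q₂ q₃ → (+ 1 + + 6 * N) * (+ 1 * (+ 2 * (+ 3 * Q₃)) * P₀ + (- 1ℤ)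
      * (+ 1 * (+ 2 * (+ 3 * P₃)) * Q₀)) + (+ 25 - + 14 * N) * (+ 1 * (+ 2 * Q₂) * (+ 1 * P₁) + (- 1ℤ) * (+ 1 * Q₁
      * (+ 1 * (+ 2 * P₂)))) - 0ℤ ≡ (P₀ * Q₁) * ((+ 1 + + 6 * N) * (+ 6 * q₃) + (+ 25 - + 14 * N) * (+ 2 * u * q₂ -
      + 2 * x₂) - 0ℤ) + ((+ 25 - + 14 * N) * (+ 2 * Q₂)) * (P₁ - P₀ * u) + (- ((+ 25 - + 14 * N) * (+ 2 * Q₁))) * (P₂ - P₀
      * x₂) + ((+ 25 - + 14 * N) * (+ 2 * (P₀ * u))) * (Q₂ - Q₁ * q₂) + ((+ 1 + + 6 * N) * (+ 6 * P₀)) * (Q₃ - Q₁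
      * q₃) + (- ((+ 1 + + 6 * N) * (+ 6 * P₃))) * (Q₀ - 0ℤ)
    identity = solve-∀

  V₁-normal : ∀ N P₀ P₁ P₂ P₃ P₄ Q₀ Q₁ Q₂ Q₃ Q₄ u x₂ x₃ q₂ q₃ q₄ → (+ 1 + + 6 * N) * ((+ 1 * (+ 2 * (+ 3 * Q₃))
    * P₁ + + 2 * (+ 3 * (+ 4 * Q₄)) * P₀) + (- 1ℤ) * (+ 1 * (+ 2 * (+ 3 * P₃)) * Q₁ + + 2 * (+ 3 * (+ 4 * P₄)) * Q₀))
    + (+ 25 - + 14 * N) * ((+ 1 * (+ 2 * Q₂) * (+ 2 * P₂) + + 2 * (+ 3 * Q₃) * (+ 1 * P₁)) + (- 1ℤ) * (+ 1 * Q₁ * (+ 2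
    * (+ 3 * P₃)) + + 2 * Q₂ * (+ 1 * (+ 2 * P₂)))) ≈ 0ℤ → P₁ ≈ P₀ * u → P₂ ≈ P₀ * x₂ → P₃ ≈ P₀ * x₃ → Q₂ ≈ Q₁ * q₂
    → Q₃ ≈ Q₁ * q₃ → Q₄ ≈ Q₁ * q₄ → Q₀ ≈ 0ℤ → P₀ * Q₁ * ((+ 1 + + 6 * N) * (+ 24 * q₄ + + 6 * q₃ * u - + 6 * x₃) + (+ 25 -
    + 14 * N) * ((+ 6 * q₃ * u + + 4 * q₂ * x₂) - (+ 6 * x₃ + + 4 * x₂ * q₂))) ≈ 0ℤ
  V₁-normal N P₀ P₁ P₂ P₃ P₄ Q₀ Q₁ Q₂ Q₃ Q₄ u x₂ x₃ q₂ q₃ q₄ e₁ e₂ e₃ e₄ e₅ e₆ e₇ e₈ = conclude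
    (identity N P₀ P₁ P₂ P₃ P₄ Q₀ Q₁ Q₂ Q₃ Q₄ u x₂ x₃ q₂ q₃ q₄)
      ((1ℤ) · e₁
       ⊕ (- ((+ 26 - + 8 * N) * (+ 6 * Q₃))) · e₂
       ⊕ (0ℤ) · e₃
       ⊕ ((+ 26 - + 8 * N) * (+ 6 * Q₁)) · e₄
       ⊕ (0ℤ) · e₅
       ⊕ (- ((+ 26 - + 8 * N) * (+ 6 * (P₀ * u)))) · e₆
       ⊕ (- ((+ 1 + + 6 * N) * (+ 24 * P₀))) · e₇
       ⊕ ((+ 1 + + 6 * N) * (+ 24 * P₄)) · e₈)
    where
    identity : ∀ N P₀ P₁ P₂ P₃ P₄ Q₀ Q₁ Q₂ Q₃ Q₄ u x₂ x₃ q₂ q₃ q₄ → P₀ * Q₁ * ((+ 1 + + 6 * N) * (+ 24 * q₄ + + 6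
      * q₃ * u - + 6 * x₃) + (+ 25 - + 14 * N) * ((+ 6 * q₃ * u + + 4 * q₂ * x₂) - (+ 6 * x₃ + + 4 * x₂ * q₂))) - 0ℤ
      ≡ (1ℤ) * ((+ 1 + + 6 * N) * ((+ 1 * (+ 2 * (+ 3 * Q₃)) * P₁ + + 2 * (+ 3 * (+ 4 * Q₄)) * P₀) + (- 1ℤ) * (+ 1
      * (+ 2 * (+ 3 * P₃)) * Q₁ + + 2 * (+ 3 * (+ 4 * P₄)) * Q₀)) + (+ 25 - + 14 * N) * ((+ 1 * (+ 2 * Q₂) * (+ 2
      * P₂) + + 2 * (+ 3 * Q₃) * (+ 1 * P₁)) + (- 1ℤ) * (+ 1 * Q₁ * (+ 2 * (+ 3 * P₃)) + + 2 * Q₂ * (+ 1 * (+ 2 * P₂)))) - 0ℤ)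
      + (- ((+ 26 - + 8 * N) * (+ 6 * Q₃))) * (P₁ - P₀ * u) + (0ℤ) * (P₂ - P₀ * x₂) + ((+ 26 - + 8 * N) * (+ 6 * Q₁))
      * (P₃ - P₀ * x₃) + (0ℤ) * (Q₂ - Q₁ * q₂) + (- ((+ 26 - + 8 * N) * (+ 6 * (P₀ * u)))) * (Q₃ - Q₁ * q₃) + (- ((+ 1
      + + 6 * N) * (+ 24 * P₀))) * (Q₄ - Q₁ * q₄) + ((+ 1 + + 6 * N) * (+ 24 * P₄)) * (Q₀ - 0ℤ)
    identity = solve-∀

  Poly-D′ : ∀ {n Φ} → Poly (suc n) Φ → Poly (suc n) (λ c → D (Φ c))
  Poly-D′ {n} q = Poly-≤ (ℕₚ.n≤1+n n) (Poly-D q)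

  -- Each term carries two derivatives, so the degree stays below n + n, the number of points in A
  -- and B together.
  Poly-W : ∀ {n P Q} N → Poly (suc n) P → Poly (suc n) Q → Poly (n ℕ.+ n) (λ c → W N (P c) (Q c))
  Poly-W N p q = Poly-+
    (Poly-• N (Poly-+ (Poly-* (Poly-D (Poly-D′ q)) p) (Poly-* (Poly-D (Poly-D′ p)) q)))
    (Poly-• (- (+ 2 * (N - + 1))) (Poly-* (Poly-D p) (Poly-D′ q)))

  Poly-V : ∀ {n P Q} N → Poly (suc n) P → Poly (suc n) Q → Poly (n ℕ.+ n) (λ c → V N (P c) (Q c))
  Poly-V N p q = Poly-+
    (Poly-• (+ 1 + + 6 * N) (Poly-+ (Poly-* (Poly-D (Poly-D′ (Poly-D′ q))) p)
      (Poly-• (- 1ℤ) (Poly-* (Poly-D (Poly-D′ (Poly-D′ p))) q))))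
    (Poly-• (+ 25 - + 14 * N) (Poly-+ (Poly-* (Poly-D (Poly-D′ q)) (Poly-D′ p))
      (Poly-• (- 1ℤ) (Poly-* (Poly-D q) (Poly-D′ (Poly-D′ p))))))

  -- Solving the local relations at one point

  cube-zero : ∀ x → x * x * x ≈ 0ℤ → x ≈ 0ℤ
  cube-zero x e = [ (λ e′ → [ id , id ]′ (integral x x e′)) , id ]′ (integral (x * x) x e)

  module Local {P Q : Series} {N u x₂ x₃ q₂ q₃ q₄ : ℤ} (J : Jet N u x₂ x₃ q₂ q₃ q₄)
    (19<p : 19 < p) (2N²+1≈0 : + 2 * (N * N) + + 1 ≈ 0ℤ)
    (P₀≉0 : P 0 ≉ 0ℤ) (Q₀≈0 : Q 0 ≈ 0ℤ) (Q₁≉0 : Q 1 ≉ 0ℤ)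
    (P₁≈ : P 1 ≈ P 0 * u) (P₂≈ : P 2 ≈ P 0 * x₂) (P₃≈ : P 3 ≈ P 0 * x₃)
    (Q₂≈ : Q 2 ≈ Q 1 * q₂) (Q₃≈ : Q 3 ≈ Q 1 * q₃) (Q₄≈ : Q 4 ≈ Q 1 * q₄) where
    open Jet J

    private
      -- The integers that the elimination divides by have prime factors 2, 3, 5, 11 and 19 only;
      -- this is the source of the bound 19.
      small : ∀ k {k≤ : T (suc k ≤ᵇ 19)} → + suc k ≉ 0ℤ
      small k {k≤} = positive-nonzero (s≤s z≤n) (ℕₚ.≤-<-trans (ℕₚ.≤ᵇ⇒≤ (suc k) 19 k≤) 19<p)

      P₀Q₁≉0 : P 0 * Q 1 ≉ 0ℤ
      P₀Q₁≉0 = *-nonzero P₀≉0 Q₁≉0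

      q₂-eq : q₂ - (+ 1 + + 2 * N) * u ≈ 0ℤ
      q₂-eq = solve-q₂ N u q₂ g₁ y₁ ratio₁ power₁ inverse₁ 2N²+1≈0

      g₁-eq : g₁ - (N - + 1) * u ≈ 0ℤ
      g₁-eq = solve-g₁ N u g₁ y₁ ratio₁ inverse₁

      y₂-eq : y₂ - (u * u - x₂) ≈ 0ℤ
      y₂-eq = solve-y₂ u x₂ y₁ y₂ inverse₂ inverse₁

      g₂-eq : + 4 * g₂ - (+ 4 * N * q₃ + (+ 5 - + 2 * N) * (u * u)) ≈ 0ℤ
      g₂-eq = solve-g₂ N u q₂ q₃ g₁ g₂ power₂ g₁-eq q₂-eq 2N²+1≈0

    -- A stage of its own: its conclusion about `V` at each single point is what proves V = 0
    -- identically, and `Third` then takes the next coefficient of that identity.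
    module Second (W₁≈0 : W N P Q 1 ≈ 0ℤ) where
      private
        W₁-eq : + 3 * q₃ - (+ 1 + + 4 * N) * (x₂ + u * q₂) ≈ 0ℤ
        W₁-eq = solve-W₁ N u x₂ q₂ q₃ (cancelˡ P₀Q₁≉0
          (W₁-normal N (P 0) (P 1) (P 2) (P 3) (Q 0) (Q 1) (Q 2) (Q 3) u x₂ q₂ q₃
            (≈-trans (≈-reflexive (sym (W-coeff₁ N P Q))) W₁≈0) P₁≈ P₂≈ Q₂≈ Q₃≈ Q₀≈0)) 2N²+1≈0

        x₂-eq : + 22 * x₂ - (+ 18 * N + + 5) * (u * u) ≈ 0ℤ
        x₂-eq = cancelˡ {+ 3} (small 2) (solve-x₂ N u x₂ (cancelˡ {+ 3} (small 2)
          (combine-x₂ N u x₂ q₂ q₃ g₂ y₂ ratio₂ g₂-eq y₂-eq W₁-eq q₂-eq 2N²+1≈0)) 2N²+1≈0)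

        q₃-eq : + 66 * q₃ - (+ 170 * N - + 97) * (u * u) ≈ 0ℤ
        q₃-eq = solve-q₃ N u x₂ q₂ q₃ W₁-eq x₂-eq q₂-eq 2N²+1≈0

      V-vanishes : V N P Q 0 ≈ 0ℤ
      V-vanishes = ≈-trans (≈-reflexive (V-coeff₀ N P Q))
        (V₀-lift N (P 0) (P 1) (P 2) (P 3) (Q 0) (Q 1) (Q 2) (Q 3) u x₂ q₂ q₃
          (cancelˡ {+ 11} (small 10) (solve-V₀ N u x₂ q₂ q₃ q₃-eq x₂-eq q₂-eq 2N²+1≈0)) P₁≈ P₂≈ Q₂≈ Q₃≈ Q₀≈0)

      module Third (W₂≈0 : W N P Q 2 ≈ 0ℤ) (V₁≈0 : V N P Q 1 ≈ 0ℤ) where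
        private
          V₁-eq : + 132 * (+ 1 + + 6 * N) * q₄ + (+ 13 - + 4 * N) * ((+ 170 * N - + 97) * (u * u * u) - + 66 * x₃) ≈ 0ℤ
          V₁-eq = reduce-V₁ N u x₃ q₃ q₄ (cancelˡ {+ 12} (small 11) (solve-V₁ N u x₂ x₃ q₂ q₃ q₄ (cancelˡ P₀Q₁≉0
            (V₁-normal N (P 0) (P 1) (P 2) (P 3) (P 4) (Q 0) (Q 1) (Q 2) (Q 3) (Q 4) u x₂ x₃ q₂ q₃ q₄
              (≈-trans (≈-reflexive (sym (V-coeff₁ N P Q))) V₁≈0) P₁≈ P₂≈ P₃≈ Q₂≈ Q₃≈ Q₄≈ Q₀≈0)))) q₃-eq

          W₂-eq : + 396 * N * q₄ + + 198 * x₃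
            + (+ 3 * (+ 170 * N - + 97) + + 3 * (+ 4 - + 2 * N) * (+ 18 * N + + 5) * (+ 1 + + 2 * N)) * (u * u * u) ≈ 0ℤ
          W₂-eq = reduce-W₂ N u x₂ x₃ q₂ q₃ q₄ (cancelˡ {+ 2} (small 1) (solve-W₂ N u x₂ x₃ q₂ q₃ q₄ (cancelˡ P₀Q₁≉0
            (W₂-normal N (P 0) (P 1) (P 2) (P 3) (P 4) (Q 0) (Q 1) (Q 2) (Q 3) (Q 4) u x₂ x₃ q₂ q₃ q₄
              (≈-trans (≈-reflexive (sym (W-coeff₂ N P Q))) W₂≈0) P₁≈ P₂≈ P₃≈ Q₂≈ Q₃≈ Q₄≈ Q₀≈0)))) q₃-eq q₂-eq x₂-eq

          L₃-eq : (+ 6930 * N - + 6930) * x₃ + (+ 1980 - + 4356 * N) * q₄ + (+ 7290 - + 1377 * N) * (u * u * u) ≈ 0ℤ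
          L₃-eq = reduce-L₃ N u x₂ x₃ q₂ q₃ q₄ g₁ g₂
            (solve-L₃ N u x₂ x₃ q₂ q₃ q₄ g₁ g₂ g₃ y₃ power₃ ratio₃
              (solve-y₃ u x₂ x₃ y₁ y₂ y₃ inverse₃ y₂-eq inverse₁) 2N²+1≈0)
            x₂-eq g₂-eq q₂-eq q₃-eq g₁-eq 2N²+1≈0

          360≉0 : + 360 ≉ 0ℤ
          360≉0 = *-nonzero {+ 18} {+ 20} (small 17) (*-nonzero {+ 4} {+ 5} (small 3) (small 4))

          1881≉0 : + 1881 ≉ 0ℤ
          1881≉0 = *-nonzero {+ 99} {+ 19} (*-nonzero {+ 9} {+ 11} (small 8) (small 10)) (small 18)

          -- 1881 = 2 · 4² + 43² is twice the norm of 4 + 43 N, where N² = -1/2.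
          u³≈0 : u * u * u ≈ 0ℤ
          u³≈0 = cancelˡ 1881≉0 (conclude (identity N (u * u * u))
            ((+ 2 * (+ 4 - + 43 * N)) · cancelˡ 360≉0 (eliminate N u x₃ q₄ V₁-eq W₂-eq L₃-eq 2N²+1≈0)
             ⊕ (+ 1849 * (u * u * u)) · 2N²+1≈0))
            where
            identity : ∀ N t → + 1881 * t - 0ℤ ≡
              (+ 2 * (+ 4 - + 43 * N)) * ((+ 4 + + 43 * N) * t - 0ℤ) + (+ 1849 * t) * (+ 2 * (N * N) + + 1 - 0ℤ)
            identity = solve-∀

          u≈0 : u ≈ 0ℤ
          u≈0 = cube-zero u u³≈0

        P₁≈0 : P 1 ≈ 0ℤ
        P₁≈0 = ≈-trans P₁≈ (*-zeroʳ (P 0) u≈0)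

  -- The case |A| = |B|

  W₀-lift : ∀ N P₀ P₁ P₂ Q₀ Q₁ Q₂ → N * (Q₂ * P₀) ≈ (N - + 1) * (P₁ * Q₁) → Q₀ ≈ 0ℤ →
    N * (+ 1 * (+ 2 * Q₂) * P₀ + + 1 * (+ 2 * P₂) * Q₀) + - (+ 2 * (N - + 1)) * (+ 1 * P₁ * (+ 1 * Q₁)) ≈ 0ℤ
  W₀-lift N P₀ P₁ P₂ Q₀ Q₁ Q₂ e₁ e₂ = conclude (identity N P₀ P₁ P₂ Q₀ Q₁ Q₂) ((+ 2) · e₁ ⊕ (+ 2 * N * P₂) · e₂)
    where
    identity : ∀ N P₀ P₁ P₂ Q₀ Q₁ Q₂ →
      N * (+ 1 * (+ 2 * Q₂) * P₀ + + 1 * (+ 2 * P₂) * Q₀) + - (+ 2 * (N - + 1)) * (+ 1 * P₁ * (+ 1 * Q₁)) - 0ℤ ≡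
      (+ 2) * (N * (Q₂ * P₀) - (N - + 1) * (P₁ * Q₁)) + (+ 2 * N * P₂) * (Q₀ - 0ℤ)
    identity = solve-∀

  cancel-N+1 : ∀ N s t → N + + 1 ≉ 0ℤ → N * (N + + 1) * s ≈ (N * N - + 1) * t → N * s ≈ (N - + 1) * t
  cancel-N+1 N s t N+1≉0 e = zero-difference (cancelˡ {N + + 1} N+1≉0 (conclude (identity N s t) (1ℤ · e)))
    where
    identity : ∀ N s t → (N + + 1) * (N * s - (N - + 1) * t) - 0ℤ ≡ 1ℤ * (N * (N + + 1) * s - (N * N - + 1) * t)
    identity = solve-∀

  normalise : ∀ x y → x ≉ 0ℤ → y ≈ x * (inv x * y)
  normalise x y x≉0 = conclude (identity x y (inv x)) ((- y) · inv-inverse x≉0)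
    where
    identity : ∀ x y i → y - x * (i * y) ≡ (- y) * (x * i - 1ℤ)
    identity = solve-∀

  module Balanced {A B : List ℤ} {n : ℕ} (|A|≡n : length A ≡ n) (|B|≡n : length B ≡ n)
    (A-distinct : Distinct A) (B-distinct : Distinct B)
    (disjoint : ∀ {a b} → a ∈ A → b ∈ B → b ≉ a)
    (expansionB : ∀ {b} → b ∈ B → Expansion n (n ℕ.* n) (prod A b) (prod B b))
    (expansionA : ∀ {a} → a ∈ A → Expansion n (n ℕ.* n) (prod B a) (prod A a))
    (3≤n : 3 ≤ n) (1+n<p : suc n < p) (2N²+1≈0 : + 2 * (+ n * + n) + + 1 ≈ 0ℤ) where

    private
      N : ℤ
      N = + n

      n+3≤m : n ℕ.+ 3 ≤ n ℕ.* n
      n+3≤m = ℕₚ.≤-trans (ℕₚ.+-monoʳ-≤ n (ℕₚ.≤-trans 3≤n (ℕₚ.m≤m+n n _))) (ℕₚ.*-monoˡ-≤ n 3≤n)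

      N+1≉0 : N + + 1 ≉ 0ℤ
      N+1≉0 = subst (_≉ 0ℤ) (trans (cong +_ (ℕₚ.+-comm 1 n)) (ℤₚ.pos-+ n 1)) (positive-nonzero (s≤s z≤n) 1+n<p)

      A++B-distinct : Distinct (A ++ B)
      A++B-distinct = AllPairsₚ.++⁺ A-distinct B-distinct
        (All.tabulate λ a∈ → All.tabulate λ b∈ e → disjoint a∈ b∈ (≈-sym e))

      vanishing : ∀ {Φ} → Poly (n ℕ.+ n) Φ → (∀ {a} → a ∈ A → Φ a 0 ≈ 0ℤ) → (∀ {b} → b ∈ B → Φ b 0 ≈ 0ℤ) →
        ∀ c → Φ c ≋ const 0ℤ
      vanishing q rootA rootB = many-roots⇒zero (A ++ B) A++B-distinct
        (Allₚ.++⁺ (All.tabulate rootA) (All.tabulate rootB)) q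
        (ℕₚ.≤-reflexive (sym (trans (length-++ A) (cong₂ ℕ._+_ |A|≡n |B|≡n))))

      PA : Poly (suc n) (prod A)
      PA = subst (λ k → Poly (suc k) (prod A)) |A|≡n (Poly-prod A)

      PB : Poly (suc n) (prod B)
      PB = subst (λ k → Poly (suc k) (prod B)) |B|≡n (Poly-prod B)

      W-root : ∀ {P Q} → Expansion n (n ℕ.* n) P Q → Q 0 ≈ 0ℤ → W N P Q 0 ≈ 0ℤ
      W-root {P} {Q} E Q₀≈0 = ≈-trans (≈-reflexive (W-coeff₀ N P Q))
        (W₀-lift N (P 0) (P 1) (P 2) (Q 0) (Q 1) (Q 2)
          (cancel-N+1 N (Q 2 * P 0) (P 1 * Q 1) N+1≉0
            (subst (λ m → N * (N + + 1) * (Q 2 * P 0) ≈ (m - + 1) * (P 1 * Q 1)) (ℤₚ.pos-* n n)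
              (first-order E (ℕₚ.≤-trans (ℕₚ.+-monoʳ-≤ n (s≤s z≤n)) n+3≤m)))) Q₀≈0)

    W-zero : ∀ c → W N (prod A c) (prod B c) ≋ const 0ℤ
    W-zero = vanishing (Poly-W N PA PB)
      (λ {a} a∈ → ≈-trans (≈-reflexive (W-symmetric N (prod A a) (prod B a)))
        (W-root (expansionA a∈) (prod-root A a∈)))
      (λ b∈ → W-root (expansionB b∈) (prod-root B b∈))

    module _ (19<p : 19 < p) where
      private
        module AtB {b} (b∈ : b ∈ B) where
          P Q : Series
          P = prod A b
          Q = prod B b
          P₀≉0 : P 0 ≉ 0ℤ
          P₀≉0 = prod-value-nonzero A (All.tabulate λ a∈ → disjoint a∈ b∈)
          Q₁≉0 : Q 1 ≉ 0ℤ
          Q₁≉0 = prod-simple-root B B-distinct b∈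
          open Local {P} {Q} (jet (expansionB b∈) n+3≤m P₀≉0 Q₁≉0 N+1≉0) 19<p 2N²+1≈0 P₀≉0 (prod-root B b∈) Q₁≉0
            (normalise (P 0) (P 1) P₀≉0) (normalise (P 0) (P 2) P₀≉0) (normalise (P 0) (P 3) P₀≉0)
            (normalise (Q 1) (Q 2) Q₁≉0) (normalise (Q 1) (Q 3) Q₁≉0) (normalise (Q 1) (Q 4) Q₁≉0) public
          open Second (≋0⇒ (W-zero b) 1) public

        module AtA {a} (a∈ : a ∈ A) where
          P Q : Series
          P = prod B a
          Q = prod A a
          P₀≉0 : P 0 ≉ 0ℤ
          P₀≉0 = prod-value-nonzero B (All.tabulate λ b∈ e → disjoint a∈ b∈ (≈-sym e))
          Q₁≉0 : Q 1 ≉ 0ℤ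
          Q₁≉0 = prod-simple-root A A-distinct a∈
          W′-zero : ∀ c → W N (prod B c) (prod A c) ≋ const 0ℤ
          W′-zero = vanishing (Poly-W N PB PA)
            (λ a∈ → W-root (expansionA a∈) (prod-root A a∈))
            (λ {b} b∈ → ≈-trans (≈-reflexive (W-symmetric N (prod B b) (prod A b)))
              (W-root (expansionB b∈) (prod-root B b∈)))
          open Local {P} {Q} (jet (expansionA a∈) n+3≤m P₀≉0 Q₁≉0 N+1≉0) 19<p 2N²+1≈0 P₀≉0 (prod-root A a∈) Q₁≉0
            (normalise (P 0) (P 1) P₀≉0) (normalise (P 0) (P 2) P₀≉0) (normalise (P 0) (P 3) P₀≉0)
            (normalise (Q 1) (Q 2) Q₁≉0) (normalise (Q 1) (Q 3) Q₁≉0) (normalise (Q 1) (Q 4) Q₁≉0) public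
          open Second (≋0⇒ (W′-zero a) 1) public

      V-zero : ∀ c → V N (prod A c) (prod B c) ≋ const 0ℤ
      V-zero = vanishing (Poly-V N PA PB)
        (λ {a} a∈ → ≈-trans (≈-reflexive (V-antisymmetric N (prod A a) (prod B a))) (neg-cong (AtA.V-vanishes a∈)))
        AtB.V-vanishes

      critical : ∀ {b} → b ∈ B → prod A b 1 ≈ 0ℤ
      -- Higher coefficients are available because `W` and `V` vanish as polynomials, not merely in
      -- value at b.
      critical {b} b∈ = AtB.Third.P₁≈0 b∈ (≋0⇒ (W-zero b) 2) (≋0⇒ (V-zero b) 1)

      contradiction : ∀ {a} → a ∈ A → ⊥
      contradiction {a} a∈ = prod-simple-root A A-distinct a∈
        (≈-trans (≈-reflexive (sym (ℤₚ.*-identityˡ (prod A a 1))))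
          (≋0⇒ (many-roots⇒zero B B-distinct
            (All.tabulate {P = λ b → D (prod A b) 0 ≈ 0ℤ} λ b∈ → *-zeroʳ (+ 1) (critical b∈))
            (Poly-D PA) (ℕₚ.≤-reflexive (sym |B|≡n)) a) 0))

  -- Power sums

  sum : List ℤ → (ℤ → ℤ) → ℤ
  sum []       f = 0ℤ
  sum (x ∷ xs) f = f x + sum xs f

  sum-cong : ∀ xs {f g} → (∀ {x} → x ∈ xs → f x ≈ g x) → sum xs f ≈ sum xs g
  sum-cong []       e = ≈-refl
  sum-cong (x ∷ xs) e = +-cong (e (here refl)) (sum-cong xs (λ x∈ → e (there x∈)))

  sum-cong-≡ : ∀ xs {f g} → (∀ x → f x ≡ g x) → sum xs f ≡ sum xs g
  sum-cong-≡ []       e = refl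
  sum-cong-≡ (x ∷ xs) e = cong₂ _+_ (e x) (sum-cong-≡ xs e)

  sum-+ : ∀ xs f g → sum xs (λ x → f x + g x) ≡ sum xs f + sum xs g
  sum-+ []       f g = refl
  sum-+ (x ∷ xs) f g rewrite sum-+ xs f g = identity (f x) (g x) (sum xs f) (sum xs g)
    where
    identity : ∀ a b c d → a + b + (c + d) ≡ a + c + (b + d)
    identity = solve-∀

  sum-scale : ∀ xs c f → sum xs (λ x → c * f x) ≡ c * sum xs f
  sum-scale []       c f = sym (ℤₚ.*-zeroʳ c)
  sum-scale (x ∷ xs) c f rewrite sum-scale xs c f = sym (ℤₚ.*-distribˡ-+ c (f x) (sum xs f))

  sum-zero : ∀ xs → sum xs (λ _ → 0ℤ) ≡ 0ℤ
  sum-zero []       = refl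
  sum-zero (x ∷ xs) = trans (ℤₚ.+-identityˡ _) (sum-zero xs)

  sum-swap : ∀ xs ys (f : ℤ → ℤ → ℤ) → sum xs (λ x → sum ys (f x)) ≡ sum ys (λ y → sum xs (λ x → f x y))
  sum-swap []       ys f = sym (sum-zero ys)
  sum-swap (x ∷ xs) ys f rewrite sum-swap xs ys f = sym (sum-+ ys (f x) (λ y → sum xs (λ x → f x y)))

  sum-product : ∀ xs ys f g → sum xs (λ x → sum ys (λ y → f x * g y)) ≡ sum xs f * sum ys g
  sum-product []       ys f g = sym (ℤₚ.*-zeroˡ (sum ys g))
  sum-product (x ∷ xs) ys f g rewrite sum-product xs ys f g | sum-scale ys (f x) g =
    sym (ℤₚ.*-distribʳ-+ (sum ys g) (f x) (sum xs f))

  powerSum : List ℤ → ℕ → ℤ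
  powerSum xs j = sum xs (_^ j)

  ⟪_⟫ : List ℤ → ℤ
  ⟪ xs ⟫ = + length xs

  powerSum-0 : ∀ xs → powerSum xs 0 ≡ ⟪ xs ⟫
  powerSum-0 []       = refl
  powerSum-0 (x ∷ xs) = cong (λ w → 1ℤ + w) (powerSum-0 xs)

  -- (xˢ - yˢ) / (x - y)
  quotient : ℕ → ℤ → ℤ → ℤ
  quotient zero    x y = 0ℤ
  quotient (suc s) x y = x ^ s + y * quotient s x y

  quotient-correct : ∀ s x y → (x - y) * quotient s x y ≡ x ^ s - y ^ s
  quotient-correct zero    x y = ℤₚ.*-zeroʳ (x - y)
  quotient-correct (suc s) x y = trans (split x y (x ^ s) (quotient s x y))
    (trans (cong (λ w → (x - y) * x ^ s + y * w) (quotient-correct s x y)) (join x y (x ^ s) (y ^ s)))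
    where
    split : ∀ x y a q → (x - y) * (a + y * q) ≡ (x - y) * a + y * ((x - y) * q)
    split = solve-∀
    join : ∀ x y a b → (x - y) * a + y * (a - b) ≡ x * a - y * b
    join = solve-∀

  quotient-diagonal : ∀ j x → quotient (suc j) x x ≡ + suc j * x ^ j
  quotient-diagonal zero    x = cong (λ w → 1ℤ + w) (ℤₚ.*-zeroʳ x)
  quotient-diagonal (suc j) x = trans (cong (λ w → x ^ suc j + x * w) (quotient-diagonal j x))
    (identity x (x ^ j) (+ suc j))
    where
    identity : ∀ x a j → x * a + x * (j * a) ≡ (1ℤ + j) * (x * a)
    identity = solve-∀

  quotient-inv : ∀ s {x y} → x ≉ y → (x ^ s - y ^ s) * inv (x - y) ≈ quotient s x y
  quotient-inv s {x} {y} x≉y = ≈-trans (≈-reflexive (cong (λ w → w * inv (x - y)) (sym (quotient-correct s x y))))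
    (conclude (identity (x - y) (quotient s x y) (inv (x - y))) (quotient s x y · inv-inverse (difference-nonzero x≉y)))
    where
    identity : ∀ d q i → d * q * i - q ≡ q * (d * i - 1ℤ)
    identity = solve-∀

  -- Unrolled by `moment-suc`, this is the sum over i < s of pᵢ(xs) p_(s-1-i+e)(ys) with pᵢ the
  -- power sums; `e` carries the recursion.
  moment : List ℤ → List ℤ → ℕ → ℕ → ℤ
  moment xs ys s e = sum xs (λ x → sum ys (λ y → y ^ e * quotient s x y))

  moment-zero : ∀ xs ys e → moment xs ys 0 e ≡ 0ℤ
  moment-zero xs ys e = trans (sum-cong-≡ xs (λ x → trans (sum-cong-≡ ys (λ y → ℤₚ.*-zeroʳ (y ^ e))) (sum-zero ys)))
    (sum-zero xs)

  moment-suc : ∀ xs ys s e → moment xs ys (suc s) e ≡ powerSum xs s * powerSum ys e + moment xs ys s (suc e)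
  moment-suc xs ys s e =
    trans (sum-cong-≡ xs (λ x → trans
            (sum-cong-≡ ys (λ y → identity (x ^ s) y (y ^ e) (quotient s x y)))
            (sum-+ ys (λ y → x ^ s * y ^ e) (λ y → y ^ suc e * quotient s x y))))
      (trans (sum-+ xs (λ x → sum ys (λ y → x ^ s * y ^ e)) (λ x → sum ys (λ y → y ^ suc e * quotient s x y)))
        (cong (λ w → w + moment xs ys s (suc e)) (sum-product xs ys (_^ s) (_^ e))))
    where
    identity : ∀ a y b q → b * (a + y * q) ≡ a * b + y * b * q
    identity = solve-∀

  Vanishing : List ℤ → ℕ → Set
  Vanishing xs j = ∀ i → 0 < i → i < j → powerSum xs i ≈ 0ℤ

  -- In the unrolled sum every index on `xs` lies below j, so only index 0 survives.
  moment-inner : ∀ xs ys {j} → Vanishing xs j → ∀ s e → suc s ℕ.+ suc e ≡ suc j →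
    moment xs ys (suc s) (suc e) ≈ powerSum xs 0 * powerSum ys j
  moment-inner xs ys vx zero e refl = ≈-reflexive (trans (moment-suc xs ys 0 (suc e))
    (trans (cong (λ w → powerSum xs 0 * powerSum ys (suc e) + w) (moment-zero xs ys (suc (suc e)))) (ℤₚ.+-identityʳ _)))
  moment-inner xs ys {j} vx (suc s) e eq = ≈-trans (≈-reflexive (moment-suc xs ys (suc s) (suc e)))
    (≈-trans (+-cong (*-zeroˡ (powerSum ys (suc e)) (vx (suc s) (s≤s z≤n) s<j))
                     (moment-inner xs ys vx s (suc e) (trans (cong suc (ℕₚ.+-suc s (suc e))) eq)))
      (≈-reflexive (ℤₚ.+-identityˡ _)))
    where
    s<j : suc s < j
    s<j = subst (suc s <_) (ℕₚ.suc-injective eq) (ℕₚ.m<m+n (suc s) (s≤s z≤n))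

  moment-top : ∀ xs ys j → Vanishing xs (suc j) →
    moment xs ys (suc (suc j)) 0 ≈ powerSum xs (suc j) * powerSum ys 0 + powerSum xs 0 * powerSum ys (suc j)
  moment-top xs ys j vx = ≈-trans (≈-reflexive (moment-suc xs ys (suc j) 0))
    (+-congˡ (powerSum xs (suc j) * powerSum ys 0) (moment-inner xs ys vx j 0 (cong suc (ℕₚ.+-comm j 1))))

  -- The weights x^i y^e allow (x - y)^s to be expanded one factor at a time, without binomial
  -- coefficients.
  mixed : List ℤ → List ℤ → ℕ → ℕ → ℕ → ℤ
  mixed xs ys i e s = sum ys (λ y → sum xs (λ x → x ^ i * y ^ e * (x - y) ^ s))

  mixed-zero : ∀ xs ys i e → mixed xs ys i e 0 ≡ powerSum xs i * powerSum ys e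
  mixed-zero xs ys i e = trans (sum-cong-≡ ys (λ y → sum-cong-≡ xs (λ x → identity (x ^ i) (y ^ e))))
    (trans (sum-product ys xs (_^ e) (_^ i)) (ℤₚ.*-comm (powerSum ys e) (powerSum xs i)))
    where
    identity : ∀ a b → a * b * 1ℤ ≡ b * a
    identity = solve-∀

  mixed-suc : ∀ xs ys i e s → mixed xs ys i e (suc s) ≡ mixed xs ys (suc i) e s + - 1ℤ * mixed xs ys i (suc e) s
  mixed-suc xs ys i e s = trans
    (sum-cong-≡ ys (λ y → trans (sum-cong-≡ xs (λ x → identity x y (x ^ i) (y ^ e) ((x - y) ^ s)))
      (trans (sum-+ xs (λ x → x ^ suc i * y ^ e * (x - y) ^ s) (λ x → - 1ℤ * (x ^ i * y ^ suc e * (x - y) ^ s)))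
        (cong (λ w → sum xs (λ x → x ^ suc i * y ^ e * (x - y) ^ s) + w)
          (sum-scale xs (- 1ℤ) (λ x → x ^ i * y ^ suc e * (x - y) ^ s))))))
    (trans (sum-+ ys (λ y → sum xs (λ x → x ^ suc i * y ^ e * (x - y) ^ s))
                     (λ y → - 1ℤ * sum xs (λ x → x ^ i * y ^ suc e * (x - y) ^ s)))
      (cong (λ w → mixed xs ys (suc i) e s + w)
        (sum-scale ys (- 1ℤ) (λ y → sum xs (λ x → x ^ i * y ^ suc e * (x - y) ^ s)))))
    where
    identity : ∀ x y a b c → a * b * ((x - y) * c) ≡ x * a * b * c + - 1ℤ * (a * (y * b) * c)
    identity = solve-∀

  module _ (xs ys : List ℤ) {j : ℕ} (vx : Vanishing xs j) where

    mixed-inner : ∀ s i e → suc i ℕ.+ suc e ℕ.+ s ≡ j → mixed xs ys (suc i) (suc e) s ≈ 0ℤ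
    mixed-inner zero i e eq = ≈-trans (≈-reflexive (mixed-zero xs ys (suc i) (suc e)))
      (*-zeroˡ (powerSum ys (suc e)) (vx (suc i) (s≤s z≤n)
        (subst (suc i <_) (trans (sym (ℕₚ.+-identityʳ _)) eq) (ℕₚ.m<m+n (suc i) (s≤s z≤n)))))
    mixed-inner (suc s) i e eq = ≈-trans (≈-reflexive (mixed-suc xs ys (suc i) (suc e) s))
      (mixed-inner s (suc i) e (trans (sym (ℕₚ.+-suc (suc i ℕ.+ suc e) s)) eq)
       ⊕ *-zeroʳ (- 1ℤ) (mixed-inner s i (suc e) (trans (cong (ℕ._+ s) (ℕₚ.+-suc (suc i) (suc e)))
           (trans (sym (ℕₚ.+-suc (suc i ℕ.+ suc e) s)) eq))))

    mixed-left : ∀ s i → suc i ℕ.+ s ≡ j → mixed xs ys (suc i) 0 s ≈ powerSum xs j * powerSum ys 0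
    mixed-left zero i eq = ≈-reflexive (trans (mixed-zero xs ys (suc i) 0)
      (cong (λ k → powerSum xs k * powerSum ys 0) (trans (sym (ℕₚ.+-identityʳ _)) eq)))
    mixed-left (suc s) i eq = ≈-trans (≈-reflexive (mixed-suc xs ys (suc i) 0 s))
      (≈-trans (+-cong (mixed-left s (suc i) eq′)
                 (*-zeroʳ (- 1ℤ) (mixed-inner s i 0 (trans (cong (ℕ._+ s) (ℕₚ.+-comm (suc i) 1)) eq′))))
        (≈-reflexive (ℤₚ.+-identityʳ _)))
      where
      eq′ : suc (suc i) ℕ.+ s ≡ j
      eq′ = trans (sym (ℕₚ.+-suc (suc i) s)) eq

    mixed-right : ∀ s e → suc e ℕ.+ s ≡ j → mixed xs ys 0 (suc e) s ≈ sgn s * (powerSum xs 0 * powerSum ys j)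
    mixed-right zero e eq = ≈-reflexive (trans (mixed-zero xs ys 0 (suc e))
      (trans (cong (λ k → powerSum xs 0 * powerSum ys k) (trans (sym (ℕₚ.+-identityʳ _)) eq))
        (sym (ℤₚ.*-identityˡ _))))
    mixed-right (suc s) e eq = ≈-trans (≈-reflexive (mixed-suc xs ys 0 (suc e) s))
      (conclude (identity (mixed xs ys 1 (suc e) s) (mixed xs ys 0 (suc (suc e)) s) (sgn s) (powerSum xs 0 * powerSum ys j))
        (1ℤ · mixed-inner s 0 e eq′ ⊕ (- 1ℤ) · mixed-right s (suc e) eq′))
      where
      eq′ : suc (suc e) ℕ.+ s ≡ j
      eq′ = trans (sym (ℕₚ.+-suc (suc e) s)) eq
      identity : ∀ a b σ t → (a + - 1ℤ * b) - (- σ) * t ≡ 1ℤ * (a - 0ℤ) + (- 1ℤ) * (b - σ * t)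
      identity = solve-∀

    -- In the binomial expansion of (x - y)^j all but the two extreme terms contain a power sum of
    -- `xs` of index strictly between 0 and j.
    difference-sum : 0 < j → mixed xs ys 0 0 j ≈ powerSum xs j * powerSum ys 0 + sgn j * (powerSum xs 0 * powerSum ys j)
    difference-sum (s≤s {n = s} z≤n) = ≈-trans (≈-reflexive (mixed-suc xs ys 0 0 s))
      (conclude (identity (mixed xs ys 1 0 s) (mixed xs ys 0 1 s) (powerSum xs (suc s) * powerSum ys 0)
                   (sgn s) (powerSum xs 0 * powerSum ys (suc s)))
        (1ℤ · mixed-left s 0 refl ⊕ (- 1ℤ) · mixed-right s 0 refl))
      where
      identity : ∀ a b l σ t → (a + - 1ℤ * b) - (l + - σ * t) ≡ 1ℤ * (a - l) + (- 1ℤ) * (b - σ * t)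
      identity = solve-∀

  -- Logarithmic forces between the two sets

  private
    except-here : ∀ x xs (f g : ℤ → ℤ) → f x ≈ 0ℤ → sum xs f ≈ sum xs g → sum (x ∷ xs) f ≈ sum (x ∷ xs) g - g x
    except-here x xs f g fx rest =
      conclude (identity (f x) (sum xs f) (g x) (sum xs g)) (1ℤ · fx ⊕ 1ℤ · rest)
      where
      identity : ∀ a s b t → (a + s) - ((b + t) - b) ≡ 1ℤ * (a - 0ℤ) + 1ℤ * (s - t)
      identity = solve-∀

    except-there : ∀ y xs x (f g : ℤ → ℤ) → f y ≈ g y → sum xs f ≈ sum xs g - g x →
      sum (y ∷ xs) f ≈ sum (y ∷ xs) g - g x
    except-there y xs x f g head rest =
      conclude (identity (f y) (sum xs f) (g y) (sum xs g) (g x)) (1ℤ · head ⊕ 1ℤ · rest)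
      where
      identity : ∀ a s b t c → (a + s) - ((b + t) - c) ≡ 1ℤ * (a - b) + 1ℤ * (s - (t - c))
      identity = solve-∀

  sum-except : ∀ (f g : ℤ → ℤ) x xs → Distinct xs → x ∈ xs → f x ≈ 0ℤ → (∀ y → x ≉ y → f y ≈ g y) →
    sum xs f ≈ sum xs g - g x
  sum-except f g x (_ ∷ xs) (x≉ ∷ _) (here refl) fx e =
    except-here x xs f g fx (sum-cong xs {f} {g} (λ {y} y∈ → e y (All.lookup x≉ y∈)))
  sum-except f g x (y ∷ xs) (y≉ ∷ xs≉) (there x∈) fx e =
    except-there y xs x f g (e y (≉-sym (All.lookup y≉ x∈))) (sum-except f g x xs xs≉ x∈ fx e)

  module _ (2<p : 2 < p) where

    inv-neg : ∀ x y → inv (y - x) ≈ (- 1ℤ) * inv (x - y)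
    inv-neg x y = by-cases ((x - y) ≈0?)
      where
      by-cases : Dec (x - y ≈ 0ℤ) → inv (y - x) ≈ (- 1ℤ) * inv (x - y)
      by-cases (yes e) = ≈-trans (inv-zero 2<p {y - x} (conclude (identity x y) ((- 1ℤ) · e)))
        (≈-sym (*-zeroʳ (- 1ℤ) (inv-zero 2<p {x - y} e)))
        where
        identity : ∀ x y → (y - x) - 0ℤ ≡ (- 1ℤ) * ((x - y) - 0ℤ)
        identity = solve-∀
      by-cases (no e) = zero-difference (cancelˡ {x - y} e (conclude (identity x y (inv (y - x)) (inv (x - y)))
        ((- 1ℤ) · inv-inverse {y - x} (λ e′ → e (conclude (flip x y) ((- 1ℤ) · e′))) ⊕ 1ℤ · inv-inverse {x - y} e)))
        where
        flip : ∀ x y → (x - y) - 0ℤ ≡ (- 1ℤ) * ((y - x) - 0ℤ)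
        flip = solve-∀
        identity : ∀ x y i k → (x - y) * (i - (- 1ℤ) * k) - 0ℤ ≡ (- 1ℤ) * ((y - x) * i - 1ℤ) + 1ℤ * ((x - y) * k - 1ℤ)
        identity = solve-∀

    -- The logarithmic derivative P′/P = Σ 1/(X - a), taken at c.
    prod-log : ∀ c xs → All (c ≉_) xs → prod xs c 1 ≈ prod xs c 0 * sum xs (λ a → inv (c - a))
    prod-log c []       []         = ≈-refl
    prod-log c (a ∷ xs) (c≉ ∷ cs≉) =
      conclude (identity (c - a) (prod xs c 1) (prod xs c 0) (inv (c - a)) (sum xs (λ a → inv (c - a))))
        ((c - a) · prod-log c xs cs≉ ⊕ (- prod xs c 0) · inv-inverse {c - a} (difference-nonzero c≉))
      where
      identity : ∀ d f g i s → (d * f + 1ℤ * g) - d * g * (i + s) ≡ d * (f - g * s) + (- g) * (d * i - 1ℤ)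
      identity = solve-∀

    -- The logarithmic derivative of Q/(X - b) at its missing root b. The sum may still include c =
    -- b, since `inv` is zero there.
    prod-log′ : ∀ {b} bs → Distinct bs → b ∈ bs → prod bs b 2 ≈ prod bs b 1 * sum bs (λ c → inv (b - c))
    prod-log′ {b} (_ ∷ bs) (b≉ ∷ _) (here refl) =
      conclude (identity b (prod bs b 2) (prod bs b 1) (prod bs b 0) (inv (b - b)) (sum bs (λ c → inv (b - c))))
        (1ℤ · prod-log b bs b≉ ⊕ (- prod bs b 0) · inv-zero 2<p {b - b} (≈-reflexive (ℤₚ.+-inverseʳ b)))
      where
      identity : ∀ b h f g i s → ((b - b) * h + (1ℤ * f + 0ℤ * g)) - ((b - b) * f + 1ℤ * g) * (i + s) ≡
        1ℤ * (f - g * s) + (- g) * (i - 0ℤ)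
      identity = solve-∀
    prod-log′ {b} (c ∷ bs) (c≉ ∷ bs≉) (there b∈) =
      conclude (identity (b - c) (prod bs b 2) (prod bs b 1) (prod bs b 0) (inv (b - c)) (sum bs (λ c → inv (b - c))))
        ((b - c) · prod-log′ bs bs≉ b∈ ⊕ (- prod bs b 1) · inv-inverse {b - c} (difference-nonzero (≉-sym (All.lookup c≉ b∈)))
         ⊕ (- (inv (b - c) + sum bs (λ c → inv (b - c)))) · prod-root bs b∈)
      where
      identity : ∀ d h f g i s → (d * h + (1ℤ * f + 0ℤ * g)) - (d * f + 1ℤ * g) * (i + s) ≡
        d * (h - f * s) + (- f) * (d * i - 1ℤ) + (- (i + s)) * (g - 0ℤ)
      identity = solve-∀

    self : List ℤ → ℕ → ℤ
    self xs s = sum xs (λ x → sum xs (λ y → x ^ s * inv (x - y)))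

    cross : List ℤ → List ℤ → ℕ → ℤ
    cross xs ys s = sum xs (λ x → sum ys (λ y → x ^ s * inv (x - y)))

    cross-flip : ∀ xs ys s → cross xs ys s ≈ (- 1ℤ) * sum ys (λ y → sum xs (λ x → x ^ s * inv (y - x)))
    cross-flip xs ys s = ≈-trans (≈-reflexive (sum-swap xs ys (λ x y → x ^ s * inv (x - y))))
      (≈-trans (sum-cong ys λ {y} _ → ≈-trans (sum-cong xs λ {x} _ → step x y)
          (≈-reflexive (sum-scale xs (- 1ℤ) (λ x → x ^ s * inv (y - x)))))
        (≈-reflexive (sum-scale ys (- 1ℤ) (λ y → sum xs (λ x → x ^ s * inv (y - x))))))
      where
      step : ∀ x y → x ^ s * inv (x - y) ≈ (- 1ℤ) * (x ^ s * inv (y - x))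
      step x y = ≈-trans (*-congˡ (x ^ s) (inv-neg y x)) (≈-reflexive (identity (x ^ s) (inv (y - x))))
        where
        identity : ∀ a i → a * ((- 1ℤ) * i) ≡ (- 1ℤ) * (a * i)
        identity = solve-∀

    -- As 1/(y - x) = -1/(x - y), adding the two double sums symmetrises the summand into a
    -- difference quotient, which off the diagonal is a polynomial.
    cross-sum : ∀ xs ys s → cross xs ys s + cross ys xs s ≈ sum xs (λ x → sum ys (λ y → (x ^ s - y ^ s) * inv (x - y)))
    cross-sum xs ys s = ≈-trans (+-congˡ (cross xs ys s) (cross-flip ys xs s)) (≈-reflexive (sym (trans
      (sum-cong-≡ xs (λ x → trans (sum-cong-≡ ys (λ y → identity (x ^ s) (y ^ s) (inv (x - y))))
        (trans (sum-+ ys (λ y → x ^ s * inv (x - y)) (λ y → (- 1ℤ) * (y ^ s * inv (x - y))))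
          (cong (λ w → sum ys (λ y → x ^ s * inv (x - y)) + w) (sum-scale ys (- 1ℤ) (λ y → y ^ s * inv (x - y)))))))
      (trans (sum-+ xs (λ x → sum ys (λ y → x ^ s * inv (x - y))) (λ x → (- 1ℤ) * sum ys (λ y → y ^ s * inv (x - y))))
        (cong (λ w → cross xs ys s + w) (sum-scale xs (- 1ℤ) (λ x → sum ys (λ y → y ^ s * inv (x - y)))))))))
      where
      identity : ∀ a b i → (a - b) * i ≡ a * i + (- 1ℤ) * (b * i)
      identity = solve-∀

    cross-moment : ∀ xs ys s → (∀ {x y} → x ∈ xs → y ∈ ys → x ≉ y) → cross xs ys s + cross ys xs s ≈ moment xs ys s 0
    cross-moment xs ys s disjoint = ≈-trans (cross-sum xs ys s) (sum-cong xs λ {x} x∈ → sum-cong ys λ {y} y∈ →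
      ≈-trans (quotient-inv s (disjoint x∈ y∈)) (≈-reflexive (sym (ℤₚ.*-identityˡ (quotient s x y)))))

    -- The diagonal contributes nothing to `self`, but in `moment` it contributes the derivative s
    -- x^(s-1); the subtracted term accounts for this.
    self-moment : ∀ xs j → Distinct xs →
      + 2 * self xs (suc j) ≈ moment xs xs (suc j) 0 - + suc j * powerSum xs j
    self-moment xs j distinct = begin
      + 2 * self xs s
        ≡⟨ double (self xs s) ⟩
      self xs s + self xs s
        ≈⟨ cross-sum xs xs s ⟩
      sum xs (λ x → sum xs (λ y → (x ^ s - y ^ s) * inv (x - y)))
        ≈⟨ sum-cong xs (λ {x} x∈ → sum-except (λ y → (x ^ s - y ^ s) * inv (x - y)) 
             (λ y → y ^ 0 * quotient s x y) x xs distinct x∈ (diagonal x)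
             (λ y x≉y → ≈-trans (quotient-inv s x≉y) (≈-reflexive (sym (ℤₚ.*-identityˡ (quotient s x y)))))) ⟩
      sum xs (λ x → sum xs (λ y → y ^ 0 * quotient s x y) - x ^ 0 * quotient s x x)
        ≡⟨ sum-cong-≡ xs (λ x → trans (cong (λ w → sum xs (λ y → y ^ 0 * quotient s x y) - 1ℤ * w) (quotient-diagonal j x))
             (negate (sum xs (λ y → y ^ 0 * quotient s x y)) (+ s) (x ^ j))) ⟩
      sum xs (λ x → sum xs (λ y → y ^ 0 * quotient s x y) + (- + s) * x ^ j)
        ≡⟨ sum-+ xs (λ x → sum xs (λ y → y ^ 0 * quotient s x y)) (λ x → (- + s) * x ^ j) ⟩
      moment xs xs s 0 + sum xs (λ x → (- + s) * x ^ j)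
        ≡⟨ cong (λ w → moment xs xs s 0 + w) (sum-scale xs (- + s) (_^ j)) ⟩
      moment xs xs s 0 + (- + s) * powerSum xs j
        ≡⟨ regroup (moment xs xs s 0) (+ s) (powerSum xs j) ⟩
      moment xs xs s 0 - + s * powerSum xs j ∎
      where
      open ≈-Reasoning
      s : ℕ
      s = suc j
      double : ∀ x → + 2 * x ≡ x + x
      double = solve-∀
      negate : ∀ a s x → a - 1ℤ * (s * x) ≡ a + (- s) * x
      negate = solve-∀
      regroup : ∀ a s x → a + (- s) * x ≡ a - s * x
      regroup = solve-∀
      diagonal : ∀ x → (x ^ s - x ^ s) * inv (x - x) ≈ 0ℤ
      diagonal x = *-zeroˡ (inv (x - x)) (≈-reflexive (ℤₚ.+-inverseʳ (x ^ s)))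

    -- The local condition at b says that the logarithmic forces of xs and ys at b balance.
    equilibrium : ∀ {N M : ℤ} {xs ys : List ℤ} → Distinct ys → (∀ {x y} → x ∈ xs → y ∈ ys → y ≉ x) →
      (∀ {b} → b ∈ ys → N * (N + + 1) * (prod ys b 2 * prod xs b 0) ≈ M * (prod xs b 1 * prod ys b 1)) →
      ∀ s → N * (N + + 1) * self ys s ≈ M * cross ys xs s
    equilibrium {N} {M} {xs} {ys} distinct disjoint local s =
      ≈-trans (≈-reflexive (sym (sum-scale ys (N * (N + + 1)) (λ b → sum ys (λ c → b ^ s * inv (b - c))))))
        (≈-trans (sum-cong ys λ {b} b∈ → pointwise b∈)
          (≈-reflexive (sum-scale ys M (λ b → sum xs (λ a → b ^ s * inv (b - a))))))
      where
      pointwise : ∀ {b} → b ∈ ys → N * (N + + 1) * sum ys (λ c → b ^ s * inv (b - c)) ≈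
                                   M * sum xs (λ a → b ^ s * inv (b - a))
      pointwise {b} b∈ = ≈-trans (*-congˡ (N * (N + + 1)) (≈-reflexive (sum-scale ys (b ^ s) (λ c → inv (b - c)))))
        (≈-trans (conclude (scale N M (b ^ s) SY SX) ((b ^ s) · ratio))
          (*-congˡ M (≈-reflexive (sym (sum-scale xs (b ^ s) (λ a → inv (b - a)))))))
        where
        SX SY P₀ P₁ Q₁ Q₂ : ℤ
        SX = sum xs (λ a → inv (b - a))
        SY = sum ys (λ c → inv (b - c))
        P₀ = prod xs b 0
        P₁ = prod xs b 1
        Q₁ = prod ys b 1
        Q₂ = prod ys b 2
        scale : ∀ N M e y x → N * (N + + 1) * (e * y) - M * (e * x) ≡ e * (N * (N + + 1) * y - M * x)
        scale = solve-∀
        apart : All (b ≉_) xs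
        apart = All.tabulate (λ a∈ → disjoint a∈ b∈)
        ratio : N * (N + + 1) * SY ≈ M * SX
        ratio = zero-difference (cancelˡ (*-nonzero {P₀} {Q₁} (prod-value-nonzero xs apart) (prod-simple-root ys distinct b∈))
          (conclude (identity N M P₀ P₁ Q₁ Q₂ SX SY)
            (1ℤ · local b∈ ⊕ (- (N * (N + + 1) * P₀)) · prod-log′ ys distinct b∈ ⊕ (M * Q₁) · prod-log b xs apart)))
          where
          identity : ∀ N M P₀ P₁ Q₁ Q₂ SX SY → P₀ * Q₁ * (N * (N + + 1) * SY - M * SX) - 0ℤ ≡
            1ℤ * (N * (N + + 1) * (Q₂ * P₀) - M * (P₁ * Q₁)) + (- (N * (N + + 1) * P₀)) * (Q₂ - Q₁ * SY)
            + (M * Q₁) * (P₁ - P₀ * SX)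
          identity = solve-∀

    module _ {A B : List ℤ} (A-distinct : Distinct A) (B-distinct : Distinct B)
      (disjoint : ∀ {a b} → a ∈ A → b ∈ B → b ≉ a)
      (localB : ∀ {b} → b ∈ B → ⟪ A ⟫ * (⟪ A ⟫ + + 1) * (prod B b 2 * prod A b 0) ≈
        (⟪ A ⟫ * ⟪ B ⟫ - + 1) * (prod A b 1 * prod B b 1))
      (localA : ∀ {a} → a ∈ A → ⟪ B ⟫ * (⟪ B ⟫ + + 1) * (prod A a 2 * prod B a 0) ≈
        (⟪ A ⟫ * ⟪ B ⟫ - + 1) * (prod B a 1 * prod A a 1))
      where

      -- Add the equilibria over B and over A, so that the cross terms join into a single `moment`.
      -- For the exponent s = j + 2 all moments have total degree j + 1, the first in which a power
      -- sum may survive, and each reduces to its two extreme products.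
      power-balance : ∀ j → Vanishing A (suc j) → Vanishing B (suc j) →
        (let J = + suc j) (let x = powerSum A (suc j)) (let y = powerSum B (suc j)) →
        ⟪ A ⟫ * y * (+ 2 * ⟪ B ⟫ - (J + + 1) * ⟪ A ⟫ - (J - + 1))
          + ⟪ B ⟫ * x * (+ 2 * ⟪ A ⟫ - (J + + 1) * ⟪ B ⟫ - (J - + 1)) ≈ 0ℤ
      power-balance j vA vB =
        conclude (identity ⟪ A ⟫ ⟪ B ⟫ J x y (self A s) (self B s) (moment A A s 0) (moment B B s 0)
                   (cross A B s) (cross B A s) (moment B A s 0))
          ((- (⟪ A ⟫ * (⟪ A ⟫ + + 1))) · selfB ⊕ (- (⟪ B ⟫ * (⟪ B ⟫ + + 1))) · selfA
           ⊕ (+ 2) · equilibrium {⟪ A ⟫} {⟪ A ⟫ * ⟪ B ⟫ - + 1} B-distinct disjoint localB s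
           ⊕ (+ 2) · equilibrium {⟪ B ⟫} {⟪ A ⟫ * ⟪ B ⟫ - + 1} A-distinct
               (λ b∈ a∈ e → disjoint a∈ b∈ (≈-sym e)) localA s
           ⊕ (+ 2 * (⟪ A ⟫ * ⟪ B ⟫ - + 1)) · cross-moment B A s (λ b∈ a∈ → disjoint a∈ b∈)
           ⊕ (- (⟪ A ⟫ * (⟪ A ⟫ + + 1))) · momentBB ⊕ (- (⟪ B ⟫ * (⟪ B ⟫ + + 1))) · momentAA
           ⊕ (+ 2 * (⟪ A ⟫ * ⟪ B ⟫ - + 1)) · momentBA)
        where
        s : ℕ
        s = suc (suc j)
        J x y : ℤ
        J = + suc j
        x = powerSum A (suc j)
        y = powerSum B (suc j)
        selfA : + 2 * self A s ≈ moment A A s 0 - (1ℤ + J) * x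
        selfA = self-moment A (suc j) A-distinct
        selfB : + 2 * self B s ≈ moment B B s 0 - (1ℤ + J) * y
        selfB = self-moment B (suc j) B-distinct
        top : ∀ xs ys → Vanishing xs (suc j) → moment xs ys s 0 ≈
          powerSum xs (suc j) * ⟪ ys ⟫ + ⟪ xs ⟫ * powerSum ys (suc j)
        top xs ys v = ≈-trans (moment-top xs ys j v) (≈-reflexive
          (cong₂ (λ a b → powerSum xs (suc j) * a + b * powerSum ys (suc j))
          (powerSum-0 ys) (powerSum-0 xs)))
        momentAA : moment A A s 0 ≈ x * ⟪ A ⟫ + ⟪ A ⟫ * x
        momentAA = top A A vA
        momentBB : moment B B s 0 ≈ y * ⟪ B ⟫ + ⟪ B ⟫ * y
        momentBB = top B B vB
        momentBA : moment B A s 0 ≈ y * ⟪ A ⟫ + ⟪ B ⟫ * x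
        momentBA = top B A vB
        identity : ∀ N K J x y sA sB mA mB cAB cBA mBA →
          N * y * (+ 2 * K - (J + + 1) * N - (J - + 1)) + K * x * (+ 2 * N - (J + + 1) * K - (J - + 1)) - 0ℤ ≡
          (- (N * (N + + 1))) * (+ 2 * sB - (mB - (1ℤ + J) * y)) + (- (K * (K + + 1))) * (+ 2 * sA - (mA - (1ℤ + J) * x))
          + (+ 2) * (N * (N + + 1) * sB - (N * K - + 1) * cBA) + (+ 2) * (K * (K + + 1) * sA - (N * K - + 1) * cAB)
          + (+ 2 * (N * K - + 1)) * ((cBA + cAB) - mBA)
          + (- (N * (N + + 1))) * (mB - (y * K + K * y)) + (- (K * (K + + 1))) * (mA - (x * N + N * x))
          + (+ 2 * (N * K - + 1)) * (mBA - (y * N + K * x))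
        identity = solve-∀

  -- Proof that |A| = |B|

  moment-poly : ∀ {d Φ} → Poly d Φ → ∀ xs e → (∀ i → e < i → i ≤ e ℕ.+ d → powerSum xs i ≈ 0ℤ) →
    sum xs (λ x → x ^ suc e * Φ x 0) ≈ 0ℤ
  moment-poly (null z) xs e v = ≈-trans (sum-cong xs λ {x} _ → *-zeroʳ (x ^ suc e) (≋0⇒ (z x) 0)) (≈-reflexive (sum-zero xs))
  moment-poly {suc d} {Φ} (horner α Ψ q h) xs e v = begin
    sum xs (λ x → x ^ suc e * Φ x 0)
      ≈⟨ sum-cong xs (λ {x} _ → ≈-trans (*-congˡ (x ^ suc e) (at (h x) 0)) (≈-reflexive (identity x (x ^ e) α (Ψ x 0)))) ⟩
    sum xs (λ x → α * x ^ suc e + x ^ suc (suc e) * Ψ x 0)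
      ≡⟨ sum-+ xs (λ x → α * x ^ suc e) (λ x → x ^ suc (suc e) * Ψ x 0) ⟩
    sum xs (λ x → α * x ^ suc e) + sum xs (λ x → x ^ suc (suc e) * Ψ x 0)
      ≈⟨ ≈-trans (≈-reflexive (sum-scale xs α (_^ suc e)))
           (*-zeroʳ α (v (suc e) ℕₚ.≤-refl (ℕₚ.≤-trans (ℕₚ.≤-reflexive (ℕₚ.+-comm 1 e)) (ℕₚ.+-monoʳ-≤ e (s≤s z≤n)))))
         ⊕ moment-poly q xs (suc e) (λ i e<i i≤ → v i (ℕₚ.<-trans (ℕₚ.n<1+n e) e<i)
             (ℕₚ.≤-trans i≤ (ℕₚ.≤-reflexive (sym (ℕₚ.+-suc e d))))) ⟩
    0ℤ ∎
    where
    open ≈-Reasoning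
    identity : ∀ x a α ψ → x * a * (α + x * ψ) ≡ α * (x * a) + x * (x * a) * ψ
    identity = solve-∀

  -- Sum X ∏ (X - x), x running over `as`, at all points of the list. Every term but that of a is
  -- zero, and expanding in power sums of index 1 to n shows that the total is zero.
  head-zero : ∀ a as → Distinct (a ∷ as) → (∀ i → 0 < i → i ≤ suc (length as) → powerSum (a ∷ as) i ≈ 0ℤ) → a ≈ 0ℤ
  head-zero a as (a≉ ∷ _) v = cancelˡ (prod-value-nonzero as a≉)
    (conclude (identity a (prod as a 0) (sum as (λ x → x ^ 1 * prod as x 0)))
      (1ℤ · moment-poly (Poly-prod as) (a ∷ as) 0 v ⊕ (- 1ℤ) · others))
    where
    others : sum as (λ x → x ^ 1 * prod as x 0) ≈ 0ℤ
    others = ≈-trans (sum-cong as λ {x} x∈ → *-zeroʳ (x ^ 1) (prod-root as x∈)) (≈-reflexive (sum-zero as))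
    identity : ∀ a f s → f * a - 0ℤ ≡ 1ℤ * ((a * 1ℤ * f + s) - 0ℤ) + (- 1ℤ) * (s - 0ℤ)
    identity = solve-∀

  0^suc : ∀ {x} i → x ≈ 0ℤ → x ^ suc i ≈ 0ℤ
  0^suc {x} i = *-zeroˡ (x ^ i)

  -- The first entry is zero, so deleting it changes no power sum of positive index; the second
  -- entry is then zero too, against distinctness.
  not-all-vanishing : ∀ as → Distinct as → 2 ≤ length as → (∀ i → 0 < i → i ≤ length as → powerSum as i ≈ 0ℤ) → ⊥
  not-all-vanishing (_ ∷ []) _ (s≤s ()) _
  not-all-vanishing (a ∷ b ∷ as) distinct@((a≉b ∷ _) ∷ distinct′) _ v =
    a≉b (≈-trans a≈0 (≈-sym (head-zero b as distinct′ (λ i 0<i i≤ → reduced i 0<i (ℕₚ.≤-trans i≤ (ℕₚ.n≤1+n _))))))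
    where
    a≈0 : a ≈ 0ℤ
    a≈0 = head-zero a (b ∷ as) distinct v
    reduced : ∀ i → 0 < i → i ≤ suc (suc (length as)) → powerSum (b ∷ as) i ≈ 0ℤ
    reduced (suc i) 0<i i≤ = conclude (identity (a ^ suc i) (powerSum (b ∷ as) (suc i)))
      (1ℤ · v (suc i) 0<i i≤ ⊕ (- 1ℤ) · 0^suc i a≈0)
      where
      identity : ∀ x s → s - 0ℤ ≡ 1ℤ * ((x + s) - 0ℤ) + (- 1ℤ) * (x - 0ℤ)
      identity = solve-∀

  search : ∀ xs d → (∀ i → 0 < i → i ≤ d → powerSum xs i ≈ 0ℤ) ⊎
    ∃ λ j → 0 < j × j ≤ d × Vanishing xs j × powerSum xs j ≉ 0ℤ
  search xs zero = inj₁ λ { (suc i) _ () }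
  search xs (suc d) with search xs d
  ... | inj₂ (j , 0<j , j≤d , rest) = inj₂ (j , 0<j , ℕₚ.m≤n⇒m≤1+n j≤d , rest)
  ... | inj₁ below with powerSum xs (suc d) ≈0?
  ...   | no ne = inj₂ (suc d , s≤s z≤n , ℕₚ.≤-refl , (λ i 0<i i<j → below i 0<i (ℕₚ.≤-pred i<j)) , ne)
  ...   | yes e = inj₁ extend
    where
    extend : ∀ i → 0 < i → i ≤ suc d → powerSum xs i ≈ 0ℤ
    extend i 0<i i≤ with ℕₚ.m≤n⇒m<n∨m≡n i≤
    ... | inj₁ i<   = below i 0<i (ℕₚ.≤-pred i<)
    ... | inj₂ refl = e

  sgn-values : ∀ j → sgn j ≡ 1ℤ ⊎ sgn j ≡ - 1ℤ
  sgn-values zero = inj₁ refl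
  sgn-values (suc j) with sgn-values j
  ... | inj₁ e = inj₂ (cong -_ e)
  ... | inj₂ e = inj₁ (cong -_ e)

  module Equal {A B : List ℤ} (A-distinct : Distinct A) (B-distinct : Distinct B)
    (disjoint : ∀ {a b} → a ∈ A → b ∈ B → b ≉ a)
    (localB : ∀ {b} → b ∈ B → ⟪ A ⟫ * (⟪ A ⟫ + + 1) * (prod B b 2 * prod A b 0) ≈
        (⟪ A ⟫ * ⟪ B ⟫ - + 1) * (prod A b 1 * prod B b 1))
    (localA : ∀ {a} → a ∈ A → ⟪ B ⟫ * (⟪ B ⟫ + + 1) * (prod A a 2 * prod B a 0) ≈
        (⟪ A ⟫ * ⟪ B ⟫ - + 1) * (prod B a 1 * prod A a 1))
    (2≤|A| : 2 ≤ length A) (2≤|B| : 2 ≤ length B)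
    (size : length A ℕ.+ length B ℕ.+ 2 < p)
    (differences : ∀ i → 0 < i → i ≤ length A → mixed B A 0 0 i ≈ 0ℤ)
    (centred : powerSum A 1 ≈ 0ℤ) where

    private
      n k : ℕ
      n = length A
      k = length B

      nonzero : ∀ {i} → 0 < i → i ≤ n ℕ.+ k ℕ.+ 2 → + i ≉ 0ℤ
      nonzero 0<i i≤ = positive-nonzero 0<i (ℕₚ.≤-<-trans i≤ size)

      n≤ : n ≤ n ℕ.+ k ℕ.+ 2
      n≤ = ℕₚ.≤-trans (ℕₚ.m≤m+n n k) (ℕₚ.m≤m+n (n ℕ.+ k) 2)

      k≤ : k ≤ n ℕ.+ k ℕ.+ 2
      k≤ = ℕₚ.≤-trans (ℕₚ.m≤n+m k n) (ℕₚ.m≤m+n (n ℕ.+ k) 2)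

      N≉0 : ⟪ A ⟫ ≉ 0ℤ
      N≉0 = nonzero (ℕₚ.≤-trans (s≤s z≤n) 2≤|A|) n≤

      K≉0 : ⟪ B ⟫ ≉ 0ℤ
      K≉0 = nonzero (ℕₚ.≤-trans (s≤s z≤n) 2≤|B|) k≤

    power-relation : ∀ j → 0 < j → j ≤ n → Vanishing B j → powerSum B j * ⟪ A ⟫ + sgn j * (⟪ B ⟫ * powerSum A j) ≈ 0ℤ
    power-relation j 0<j j≤n vB = ≈-trans (≈-reflexive (cong₂ (λ a b → powerSum B j * a + sgn j * (b * powerSum A j))
        (sym (powerSum-0 A)) (sym (powerSum-0 B))))
      (≈-trans (≈-sym (difference-sum B A vB 0<j)) (differences j 0<j j≤n))

    -- At each index `power-relation` makes one power sum a unit multiple of the other. The bound j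
    -- ≤ n + 1 is right because `Vanishing` concerns indices strictly below j.
    transfer : ∀ j → j ≤ suc n → Vanishing A j → Vanishing B j
    transfer (suc j) j≤n vA i 0<i i<j with ℕₚ.m≤n⇒m<n∨m≡n (ℕₚ.≤-pred i<j)
    ... | inj₁ i<    = transfer j (ℕₚ.≤-trans (ℕₚ.n≤1+n j) j≤n) (λ i 0<i i<j → vA i 0<i (ℕₚ.m≤n⇒m≤1+n i<j)) i 0<i i<
    ... | inj₂ refl  = cancelˡ {⟪ A ⟫} N≉0 (conclude
      (identity ⟪ A ⟫ (powerSum B i) (sgn i) ⟪ B ⟫ (powerSum A i))
      (1ℤ · power-relation i 0<i (ℕₚ.≤-pred j≤n)
         (transfer i (ℕₚ.≤-trans (ℕₚ.n≤1+n i) j≤n) (λ l 0<l l<i → vA l 0<l (ℕₚ.m≤n⇒m≤1+n l<i)))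
       ⊕ (- (sgn i * ⟪ B ⟫)) · vA i 0<i ℕₚ.≤-refl))
      where
      identity : ∀ N y σ K x → N * y - 0ℤ ≡ 1ℤ * ((y * N + σ * (K * x)) - 0ℤ) + (- (σ * K)) * (x - 0ℤ)
      identity = solve-∀

    record Leading : Set where
      field
        j       : ℕ
        1<j     : 1 < j
        j≤n     : j ≤ n
        even    : sgn j ≡ 1ℤ
        pA≉0    : powerSum A j ≉ 0ℤ
        n≡k     : n ≡ k

    private
      lengths : ⟪ A ⟫ - ⟪ B ⟫ ≈ 0ℤ → n ≡ k
      lengths e with ℕₚ.<-cmp n k
      ... | tri< n<k _ _ = ⊥-elim (naturals-distinct n<k (ℕₚ.≤-<-trans k≤ size) (zero-difference e))
      ... | tri≈ _ n≡k _ = n≡k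
      ... | tri> _ _ k<n = ⊥-elim (naturals-distinct k<n (ℕₚ.≤-<-trans n≤ size) (≈-sym (zero-difference e)))

      -- Balance and relation are two linear equations in x and y. Eliminating y leaves K x (J +
      -- 3)(N - K) = 0 for even J and K x (J - 1)(N + K + 2) = 0 for odd J. The second is impossible
      -- as J > 1, which is why A has to be centred; the first gives N = K.
      analyse : ∀ j → 0 < j → suc j ≤ n → Vanishing A (suc j) → powerSum A (suc j) ≉ 0ℤ → Leading
      analyse j 0<j j<n vA x≉0 = by-sign (sgn-values (suc j))
        where
        J x y : ℤ
        J = + suc j
        x = powerSum A (suc j)
        y = powerSum B (suc j)
        vB : Vanishing B (suc j)
        vB = transfer (suc j) (ℕₚ.m≤n⇒m≤1+n j<n) vA
        balance : ⟪ A ⟫ * y * (+ 2 * ⟪ B ⟫ - (J + + 1) * ⟪ A ⟫ - (J - + 1))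
          + ⟪ B ⟫ * x * (+ 2 * ⟪ A ⟫ - (J + + 1) * ⟪ B ⟫ - (J - + 1)) ≈ 0ℤ
        balance = power-balance 2<p A-distinct B-distinct disjoint localB localA j vA vB
          where
          2<p : 2 < p
          2<p = ℕₚ.≤-<-trans (ℕₚ.m≤n+m 2 (n ℕ.+ k)) size
        relation : y * ⟪ A ⟫ + sgn (suc j) * (⟪ B ⟫ * x) ≈ 0ℤ
        relation = power-relation (suc j) (s≤s z≤n) j<n vB
        Kx≉0 : ⟪ B ⟫ * x ≉ 0ℤ
        Kx≉0 = *-nonzero {⟪ B ⟫} {x} K≉0 x≉0
        by-sign : sgn (suc j) ≡ 1ℤ ⊎ sgn (suc j) ≡ - 1ℤ → Leading
        by-sign (inj₁ σ) = record { j = suc j ; 1<j = s≤s 0<j ; j≤n = j<n ; even = σ ; pA≉0 = x≉0 ; n≡k = lengths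
            (cancelˡ {J + + 3} J+3≉0 (cancelˡ {⟪ B ⟫ * x} Kx≉0 (conclude (identity ⟪ A ⟫ ⟪ B ⟫ J x y)
              (1ℤ · balance ⊕ (- (+ 2 * ⟪ B ⟫ - (J + + 1) * ⟪ A ⟫ - (J - + 1)))
                · subst (λ s → y * ⟪ A ⟫ + s * (⟪ B ⟫ * x) ≈ 0ℤ) σ relation)))) }
          where
          J+3≉0 : J + + 3 ≉ 0ℤ
          J+3≉0 = nonzero {suc j ℕ.+ 3} (s≤s z≤n) (ℕₚ.≤-trans (ℕₚ.+-mono-≤ j<n (s≤s (s≤s (s≤s z≤n))))
            (ℕₚ.≤-trans (ℕₚ.+-monoʳ-≤ n (ℕₚ.≤-trans (ℕₚ.n≤1+n 3) (ℕₚ.+-monoˡ-≤ 2 2≤|B|)))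
              (ℕₚ.≤-reflexive (sym (ℕₚ.+-assoc n k 2)))))
          identity : ∀ N K J x y → K * x * ((J + + 3) * (N - K)) - 0ℤ ≡
            1ℤ * (N * y * (+ 2 * K - (J + + 1) * N - (J - + 1)) + K * x * (+ 2 * N - (J + + 1) * K - (J - + 1)) - 0ℤ)
            + (- (+ 2 * K - (J + + 1) * N - (J - + 1))) * (y * N + 1ℤ * (K * x) - 0ℤ)
          identity = solve-∀
        by-sign (inj₂ σ) = ⊥-elim (*-nonzero {+ j} {⟪ A ⟫ + ⟪ B ⟫ + + 2}
            (nonzero 0<j (ℕₚ.≤-trans (ℕₚ.n≤1+n j) (ℕₚ.≤-trans j<n n≤)))
            (nonzero (ℕₚ.≤-trans (s≤s z≤n) (ℕₚ.m≤n+m 2 (n ℕ.+ k))) ℕₚ.≤-refl)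
            (cancelˡ {⟪ B ⟫ * x} Kx≉0 (conclude (identity ⟪ A ⟫ ⟪ B ⟫ (+ j) x y)
              ((- 1ℤ) · balance ⊕ (+ 2 * ⟪ B ⟫ - (J + + 1) * ⟪ A ⟫ - (J - + 1))
                · subst (λ s → y * ⟪ A ⟫ + s * (⟪ B ⟫ * x) ≈ 0ℤ) σ relation))))
          where
          identity : ∀ N K i x y → K * x * (i * (N + K + + 2)) - 0ℤ ≡
            (- 1ℤ) * (N * y * (+ 2 * K - ((1ℤ + i) + + 1) * N - ((1ℤ + i) - + 1))
                      + K * x * (+ 2 * N - ((1ℤ + i) + + 1) * K - ((1ℤ + i) - + 1)) - 0ℤ)
            + (+ 2 * K - ((1ℤ + i) + + 1) * N - ((1ℤ + i) - + 1)) * (y * N + (- 1ℤ) * (K * x) - 0ℤ)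
          identity = solve-∀

    leading : Leading
    leading with search A n
    ... | inj₁ all = ⊥-elim (not-all-vanishing A A-distinct 2≤|A| all)
    ... | inj₂ (suc zero , _ , _ , _ , ne) = ⊥-elim (ne centred)
    ... | inj₂ (suc (suc j) , _ , j≤n , vA , ne) = analyse (suc j) (s≤s z≤n) j≤n vA ne

  -- Squares modulo p

  -- The nonzero squares are the differences b - a, so A is the negative of a summand.
  record Decomposition (A B : List ℤ) (m′ : ℕ) : Set where
    field
      A-distinct : Distinct A
      B-distinct : Distinct B
      p≡1+2m     : p ≡ suc (suc m′ ℕ.+ suc m′)
      2≤|A|      : 2 ≤ length A
      2≤|B|      : 2 ≤ length B
      square     : ∀ {a b} → a ∈ A → b ∈ B → ∃ λ y → y ≉ 0ℤ × b - a ≈ y * y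
      covered    : ∀ y → y ≉ 0ℤ → ∃ λ a → ∃ λ b → a ∈ A × b ∈ B × y * y ≈ b - a

  differences : List ℤ → List ℤ → List ℤ
  differences []       B = []
  differences (a ∷ A)  B = map (λ b → b - a) B ++ differences A B

  length-differences : ∀ A B → length (differences A B) ≡ length A ℕ.* length B
  length-differences []      B = refl
  length-differences (a ∷ A) B = trans (length-++ (map (λ b → b - a) B))
    (cong₂ ℕ._+_ (length-map (λ b → b - a) B) (length-differences A B))

  ∈-differences : ∀ {A B a b v} → a ∈ A → b ∈ B → v ≈ b - a → Any (v ≈_) (differences A B)
  ∈-differences {a ∷ A} {B} (here refl) b∈ e = Anyₚ.++⁺ˡ (Anyₚ.map⁺ (Any.map (λ { refl → e }) b∈))
  ∈-differences {a ∷ A} {B} (there a∈) b∈ e = Anyₚ.++⁺ʳ (map (λ b → b - a) B) (∈-differences a∈ b∈ e)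

  sum-++ : ∀ xs ys f → sum (xs ++ ys) f ≡ sum xs f + sum ys f
  sum-++ []       ys f = sym (ℤₚ.+-identityˡ _)
  sum-++ (x ∷ xs) ys f = trans (cong (λ w → f x + w) (sum-++ xs ys f)) (sym (ℤₚ.+-assoc (f x) (sum xs f) (sum ys f)))

  sum-map : ∀ g xs f → sum (map g xs) f ≡ sum xs (λ x → f (g x))
  sum-map g []       f = refl
  sum-map g (x ∷ xs) f = cong (λ w → f (g x) + w) (sum-map g xs f)

  sum-differences : ∀ A B f → sum (differences A B) f ≡ sum A (λ a → sum B (λ b → f (b - a)))
  sum-differences []      B f = refl
  sum-differences (a ∷ A) B f = trans (sum-++ (map (λ b → b - a) B) (differences A B) f)
    (cong₂ _+_ (sum-map (λ b → b - a) B f) (sum-differences A B f))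

  sum-↭ : ∀ {xs ys} f → (∀ {x y} → x ≈ y → f x ≈ f y) → xs ↭ ys → sum xs f ≈ sum ys f
  sum-↭ {xs} {ys} f f-cong σ = ≈-trans (≈-reflexive (as-foldr xs))
    (≈-trans (foldr-commMonoid (CommutativeRing.+-isCommutativeMonoid residueRing) (map⁺ residueSetoid f-cong σ))
      (≈-reflexive (sym (as-foldr ys))))
    where
    as-foldr : ∀ xs → sum xs f ≡ foldr _+_ 0ℤ (map f xs)
    as-foldr []       = refl
    as-foldr (x ∷ xs) = cong (λ w → f x + w) (as-foldr xs)

  module FromDecomposition {A B m′} (Δ : Decomposition A B m′) where
    open Decomposition Δ
    private
      m : ℕ
      m = suc m′

      square-at : ℕ → ℤ
      square-at i = + suc i * + suc i

      squares : List ℤ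
      squares = applyUpTo square-at m

      suc-nonzero : ∀ {i} → i < m → + suc i ≉ 0ℤ
      suc-nonzero i<m = positive-nonzero (s≤s z≤n)
        (subst (suc _ <_) (sym p≡1+2m) (s≤s (ℕₚ.≤-trans i<m (ℕₚ.m≤m+n m m))))

      squares-distinct : Distinct squares
      squares-distinct = AllPairsₚ.applyUpTo⁺₁ square-at m apart
        where
        identity : ∀ x y → (y - x) * (x + y) - 0ℤ ≡ (- 1ℤ) * (x * x - y * y)
        identity = solve-∀
        apart : ∀ {i j} → i < j → j < m → square-at i ≉ square-at j
        apart {i} {j} i<j j<m e = *-nonzero {+ suc j - + suc i} {+ suc i + + suc j}
          (difference-nonzero (≉-sym (naturals-distinct (s≤s i<j) 1+j<p)))
          (positive-nonzero (s≤s z≤n) (subst (suc i ℕ.+ suc j <_) (sym p≡1+2m)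
            (s≤s (ℕₚ.+-mono-≤ (ℕₚ.<-trans i<j j<m) j<m))))
          (conclude (identity (+ suc i) (+ suc j)) ((- 1ℤ) · e))
          where
          1+j<p : suc j < p
          1+j<p = subst (suc j <_) (sym p≡1+2m) (s≤s (ℕₚ.≤-trans j<m (ℕₚ.m≤m+n m m)))

      L : List ℤ
      L = differences A B

      square∈L : ∀ {v} y → y ≉ 0ℤ → v ≈ y * y → Any (v ≈_) L
      square∈L y y≉0 e with covered y y≉0
      ... | a , b , a∈ , b∈ , e′ = ∈-differences a∈ b∈ (≈-trans e e′)

      squares⊆L : All (λ x → Any (x ≈_) L) squares
      squares⊆L = Allₚ.applyUpTo⁺₁ square-at m (λ {i} i<m → square∈L (+ suc i) (suc-nonzero i<m) ≈-refl)

      |squares|≡m : length squares ≡ m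
      |squares|≡m = length-applyUpTo square-at m

      p∸1≡2m : p ∸ 1 ≡ m ℕ.+ m
      p∸1≡2m = cong (_∸ 1) p≡1+2m

    configuration : Configuration A B m′ 1ℤ
    configuration = record
      { A-distinct = A-distinct ; B-distinct = B-distinct
      ; powers = λ a∈ b∈ → power (square a∈ b∈)
      ; χ≉0 = 1≉0 ; p≡1+2m = p≡1+2m ; 2≤|A| = 2≤|A| ; 2≤|B| = 2≤|B|
      ; covering = subst₂′ |squares|≡m (length-differences A B) (distinct-length squares squares-distinct squares⊆L) }
      where
      subst₂′ : ∀ {x y z w} → x ≡ y → z ≡ w → x ≤ z → y ≤ w
      subst₂′ refl refl le = le
      power : ∀ {d} → (∃ λ y → y ≉ 0ℤ × d ≈ y * y) → d ^ m ≈ 1ℤ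
      power (y , y≉0 , e) = ≈-trans (^-cong e m) (≈-trans (≈-reflexive (trans (^-scale y y m)
        (trans (sym (ℤₚ.^-distribˡ-+-* y m m)) (cong (y ^_) (sym p∸1≡2m))))) (fermat y≉0))

    module _ (|A||B|≡m : length A ℕ.* length B ≡ m) where
      private
        |L|≤ : length L ≤ length squares
        |L|≤ = ℕₚ.≤-reflexive (trans (length-differences A B) (trans |A||B|≡m (sym |squares|≡m)))

        -- With |A| |B| = m the differences have no room for repetition: each square is b - a
        -- exactly once.
        L↭squares : L ↭ squares
        L↭squares = distinct-↭ squares squares-distinct squares⊆L |L|≤

        module _ (y : ℤ) (y≉0 : y ≉ 0ℤ) where
          scaled : List ℤ
          scaled = map (λ x → y * y * x) squares

          scaled⊆L : All (λ x → Any (x ≈_) L) scaled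
          scaled⊆L = Allₚ.map⁺ (Allₚ.applyUpTo⁺₁ square-at m λ {i} i<m →
            square∈L (y * + suc i) (*-nonzero {y} {+ suc i} y≉0 (suc-nonzero i<m)) (≈-reflexive (identity y (+ suc i))))
            where
            identity : ∀ y x → y * y * (x * x) ≡ y * x * (y * x)
            identity = solve-∀

          L↭scaled : L ↭ scaled
          L↭scaled = distinct-↭ scaled (scale-distinct (*-nonzero {y} {y} y≉0 y≉0) squares-distinct) scaled⊆L
            (subst (length L ≤_) (sym (length-map _ squares)) |L|≤)

          -- The squares and their multiples by y² are both rearrangements of `L`, so scaling by y²
          -- preserves their power sums.
          invariance : ∀ j → ((y * y) ^ j - 1ℤ) * powerSum squares j ≈ 0ℤ
          invariance j = conclude (identity ((y * y) ^ j) (powerSum squares j))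
            (1ℤ · ≈-trans (≈-reflexive (sym sums)) (≈-trans (≈-sym (sum-↭ (_^ j) (λ e → ^-cong e j) L↭scaled))
              (sum-↭ (_^ j) (λ e → ^-cong e j) L↭squares)))
            where
            sums : powerSum scaled j ≡ (y * y) ^ j * powerSum squares j
            sums = trans (sum-map (λ x → y * y * x) squares (_^ j))
              (trans (sum-cong-≡ squares (λ x → ^-scale (y * y) x j)) (sum-scale squares ((y * y) ^ j) (_^ j)))
            identity : ∀ g s → (g - 1ℤ) * s - 0ℤ ≡ 1ℤ * (g * s - s)
            identity = solve-∀

      -- By `invariance` a nonzero sum would make all m squares roots of X^j - 1, of degree j < m.
      -- The complete polynomial on the one node 0 plays the monomial.
      squares-powerSum : ∀ j → 0 < j → j < m → powerSum squares j ≈ 0ℤ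
      squares-powerSum (suc j) _ j<m with powerSum squares (suc j) ≈0?
      ... | yes e = e
      ... | no ne = ⊥-elim (1≉0 (≈-trans (conclude (identity (completeˢ (0ℤ ∷ []) (suc j) 0ℤ 0))
          ((- 1ℤ) · ≋0⇒ (many-roots⇒zero squares squares-distinct roots
              (Poly-+ (Poly-complete (0ℤ ∷ []) (suc j)) (Poly-≤ (s≤s z≤n) (Poly-const (- 1ℤ))))
              (subst (suc (suc j) ≤_) (sym |squares|≡m) j<m) 0ℤ) 0)) vanishing))
        where
        value : ∀ c → completeˢ (0ℤ ∷ []) (suc j) c 0 ≡ (c - 0ℤ) ^ suc j
        value c = trans (completeˢ-value (0ℤ ∷ []) (suc j) c) (complete-singleton (c - 0ℤ) (suc j))
        vanishing : completeˢ (0ℤ ∷ []) (suc j) 0ℤ 0 ≈ 0ℤ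
        vanishing = ≈-trans (≈-reflexive (value 0ℤ)) (*-zeroˡ ((0ℤ - 0ℤ) ^ j) ≈-refl)
        identity : ∀ h → 1ℤ - h ≡ (- 1ℤ) * ((h + - 1ℤ) - 0ℤ)
        identity = solve-∀
        cancel : ∀ {x} → x * powerSum squares (suc j) ≈ 0ℤ → x ≈ 0ℤ
        cancel {x} e = cancelˡ {powerSum squares (suc j)} ne
          (≈-trans (≈-reflexive (ℤₚ.*-comm (powerSum squares (suc j)) x)) e)
        roots : All (λ c → completeˢ (0ℤ ∷ []) (suc j) c 0 + - 1ℤ ≈ 0ℤ) squares
        roots = Allₚ.applyUpTo⁺₁ square-at m λ {i} i<m → ≈-trans
          (≈-reflexive (cong (λ w → w + - 1ℤ) (trans (value (square-at i)) (cong (_^ suc j) (ℤₚ.+-identityʳ (square-at i))))))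
          (cancel {square-at i ^ suc j - 1ℤ} (invariance (+ suc i) (suc-nonzero i<m) (suc j)))

      difference-powerSum : ∀ j → 0 < j → j < m → mixed B A 0 0 j ≈ 0ℤ
      difference-powerSum j 0<j j<m = ≈-trans (≈-reflexive (trans
          (sum-cong-≡ A (λ a → sum-cong-≡ B (λ b → ℤₚ.*-identityˡ ((b - a) ^ j))))
          (sym (sum-differences A B (_^ j)))))
        (≈-trans (sum-↭ (_^ j) (λ e → ^-cong e j) L↭squares) (squares-powerSum j 0<j j<m))

  shift : ∀ {A B m′} c → Decomposition A B m′ → Decomposition (map (λ x → x - c) A) (map (λ x → x - c) B) m′
  shift {A} {B} c Δ = record
    { A-distinct = AllPairsₚ.map⁺ (AllPairs.map apart A-distinct)
    ; B-distinct = AllPairsₚ.map⁺ (AllPairs.map apart B-distinct)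
    ; p≡1+2m = p≡1+2m
    ; 2≤|A| = subst (2 ≤_) (sym (length-map _ A)) 2≤|A|
    ; 2≤|B| = subst (2 ≤_) (sym (length-map _ B)) 2≤|B|
    ; square = λ a∈ b∈ → shifted-square (∈-map⁻ (λ x → x - c) a∈) (∈-map⁻ (λ x → x - c) b∈)
    ; covered = λ y y≉0 → shifted-covered (covered y y≉0)
    }
    where
    open Decomposition Δ
    invariant : ∀ a b c → b - a ≡ (b - c) - (a - c)
    invariant = solve-∀
    apart : ∀ {x y} → x ≉ y → x - c ≉ y - c
    apart {x} {y} x≉y e = x≉y (conclude (identity x y c) (1ℤ · e))
      where
      identity : ∀ x y c → x - y ≡ 1ℤ * ((x - c) - (y - c))
      identity = solve-∀
    shifted-square : ∀ {a b} → (∃ λ x → x ∈ A × a ≡ x - c) → (∃ λ x → x ∈ B × b ≡ x - c) →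
      ∃ λ y → y ≉ 0ℤ × b - a ≈ y * y
    shifted-square (a , a∈ , refl) (b , b∈ , refl) with square a∈ b∈
    ... | y , y≉0 , e = y , y≉0 , ≈-trans (≈-reflexive (sym (invariant a b c))) e
    shifted-covered : ∀ {v} → (∃ λ a → ∃ λ b → a ∈ A × b ∈ B × v ≈ b - a) →
      ∃ λ a → ∃ λ b → a ∈ map (λ x → x - c) A × b ∈ map (λ x → x - c) B × v ≈ b - a
    shifted-covered (a , b , a∈ , b∈ , e) =
      a - c , b - c , ∈-map⁺ (λ x → x - c) a∈ , ∈-map⁺ (λ x → x - c) b∈ , ≈-trans e (≈-reflexive (invariant a b c))

  -- Centred cubics: the case p = 19

  prod-step : ∀ a as i → prod (a ∷ as) 0ℤ (suc i) ≡ (0ℤ - a) * prod as 0ℤ (suc i) + prod as 0ℤ i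
  prod-step a as i = lin-*ˢ (0ℤ - a) (prod as 0ℤ) i

  module _ (a b c : ℤ) where
    private
      pair₁ : prod (b ∷ c ∷ []) 0ℤ 1 ≡ (0ℤ - b) * ((0ℤ - c) * 0ℤ + 1ℤ) + (0ℤ - c) * 1ℤ
      pair₁ = trans (prod-step b (c ∷ []) 0) (cong (λ w → (0ℤ - b) * w + (0ℤ - c) * 1ℤ) (prod-step c [] 0))

      pair₂ : prod (b ∷ c ∷ []) 0ℤ 2 ≡ (0ℤ - b) * ((0ℤ - c) * 0ℤ + 0ℤ) + ((0ℤ - c) * 0ℤ + 1ℤ)
      pair₂ = trans (prod-step b (c ∷ []) 1) (cong₂ (λ v w → (0ℤ - b) * v + w) (prod-step c [] 1) (prod-step c [] 0))

    cubic-coeff₂ : prod (a ∷ b ∷ c ∷ []) 0ℤ 2 ≡ - powerSum (a ∷ b ∷ c ∷ []) 1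
    cubic-coeff₂ = trans (prod-step a (b ∷ c ∷ []) 1) (trans (cong₂ (λ v w → (0ℤ - a) * v + w) pair₂ pair₁) (identity a b c))
      where
      identity : ∀ a b c → (0ℤ - a) * ((0ℤ - b) * ((0ℤ - c) * 0ℤ + 0ℤ) + ((0ℤ - c) * 0ℤ + 1ℤ))
        + ((0ℤ - b) * ((0ℤ - c) * 0ℤ + 1ℤ) + (0ℤ - c) * 1ℤ) ≡ - (a * 1ℤ + (b * 1ℤ + (c * 1ℤ + 0ℤ)))
      identity = solve-∀

    cubic-coeff₁ : + 2 * prod (a ∷ b ∷ c ∷ []) 0ℤ 1 ≡
      powerSum (a ∷ b ∷ c ∷ []) 1 * powerSum (a ∷ b ∷ c ∷ []) 1 - powerSum (a ∷ b ∷ c ∷ []) 2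
    cubic-coeff₁ = trans (cong (λ w → + 2 * w) (trans (prod-step a (b ∷ c ∷ []) 0)
        (cong (λ v → (0ℤ - a) * v + (0ℤ - b) * ((0ℤ - c) * 1ℤ)) pair₁))) (identity a b c)
      where
      identity : ∀ a b c → + 2 * ((0ℤ - a) * ((0ℤ - b) * ((0ℤ - c) * 0ℤ + 1ℤ) + (0ℤ - c) * 1ℤ) + (0ℤ - b) * ((0ℤ - c) * 1ℤ)) ≡
        (a * 1ℤ + (b * 1ℤ + (c * 1ℤ + 0ℤ))) * (a * 1ℤ + (b * 1ℤ + (c * 1ℤ + 0ℤ)))
        - (a * (a * 1ℤ) + (b * (b * 1ℤ) + (c * (c * 1ℤ) + 0ℤ)))
      identity = solve-∀

  private
    cubic-coefficients : ∀ A → length A ≡ 3 → powerSum A 1 ≈ 0ℤ →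
      prod A 0ℤ 2 ≈ 0ℤ × + 2 * prod A 0ℤ 1 ≈ - powerSum A 2
    cubic-coefficients (a ∷ b ∷ c ∷ []) refl s≈0 =
      ≈-trans (≈-reflexive (cubic-coeff₂ a b c)) (neg-cong s≈0) ,
      ≈-trans (≈-reflexive (cubic-coeff₁ a b c))
        (conclude (identity (powerSum (a ∷ b ∷ c ∷ []) 1) (powerSum (a ∷ b ∷ c ∷ []) 2)) (powerSum (a ∷ b ∷ c ∷ []) 1 · s≈0))
      where
      identity : ∀ s t → (s * s - t) - - t ≡ s * (s - 0ℤ)
      identity = solve-∀

    cubic-scalar : ∀ P₀ P₁ P₂ Q₀ Q₁ Q₂ x y →
      + 3 * (+ 1 * (+ 2 * Q₂) * P₀ + + 1 * (+ 2 * P₂) * Q₀) + - (+ 2 * (+ 3 - + 1)) * (+ 1 * P₁ * (+ 1 * Q₁)) ≈ 0ℤ →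
      P₂ ≈ 0ℤ → Q₂ ≈ 0ℤ → + 2 * P₁ ≈ - x → + 2 * Q₁ ≈ - y → x * y ≈ 0ℤ
    cubic-scalar P₀ P₁ P₂ Q₀ Q₁ Q₂ x y e₁ e₂ e₃ e₄ e₅ = conclude (identity P₀ P₁ P₂ Q₀ Q₁ Q₂ x y)
      ((- 1ℤ) · e₁ ⊕ (+ 6 * Q₀) · e₂ ⊕ (+ 6 * P₀) · e₃ ⊕ y · e₄ ⊕ (- (+ 2 * P₁)) · e₅)
      where
      identity : ∀ P₀ P₁ P₂ Q₀ Q₁ Q₂ x y → x * y - 0ℤ ≡
        (- 1ℤ) * (+ 3 * (+ 1 * (+ 2 * Q₂) * P₀ + + 1 * (+ 2 * P₂) * Q₀) + - (+ 2 * (+ 3 - + 1)) * (+ 1 * P₁ * (+ 1 * Q₁)) - 0ℤ)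
        + (+ 6 * Q₀) * (P₂ - 0ℤ) + (+ 6 * P₀) * (Q₂ - 0ℤ) + y * (+ 2 * P₁ - - x) + (- (+ 2 * P₁)) * (+ 2 * Q₁ - - y)
      identity = solve-∀

  -- For p = 19 the elimination degenerates, but then the sets have three elements and
  -- the constant coefficient of W at the common barycentre 0 is the product of the second power sums.
  cubic-product : ∀ {A B} → length A ≡ 3 → length B ≡ 3 → powerSum A 1 ≈ 0ℤ → powerSum B 1 ≈ 0ℤ →
    W (+ 3) (prod A 0ℤ) (prod B 0ℤ) 0 ≈ 0ℤ → powerSum A 2 * powerSum B 2 ≈ 0ℤ
  cubic-product {A} {B} |A|≡3 |B|≡3 sA sB w = cubic-scalar (P 0) (P 1) (P 2) (Q 0) (Q 1) (Q 2) (powerSum A 2) (powerSum B 2)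
    (≈-trans (≈-reflexive (sym (W-coeff₀ (+ 3) P Q))) w) (proj₁ coeffA) (proj₁ coeffB) (proj₂ coeffA) (proj₂ coeffB)
    where
    P Q : Series
    P = prod A 0ℤ
    Q = prod B 0ℤ
    coeffA : P 2 ≈ 0ℤ × + 2 * P 1 ≈ - powerSum A 2
    coeffA = cubic-coefficients A |A|≡3 sA
    coeffB : Q 2 ≈ 0ℤ × + 2 * Q 1 ≈ - powerSum B 2
    coeffB = cubic-coefficients B |B|≡3 sB

  -- Exclusion of every size n

  sum≤product : ∀ {n k} → 2 ≤ n → 2 ≤ k → n ℕ.+ k ≤ n ℕ.* k
  sum≤product {suc n} {k} (s≤s 1≤n) 2≤k = ℕₚ.≤-trans (ℕₚ.≤-reflexive (ℕₚ.+-comm (suc n) k))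
    (ℕₚ.+-monoʳ-≤ k (ℕₚ.≤-trans (ℕₚ.≤-trans (ℕₚ.+-monoˡ-≤ n 1≤n) (ℕₚ.≤-reflexive double)) (ℕₚ.*-monoʳ-≤ n 2≤k)))
    where
    double : n ℕ.+ n ≡ n ℕ.* 2
    double = trans (cong (n ℕ.+_) (sym (ℕₚ.+-identityʳ n))) (ℕₚ.*-comm 2 n)

  module Centred {a as b bs m′} (Δ : Decomposition (a ∷ as) (b ∷ bs) m′) (centred : powerSum (a ∷ as) 1 ≈ 0ℤ) where
    open Decomposition Δ
    open FromDecomposition Δ

    private
      A B : List ℤ
      A = a ∷ as
      B = b ∷ bs
      n k m : ℕ
      n = length A
      k = length B
      m = suc m′
      N K : ℤ
      N = + n
      K = + k

      module HB = PointExpansion configuration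
      module HA = PointExpansion (exchange configuration)

      nk≡m : n ℕ.* k ≡ m
      nk≡m = HB.n*k≡m

      +m≡NK : + m ≡ N * K
      +m≡NK = trans (cong +_ (sym nk≡m)) (ℤₚ.pos-* n k)

      disjoint : ∀ {a b} → a ∈ A → b ∈ B → b ≉ a
      disjoint a∈ b∈ e with square a∈ b∈
      ... | y , y≉0 , e′ = *-nonzero {y} {y} y≉0 y≉0 (≈-trans (≈-sym e′) (difference-zero e))

      n+k≤m : n ℕ.+ k ≤ m
      n+k≤m = subst (n ℕ.+ k ≤_) nk≡m (sum≤product 2≤|A| 2≤|B|)

      n+1≤m : n ℕ.+ 1 ≤ m
      n+1≤m = ℕₚ.≤-trans (ℕₚ.+-monoʳ-≤ n (s≤s z≤n)) n+k≤m

      k+1≤m : k ℕ.+ 1 ≤ m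
      k+1≤m = ℕₚ.≤-trans (ℕₚ.+-monoʳ-≤ k (s≤s z≤n)) (subst (_≤ m) (ℕₚ.+-comm n k) n+k≤m)

      localB : ∀ {b} → b ∈ B → N * (N + + 1) * (prod B b 2 * prod A b 0) ≈ (N * K - + 1) * (prod A b 1 * prod B b 1)
      localB {b} b∈ = subst (λ M → N * (N + + 1) * (prod B b 2 * prod A b 0) ≈ (M - + 1) * (prod A b 1 * prod B b 1))
        +m≡NK (first-order (HB.expansion b∈) n+1≤m)

      localA : ∀ {a} → a ∈ A → K * (K + + 1) * (prod A a 2 * prod B a 0) ≈ (N * K - + 1) * (prod B a 1 * prod A a 1)
      localA {a} a∈ = subst (λ M → K * (K + + 1) * (prod A a 2 * prod B a 0) ≈ (M - + 1) * (prod B a 1 * prod A a 1))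
        +m≡NK (first-order (HA.expansion a∈) k+1≤m)

      m≥3 : 3 ≤ m
      m≥3 = ℕₚ.≤-trans (s≤s (s≤s (s≤s z≤n))) (ℕₚ.≤-trans (ℕₚ.+-mono-≤ 2≤|A| 2≤|B|) n+k≤m)

      -- The one bound that makes units of all positive integers cancelled in `Equal`, up to n + k +
      -- 2; it comes from n + k ≤ m, 2 ≤ m and p = 1 + 2 m.
      size : n ℕ.+ k ℕ.+ 2 < p
      size = subst (n ℕ.+ k ℕ.+ 2 <_) (sym p≡1+2m)
        (s≤s (ℕₚ.+-mono-≤ n+k≤m (ℕₚ.≤-trans (ℕₚ.n≤1+n 2) m≥3)))

      n<m : ∀ {i} → i ≤ n → i < m
      n<m i≤n = ℕₚ.≤-trans (s≤s i≤n) (ℕₚ.≤-trans (ℕₚ.≤-reflexive (ℕₚ.+-comm 1 n)) n+1≤m)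

      module E = Equal A-distinct B-distinct disjoint localB localA 2≤|A| 2≤|B| size
        (λ i 0<i i≤n → difference-powerSum nk≡m i 0<i (n<m i≤n)) centred

      open E.Leading E.leading

      m≡n² : m ≡ n ℕ.* n
      m≡n² = trans (sym nk≡m) (cong (n ℕ.*_) (sym n≡k))

      p≡ : p ≡ suc (n ℕ.* n ℕ.+ n ℕ.* n)
      p≡ = trans p≡1+2m (cong (λ m → suc (m ℕ.+ m)) m≡n²)

      2N²+1≈0 : + 2 * (N * N) + + 1 ≈ 0ℤ
      2N²+1≈0 = by 1ℤ (trans (identity (N * N))
        (cong (λ w → 0ℤ + 1ℤ * w) (trans (cong (λ w → + 1 + (w + w)) (sym (ℤₚ.pos-* n n))) (cong +_ (sym p≡)))))
        where
        identity : ∀ x → + 2 * x + + 1 ≡ 0ℤ + 1ℤ * (+ 1 + (x + x))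
        identity = solve-∀

      1+n<p : suc n < p
      1+n<p = ℕₚ.≤-<-trans (ℕₚ.≤-trans (ℕₚ.≤-reflexive (ℕₚ.+-comm 1 n))
        (ℕₚ.≤-trans (ℕₚ.+-monoʳ-≤ n (s≤s z≤n)) (ℕₚ.m≤m+n (n ℕ.+ k) 2))) size

      module B₃ (3≤n : 3 ≤ n) = Balanced {A} {B} {n} refl (sym n≡k) A-distinct B-distinct disjoint
        (λ {b} b∈ → subst (λ m → Expansion n m (prod A b) (prod B b)) m≡n² (HB.expansion b∈))
        (λ {a} a∈ → subst₂ (λ n m → Expansion n m (prod B a) (prod A a)) (sym n≡k) m≡n² (HA.expansion a∈))
        3≤n 1+n<p 2N²+1≈0

      -- The leading index is even with 1 < j ≤ 3, hence 2. `power-relation` carries the nonzero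
      -- second power sum from A to B, against `cubic-product`.
      cubic : n ≡ 3 → ⊥
      cubic n≡3 = second-order j 1<j (subst (j ≤_) n≡3 j≤n) even pA≉0
        where
        K≉0 : K ≉ 0ℤ
        K≉0 = positive-nonzero (s≤s z≤n) (ℕₚ.≤-<-trans (ℕₚ.≤-trans (ℕₚ.m≤n+m k n) (ℕₚ.m≤m+n (n ℕ.+ k) 2)) size)
        vA : Vanishing A 2
        vA (suc zero) _ _ = centred
        vA (suc (suc _)) _ (s≤s (s≤s ()))
        vB : Vanishing B 2
        vB = E.transfer 2 (ℕₚ.m≤n⇒m≤1+n 2≤|A|) vA
        second-order : ∀ j → 1 < j → j ≤ 3 → sgn j ≡ 1ℤ → powerSum A j ≉ 0ℤ → ⊥
        second-order (suc zero) (s≤s ())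
        second-order (suc (suc zero)) _ _ _ x≉0 = *-nonzero {powerSum A 2} {powerSum B 2} x≉0 y≉0
          (cubic-product {A} {B} n≡3 (trans (sym n≡k) n≡3) centred (vB 1 (s≤s z≤n) (s≤s (s≤s z≤n)))
            (subst (λ n → W (+ n) (prod A 0ℤ) (prod B 0ℤ) 0 ≈ 0ℤ) n≡3
              (≋0⇒ (B₃.W-zero (ℕₚ.≤-reflexive (sym n≡3)) 0ℤ) 0)))
          where
          y≉0 : powerSum B 2 ≉ 0ℤ
          y≉0 y≈0 = *-nonzero {K} {powerSum A 2} K≉0 x≉0 (conclude (identity N K (powerSum A 2) (powerSum B 2))
            (1ℤ · E.power-relation 2 (s≤s z≤n) 2≤|A| vB ⊕ (- N) · y≈0))
            where
            identity : ∀ N K x y → K * x - 0ℤ ≡ 1ℤ * (y * N + 1ℤ * (K * x) - 0ℤ) + (- N) * (y - 0ℤ)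
            identity = solve-∀
        second-order (suc (suc (suc zero))) _ _ ()
        second-order (suc (suc (suc (suc _)))) _ (s≤s (s≤s (s≤s ())))

      -- With p = 2 n² + 1, n = 2 gives the composite 9, n = 3 gives 19, and n ≥ 4 gives p ≥ 33,
      -- where the elimination applies.
      by-size : ∀ l → n ≡ l → ⊥
      by-size 0 ()
      by-size 1 n≡1 = ℕₚ.<-irrefl (sym n≡1) 2≤|A|
      by-size 2 n≡2 = from-no (prime? 9) (subst Prime (trans p≡ (cong (λ n → suc (n ℕ.* n ℕ.+ n ℕ.* n)) n≡2)) p-prime)
      by-size 3 n≡3 = cubic n≡3
      by-size (suc (suc (suc (suc l)))) n≡l = B₃.contradiction (ℕₚ.≤-trans (ℕₚ.n≤1+n 3) 4≤n) 19<p (here refl)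
        where
        4≤n : 4 ≤ n
        4≤n = subst (4 ≤_) (sym n≡l) (s≤s (s≤s (s≤s (s≤s z≤n))))
        16≤n² : 16 ≤ n ℕ.* n
        16≤n² = ℕₚ.*-mono-≤ 4≤n 4≤n
        19<p : 19 < p
        19<p = subst (19 <_) (sym p≡) (s≤s (ℕₚ.≤-trans (ℕₚ.m≤m+n 19 13) (ℕₚ.+-mono-≤ 16≤n² 16≤n²)))

    absurd : ⊥
    absurd = by-size n refl

  no-decomposition : ∀ {A B m′} → Decomposition A B m′ → ⊥
  no-decomposition {[]} Δ with Decomposition.2≤|A| Δ
  ... | ()
  no-decomposition {_ ∷ _} {[]} Δ with Decomposition.2≤|B| Δ
  ... | ()
  no-decomposition {A@(_ ∷ _)} {B@(_ ∷ _)} Δ = Centred.absurd (shift c Δ) centred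
    where
    open FromDecomposition Δ
    N c : ℤ
    N = + length A
    -- The barycentre of A; translating both sets by it keeps all differences.
    c = inv N * powerSum A 1
    N≉0 : N ≉ 0ℤ
    N≉0 = positive-nonzero (s≤s z≤n) (PointExpansion.n<p configuration)
    centred : powerSum (map (λ x → x - c) A) 1 ≈ 0ℤ
    centred = ≈-trans (≈-reflexive (trans (sum-map (λ x → x - c) A (_^ 1))
        (trans (sum-cong-≡ A (λ x → split x c)) (trans (sum-+ A (_^ 1) (λ x → (- c) * x ^ 0))
          (cong (λ w → powerSum A 1 + w) (trans (sum-scale A (- c) (_^ 0)) (cong (λ w → (- c) * w) (powerSum-0 A))))))))
      (conclude (identity (powerSum A 1) (inv N) N) ((- powerSum A 1) · inv-inverse N≉0))
      where
      split : ∀ x c → (x - c) * 1ℤ ≡ x * 1ℤ + (- c) * 1ℤ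
      split = solve-∀
      identity : ∀ s i N → (s + (- (i * s)) * N) - 0ℤ ≡ (- s) * (N * i - 1ℤ)
      identity = solve-∀


-- Subsets of the integers modulo p

open AllPairs using (AllPairs; []; _∷_)
open import Data.Bool using (true; false)
open import Data.Fin using (Fin; zero; suc; toℕ; fromℕ<)
open import Data.Fin.Properties using (toℕ<n; toℕ-fromℕ<; toℕ-injective)
open import Data.Fin.Subset using () renaming (_∈_ to _∈ˢ_)
open import Data.Nat.Divisibility using (m%n≡0⇒n∣m)
open import Data.Nat.DivMod using (_%_; _/_; _mod_; m%n<n; m≡m%n+[m/n]*n)
open import Data.Nat.Primality using (prime⇒irreducible)
open import Data.Vec using (here; there; []; _∷_)
open import Relation.Binary.PropositionalEquality using (_≢_)

elements : ∀ {n} → Subset n → List (Fin n)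
elements []          = []
elements (true ∷ A)  = zero ∷ map suc (elements A)
elements (false ∷ A) = map suc (elements A)

length-elements : ∀ {n} (A : Subset n) → length (elements A) ≡ ∣ A ∣
length-elements []          = refl
length-elements (true ∷ A)  = cong ℕ.suc (trans (length-map suc (elements A)) (length-elements A))
length-elements (false ∷ A) = trans (length-map suc (elements A)) (length-elements A)

∈-elements⁺ : ∀ {n} {A : Subset n} {i} → i ∈ˢ A → i ∈ elements A
∈-elements⁺ {A = true ∷ A}  here       = here refl
∈-elements⁺ {A = true ∷ A}  (there i∈) = there (∈-map⁺ suc (∈-elements⁺ i∈))
∈-elements⁺ {A = false ∷ A} (there i∈) = ∈-map⁺ suc (∈-elements⁺ i∈)

∈-elements⁻ : ∀ {n} (A : Subset n) {i} → i ∈ elements A → i ∈ˢ A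
∈-elements⁻ (true ∷ A)  (here refl) = here
∈-elements⁻ (true ∷ A)  (there i∈) with ∈-map⁻ suc i∈
... | _ , j∈ , refl = there (∈-elements⁻ A j∈)
∈-elements⁻ (false ∷ A) i∈ with ∈-map⁻ suc i∈
... | _ , j∈ , refl = there (∈-elements⁻ A j∈)

-- Strict order of representatives is the form of distinctness that `naturals-distinct` carries over
-- to residues.
elements-increasing : ∀ {n} (A : Subset n) → AllPairs (λ i j → toℕ i < toℕ j) (elements A)
elements-increasing []          = []
elements-increasing (true ∷ A)  = Allₚ.map⁺ (All.tabulate (λ _ → s≤s z≤n)) ∷
  AllPairsₚ.map⁺ (AllPairs.map s≤s (elements-increasing A))
elements-increasing (false ∷ A) = AllPairsₚ.map⁺ (AllPairs.map s≤s (elements-increasing A))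

odd-prime : ∀ {p} → Prime p → p ≢ 2 → ∃ λ m′ → p ≡ ℕ.suc (ℕ.suc m′ ℕ.+ ℕ.suc m′)
odd-prime {p} p-prime p≢2 with p % 2 | m%n<n p 2 | m≡m%n+[m/n]*n p 2 | m%n≡0⇒n∣m p 2
... | 0 | _ | _ | even with prime⇒irreducible p-prime (even refl)
...   | inj₂ 2≡p = ⊥-elim (p≢2 (sym 2≡p))
odd-prime {p} p-prime p≢2 | 1 | _ | e | _ with p / 2
...   | 0 = ⊥-elim (¬prime[1] (subst Prime e p-prime))
...   | ℕ.suc m′ = m′ , trans e (cong ℕ.suc (trans (ℕₚ.*-comm (ℕ.suc m′) 2) (cong (ℕ.suc m′ ℕ.+_) (ℕₚ.+-identityʳ _))))
odd-prime {p} p-prime p≢2 | ℕ.suc (ℕ.suc _) | s≤s (s≤s ()) | _ | _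

module OddPrime (p : ℕ) (p-prime : Prime p) where
  open Residues p p-prime

  value : Fin p → ℤ
  value i = + toℕ i

  value-mod : ∀ x → value (x mod p) ≈ + x
  value-mod x = ≈-trans (≈-reflexive (cong +_ (toℕ-fromℕ< (m%n<n x p)))) (≈-sym (residue-≈ (+ x)))

  value-+ : ∀ i j → value (_+ₚ_ p i j) ≈ value i + value j
  value-+ i j = value-mod (toℕ i ℕ.+ toℕ j)

  value-* : ∀ i j → value (_*ₚ_ p i j) ≈ value i * value j
  value-* i j = ≈-trans (value-mod (toℕ i ℕ.* toℕ j)) (≈-reflexive (ℤₚ.pos-* (toℕ i) (toℕ j)))

  value-zero : value (zeroₚ p) ≈ 0ℤ
  value-zero = value-mod 0

  value-injective : ∀ {i j} → value i ≈ value j → i ≡ j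
  value-injective {i} {j} e with ℕₚ.<-cmp (toℕ i) (toℕ j)
  ... | tri< i<j _ _ = ⊥-elim (naturals-distinct i<j (toℕ<n j) e)
  ... | tri≈ _ i≡j _ = toℕ-injective i≡j
  ... | tri> _ _ j<i = ⊥-elim (naturals-distinct j<i (toℕ<n i) (≈-sym e))

  module _ {m′} (p≡1+2m : p ≡ ℕ.suc (ℕ.suc m′ ℕ.+ ℕ.suc m′)) (A B : Subset p)
    (1<|A| : 1 < ∣ A ∣) (1<|B| : 1 < ∣ B ∣) (decomposed : QRIsSumset p A B) where

    private
      As Bs : List ℤ
      As = map (λ i → - value i) (elements A)
      Bs = map value (elements B)

      distinct-values : ∀ C → AllPairs (λ i j → value i ≉ value j) (elements C)
      distinct-values C = AllPairs.map (λ {i} {j} i<j → naturals-distinct i<j (toℕ<n j)) (elements-increasing C)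

      difference : ∀ x y → y - - x ≡ x + y
      difference = solve-∀

      square-of : ∀ {a b} → (∃ λ i → i ∈ elements A × a ≡ - value i) →
        (∃ λ j → j ∈ elements B × b ≡ value j) → ∃ λ y → y ≉ 0ℤ × b - a ≈ y * y
      square-of (i , i∈ , refl) (j , j∈ , refl) with proj₂ decomposed i j (∈-elements⁻ A i∈) (∈-elements⁻ B j∈)
      ... | x≢0 , y , y²≡x = value y , y≉0 , ≈-trans (≈-reflexive (difference (value i) (value j)))
          (≈-trans (≈-sym (value-+ i j)) x≈y²)
        where
        x≈y² : value (_+ₚ_ p i j) ≈ value y * value y
        x≈y² = ≈-trans (≈-reflexive (cong value (sym y²≡x))) (value-* y y)
        y≉0 : value y ≉ 0ℤ
        y≉0 y≈0 = x≢0 (value-injective (≈-trans x≈y² (≈-trans (*-zeroʳ (value y) y≈0) (≈-sym value-zero))))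

      covering : ∀ y → y ≉ 0ℤ → ∃ λ a → ∃ λ b → a ∈ As × b ∈ Bs × y * y ≈ b - a
      covering y y≉0 = cover (proj₁ decomposed (_*ₚ_ p r r) (nonzero , r , refl))
        where
        r : Fin p
        r = fromℕ< (n%ℕd<d y p)
        r≈y : value r ≈ y
        r≈y = ≈-trans (≈-reflexive (cong +_ (toℕ-fromℕ< (n%ℕd<d y p)))) (≈-sym (residue-≈ y))
        r²≈y² : value (_*ₚ_ p r r) ≈ y * y
        r²≈y² = ≈-trans (value-* r r) (*-cong r≈y r≈y)
        nonzero : _*ₚ_ p r r ≢ zeroₚ p
        nonzero e = *-nonzero {y} {y} y≉0 y≉0
          (≈-trans (≈-sym r²≈y²) (≈-trans (≈-reflexive (cong value e)) value-zero))
        cover : (∃ λ i → ∃ λ j → i ∈ˢ A × j ∈ˢ B × _+ₚ_ p i j ≡ _*ₚ_ p r r) →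
          ∃ λ a → ∃ λ b → a ∈ As × b ∈ Bs × y * y ≈ b - a
        cover (i , j , i∈ , j∈ , e) = - value i , value j , ∈-map⁺ (λ i → - value i) (∈-elements⁺ i∈) ,
          ∈-map⁺ value (∈-elements⁺ j∈) ,
          ≈-trans (≈-sym r²≈y²) (≈-trans (≈-reflexive (cong value (sym e)))
            (≈-trans (value-+ i j) (≈-reflexive (sym (difference (value i) (value j))))))

    not-sumset : ⊥
    not-sumset = no-decomposition {As} {Bs} {m′} record
      { A-distinct = AllPairsₚ.map⁺ (AllPairs.map negated (distinct-values A))
      ; B-distinct = AllPairsₚ.map⁺ (distinct-values B)
      ; p≡1+2m = p≡1+2m
      ; 2≤|A| = subst (1 <_) (sym (trans (length-map _ (elements A)) (length-elements A))) 1<|A|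
      ; 2≤|B| = subst (1 <_) (sym (trans (length-map _ (elements B)) (length-elements B))) 1<|B|
      ; square = λ a∈ b∈ → square-of (∈-map⁻ (λ i → - value i) a∈) (∈-map⁻ value b∈)
      ; covered = covering
      }
      where
      negated : ∀ {i j} → value i ≉ value j → - value i ≉ - value j
      negated {i} {j} i≉j e = i≉j (conclude (identity (value i) (value j)) ((- 1ℤ) · e))
        where
        identity : ∀ x y → x - y ≡ (- 1ℤ) * (- x - - y)
        identity = solve-∀

-- Modulo 2 both summands are the whole field, so 0 + 0 = 0 would have to be a nonzero square.
zero-in-full : (A : Subset 2) → 1 < ∣ A ∣ → zero ∈ˢ A
zero-in-full (true ∷ _)           _ = here
zero-in-full (false ∷ true ∷ [])  (s≤s ())
zero-in-full (false ∷ false ∷ []) ()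

theorem3 : (p : ℕ) .{{_ : NonZero p}} → Prime p →
    (A B : Subset p) → 1 < ∣ A ∣ → 1 < ∣ B ∣ → ¬ QRIsSumset p A B
theorem3 p p-prime A B 1<|A| 1<|B| decomposed with p ℕₚ.≟ 2
... | yes refl = proj₁ (proj₂ decomposed zero zero (zero-in-full A 1<|A|) (zero-in-full B 1<|B|)) refl
... | no p≢2 with odd-prime p-prime p≢2
...   | m′ , p≡1+2m = OddPrime.not-sumset p p-prime p≡1+2m A B 1<|A| 1<|B| decomposed
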